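{- In the offline interval scheduling problem with $m$ identical machines, suppose that interval weights take values from a set of $k$ distinct positive weights. Then there is a polynomial-time algorithm $\mathrm{ALG}$ that outputs an EF1 schedule and whose price of fairness is at most $\tfrac32k$; that is, for every such instance $\mathcal I$, $$w(\mathrm{OPT}(\mathcal I))\;\le\;\tfrac32\,k\; w(\mathrm{ALG}(\mathcal I)).$$
   Context: An instance $\mathcal I$ is a finite indexed family of intervals $I_1,\dots,I_n$ (identical intervals may occur several times). Interval $I_j$ has a start time $s_j$ and an end time $e_j$, $s_j<e_j$, both nonnegative rationals, and a weight $w(I_j)$; it is identified with the half-open set $[s_j,e_j)$. Two intervals overlap (conflict) if these sets intersect. Machines are $1,\dots,m$. A schedule assigns a subset of the intervals to machines (each accepted interval to exactly one machine; intervals may be left unassigned) so that no two intervals on the same machine overlap. $S_i$ is the set of intervals assigned to machine $i$; $w(X)=\sum_{I\in X}w(I)$ is the total weight of a set $X$ of intervals, and the weight of a schedule is the total weight of its assigned intervals. $\mathrm{OPT}(\mathcal I)$ is a schedule of maximum total weight, with no fairness requirement. A schedule is EF1 (envy-free up to one interval) if for every pair of machines $i\ne k'$ with $S_{k'}\neq\emptyset$ there is $I\in S_{k'}$ such that $w(S_i)\ge w(S_{k'})-w(I)$. Offline means the algorithm is given the whole instance in advance. The price of fairness of an offline EF1 algorithm is the smallest $\alpha$ such that $w(\mathrm{OPT}(\mathcal I))\le\alpha\,w(\mathrm{ALG}(\mathcal I))$ for every instance $\mathcal I$ under consideration. -}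

module Defs where

open import Data.Bool.Base using (if_then_else_)
open import Data.Digit using (toNatDigits)
open import Data.Fin.Base using (Fin; toℕ)
import Data.Fin.Properties as Fin
open import Data.Fin.Subset using (Subset; _∈_; Nonempty)
open import Data.Integer.Base using (ℤ; +_; -[1+_])
open import Data.List.Base as List using (List; []; _∷_)
open import Data.Maybe.Base using (Maybe; just; nothing; is-just)
import Data.Maybe.Properties as Maybe
open import Data.Nat.Base as ℕ using (ℕ; suc; _≤ᵇ_)
open import Data.Nat.Logarithm using (⌊log₂_⌋)
open import Data.Product.Base using (∃; _×_; _,_)
open import Data.Rational.Base as ℚ using (ℚ; 0ℚ)
import Data.Rational.Properties as ℚ
open import Data.Sum.Base using (_⊎_; inj₁; inj₂)
open import Data.Unit.Base using (⊤; tt)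
open import Data.Vec.Base using (lookup; tabulate)
open import Data.Vec.Functional using (Vector)
open import Relation.Binary.PropositionalEquality using (_≡_; _≢_)
open import Relation.Nullary using (¬_; does)

open import Algebra.Properties.CommutativeMonoid.Sum ℚ.+-0-commutativeMonoid
  using (sum)

------------------------------------------------------------------------
-- Interval scheduling

record Interval : Set where
  field
    start end   : ℚ
    weight      : ℚ
    start≥0     : 0ℚ ℚ.≤ start
    start<end   : start ℚ.< end

open Interval public

-- The half-open set [ start , end ).  Two such sets of reals with rational
-- endpoints meet iff they meet in a rational point.

_∈ᴵ_ : ℚ → Interval → Set
t ∈ᴵ I = (start I ℚ.≤ t) × (t ℚ.< end I)

Overlap : Interval → Interval → Set
Overlap I J = ∃ λ t → (t ∈ᴵ I) × (t ∈ᴵ J)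

Instance : ℕ → Set
Instance n = Vector Interval n

record Schedule (m : ℕ) {n : ℕ} (ℐ : Instance n) : Set where
  field
    assign    : Fin n → Maybe (Fin m)
    noOverlap : ∀ {i j x} → i ≢ j → assign i ≡ just x → assign j ≡ just x →
                ¬ Overlap (ℐ i) (ℐ j)

open Schedule public

w : ∀ {n} → Instance n → Subset n → ℚ
w ℐ X = sum (λ j → if lookup X j then weight (ℐ j) else 0ℚ)

module _ {m n : ℕ} {ℐ : Instance n} (S : Schedule m ℐ) where

  machine : Fin m → Subset n
  machine i = tabulate (λ j → does (Maybe.≡-dec Fin._≟_ (assign S j) (just i)))

  assigned : Subset n
  assigned = tabulate (λ j → is-just (assign S j))

  scheduleWeight : ℚ
  scheduleWeight = w ℐ assigned

  EF1 : Set
  EF1 = ∀ i k → i ≢ k → Nonempty (machine k) →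
        ∃ λ j → (j ∈ machine k) ×
                (w ℐ (machine i) ℚ.≥ w ℐ (machine k) ℚ.- weight (ℐ j))

Optimal : ∀ {m n} {ℐ : Instance n} → Schedule m ℐ → Set
Optimal {m} {ℐ = ℐ} O =
  ∀ (T : Schedule m ℐ) → scheduleWeight T ℚ.≤ scheduleWeight O

------------------------------------------------------------------------
-- Programs and their running time
--
-- A first-order language of loop programs over pairs, sums, lists and
-- natural numbers, with the logarithmic cost criterion for arithmetic:
-- data are held by reference, so a structural step costs 1, while an
-- arithmetic step costs the binary length of its operands.  Up to a
-- polynomial this is the running time on a random-access or Turing machine.

infixr 7 _⊗_
infixr 6 _⊕_

data Ty : Set where
  unit nat : Ty
  _⊗_ _⊕_  : Ty → Ty → Ty
  list     : Ty → Ty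

bool : Ty
bool = unit ⊕ unit

⟦_⟧ : Ty → Set
⟦ unit ⟧   = ⊤
⟦ nat ⟧    = ℕ
⟦ A ⊗ B ⟧  = ⟦ A ⟧ × ⟦ B ⟧
⟦ A ⊕ B ⟧  = ⟦ A ⟧ ⊎ ⟦ B ⟧
⟦ list A ⟧ = List ⟦ A ⟧

infixr 5 _⟫_

data Prog : Ty → Ty → Set where
  id             : ∀ {A} → Prog A A
  _⟫_            : ∀ {A B C} → Prog A B → Prog B C → Prog A C
  ⟨_,_⟩          : ∀ {A B C} → Prog A B → Prog A C → Prog A (B ⊗ C)
  fst            : ∀ {A B} → Prog (A ⊗ B) A
  snd            : ∀ {A B} → Prog (A ⊗ B) B
  drop           : ∀ {A} → Prog A unit
  inl            : ∀ {A B} → Prog A (A ⊕ B)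
  inr            : ∀ {A B} → Prog B (A ⊕ B)
  branch         : ∀ {A B C D} → Prog (A ⊗ C) D → Prog (B ⊗ C) D →
                   Prog ((A ⊕ B) ⊗ C) D
  nil            : ∀ {A B} → Prog A (list B)
  cons           : ∀ {A} → Prog (A ⊗ list A) (list A)
  uncons         : ∀ {A} → Prog (list A) (unit ⊕ (A ⊗ list A))
  fold           : ∀ {A B C} → Prog C B → Prog (A ⊗ B ⊗ C) B →
                   Prog (list A ⊗ C) B
  lit            : ∀ {A} → ℕ → Prog A nat
  add monus mul  : Prog (nat ⊗ nat) nat
  leq            : Prog (nat ⊗ nat) bool
  bits           : Prog nat (list nat)

run : ∀ {A B} → Prog A B → ⟦ A ⟧ → ⟦ B ⟧
run id            x            = x
run (p ⟫ q)       x            = run q (run p x)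
run ⟨ p , q ⟩     x            = run p x , run q x
run fst           (x , y)      = x
run snd           (x , y)      = y
run drop          x            = tt
run inl           x            = inj₁ x
run inr           x            = inj₂ x
run (branch p q)  (inj₁ x , z) = run p (x , z)
run (branch p q)  (inj₂ y , z) = run q (y , z)
run nil           x            = []
run cons          (x , xs)     = x ∷ xs
run uncons        []           = inj₁ tt
run uncons        (x ∷ xs)     = inj₂ (x , xs)
run (fold p q)    (xs , z)     = List.foldr (λ x y → run q (x , y , z)) (run p z) xs
run (lit n)       x            = n
run add           (a , b)      = a ℕ.+ b
run monus         (a , b)      = a ℕ.∸ b
run mul           (a , b)      = a ℕ.* b
run leq           (a , b)      = if a ≤ᵇ b then inj₁ tt else inj₂ tt
run bits          a            = toNatDigits 2 a

bitLength : ℕ → ℕ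
bitLength n = suc ⌊log₂ n ⌋

-- Total time of the iterations of  foldr f e , where an iteration on the
-- element x with accumulator y takes time  t x y .

foldTime : {A B : Set} → (A → B → B) → (A → B → ℕ) → B → List A → ℕ
foldTime f t e []       = 0
foldTime f t e (x ∷ xs) =
  suc (t x (List.foldr f e xs) ℕ.+ foldTime f t e xs)

time : ∀ {A B} → Prog A B → ⟦ A ⟧ → ℕ
time (p ⟫ q)      x            = suc (time p x ℕ.+ time q (run p x))
time ⟨ p , q ⟩    x            = suc (time p x ℕ.+ time q x)
time (branch p q) (inj₁ x , z) = suc (time p (x , z))
time (branch p q) (inj₂ y , z) = suc (time q (y , z))
time (fold p q)   (xs , z)     =
  suc (time p z ℕ.+ foldTime (λ x y → run q (x , y , z))
                             (λ x y → time q (x , y , z)) (run p z) xs)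
time add          (a , b)      = suc (bitLength a ℕ.+ bitLength b)
time monus        (a , b)      = suc (bitLength a ℕ.+ bitLength b)
time mul          (a , b)      = suc (bitLength a ℕ.+ bitLength b)
time leq          (a , b)      = suc (bitLength a ℕ.+ bitLength b)
time bits         a            = suc (bitLength a)
time id           _            = 1
time fst          _            = 1
time snd          _            = 1
time drop         _            = 1
time inl          _            = 1
time inr          _            = 1
time nil          _            = 1
time cons         _            = 1
time uncons       _            = 1
time (lit n)      _            = 1

-- Length of a value written out in full, numbers in binary.

size : ∀ A → ⟦ A ⟧ → ℕ
size unit     _        = 1
size nat      n        = bitLength n
size (A ⊗ B)  (x , y)  = suc (size A x ℕ.+ size B y)
size (A ⊕ B)  (inj₁ x) = suc (size A x)
size (A ⊕ B)  (inj₂ y) = suc (size B y)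
size (list A) xs       = List.foldr (λ x s → suc (size A x ℕ.+ s)) 1 xs

PolynomialTime : ∀ {A B} → Prog A B → Set
PolynomialTime {A} p =
  ∃ λ c → ∃ λ d → ∀ (x : ⟦ A ⟧) → time p x ℕ.≤ c ℕ.* size A x ℕ.^ d

------------------------------------------------------------------------
-- Instances and schedules as data

rational : Ty
rational = (nat ⊕ nat) ⊗ nat

instanceTy : Ty
instanceTy = nat ⊗ list (rational ⊗ rational ⊗ rational)

-- The j-th entry is the machine of the j-th interval, if it is accepted.

scheduleTy : Ty
scheduleTy = list (unit ⊕ nat)

encodeℤ : ℤ → ⟦ nat ⊕ nat ⟧
encodeℤ (+ n)    = inj₁ n
encodeℤ -[1+ n ] = inj₂ n

encodeℚ : ℚ → ⟦ rational ⟧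
encodeℚ q = encodeℤ (ℚ.↥ q) , ℚ.↧ₙ q

encodeInstance : ∀ (m : ℕ) {n} → Instance n → ⟦ instanceTy ⟧
encodeInstance m ℐ =
  m , List.tabulate λ j →
        encodeℚ (start (ℐ j)) , encodeℚ (end (ℐ j)) , encodeℚ (weight (ℐ j))

encodeMachine : ∀ {m} → Maybe (Fin m) → ⟦ unit ⊕ nat ⟧
encodeMachine nothing  = inj₁ tt
encodeMachine (just i) = inj₂ (toℕ i)

encodeSchedule : ∀ {m n} {ℐ : Instance n} → Schedule m ℐ → ⟦ scheduleTy ⟧
encodeSchedule S = List.tabulate (λ j → encodeMachine (assign S j))

{-# OPTIONS --safe #-}
module Submission where

-- Among items of equal positive weight, EF1 means that the
-- numbers of items on the machines differ by at most one.  So it suffices to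
-- find for each of the k weights a schedule balanced in this sense with at
-- least two thirds of the maximum number of items of that weight; the
-- heaviest of these k schedules has at least 2 / (3 k) of the optimum.
--
-- Given m machines and items of one weight, the greedy schedule (latest start
-- first, best fit) accepts the maximum number N.  Let n = ⌈ 2 N / 3 ⌉.  Chains
-- of τ = ⌈ n / p ⌉ items are cut off one after the other, where n and p count
-- the items and machines that are still to be served: take a chain A with at
-- least τ items and, if there is one, a chain B with fewer than τ items.
-- Follow A up to the end t of one of its items and continue with what starts
-- after t in B.  As t runs through A, the number of items on the way increases
-- from length B to length A by at most one at a time, so that it is τ for some
-- t.  The rest, B up to t and then A, goes back to the pool, and only an item
-- of B that contains t is lost.  As B is empty for τ = 1 and missing in the
-- last step, at most min (p - 1 , n - p) items are lost, which is at most
-- N - n.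
--
-- Start and end times are replaced by the numbers of end times up to them,
-- which does not affect conflicts.

open import Defs
open import Data.Bool.Base using (Bool; true; false; if_then_else_; _∧_; not; T)
open import Data.Bool.Properties using (T?; T-≡)
open import Data.Empty using (⊥; ⊥-elim)
open import Data.Fin.Base as Fin using (Fin; zero; suc; toℕ)
import Data.Fin.Properties as Fin
open import Data.Integer.Base as ℤ using (-[1+_]) renaming (+_ to pos)
import Data.Integer.Properties as ℤ
open import Data.List.Base as List using (List; []; _∷_; foldr; length; map; concat; filterᵇ; _++_)
open import Data.List.Membership.Propositional using (_∈_)
open import Data.List.Membership.Propositional.Properties using (∈-tabulate⁺; ∈-tabulate⁻; ∈-filter⁻)
open import Data.List.Properties using (map-++; length-++; length-tabulate; tabulate-cong)
open import Data.List.Relation.Unary.All as All using (All; []; _∷_)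
import Data.List.Relation.Unary.All.Properties as All
open import Data.List.Relation.Unary.AllPairs as AllPairs using (AllPairs; []; _∷_)
import Data.List.Relation.Unary.AllPairs.Properties as AllPairs
open import Data.List.Relation.Unary.Any using (here; there)
open import Data.Maybe.Base as Maybe using (Maybe; just; nothing; is-just)
import Data.Maybe.Properties as Maybe
open import Data.Nat.Base
open import Data.Nat.DivMod using (m/n*n≤m; m≡m%n+[m/n]*n; m%n<n)
open import Data.Nat.ListAction using (sum)
open import Data.Nat.ListAction.Properties using (sum-++)
open import Data.Nat.Logarithm using (⌊log₂_⌋; ⌊log₂⌋-mono-≤; ⌊log₂[2^n]⌋≡n; ⌊log₂⌊n/2⌋⌋≡⌊log₂n⌋∸1)
open import Data.Nat.Properties
open import Data.Nat.Tactic.RingSolver using (solve-∀)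
open import Data.Product.Base using (∃; _×_; _,_; proj₁; proj₂)
import Data.Product.Properties as Product
open import Data.Rational.Base as ℚ using (ℚ; 0ℚ; 1ℚ; ½; mkℚ; *≤*; toℚᵘ)
import Data.Rational.Properties as ℚ
open import Data.Rational.Unnormalised.Base as ℚᵘ using (mkℚᵘ; *≡*)
import Data.Rational.Unnormalised.Properties as ℚᵘ
open import Data.Sum.Base using (_⊎_; inj₁; inj₂; [_,_])
open import Data.Unit.Base using (tt)
open import Data.Vec.Base as Vec using ()
open import Data.Vec.Functional using (Vector)
import Data.Vec.Properties as Vec
open import Function.Base using (_∘_; const)
open import Function.Bundles using (Equivalence)
open import Function.Definitions using (Injective)
open import Relation.Binary.Definitions using (DecidableEquality; Symmetric)
open import Relation.Binary.PropositionalEquality hiding ([_])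
open import Relation.Nullary using (¬_; Dec; does; yes; no)

open import Algebra.Properties.CommutativeMonoid.Sum +-0-commutativeMonoid using (∑-distrib-+) renaming (sum to ∑; sum-cong-≗ to ∑-cong)
open import Algebra.Properties.CommutativeMonoid.Sum ℚ.+-0-commutativeMonoid using () renaming (sum to sumℚ; sum-cong-≗ to sumℚ-cong; ∑-comm to sumℚ-swap)
open import Algebra.Properties.CommutativeSemigroup +-commutativeSemigroup using (x∙yz≈y∙xz)
open import Algebra.Solver.CommutativeMonoid +-0-commutativeMonoid using (Expr; solve; _⊜_) renaming (_⊕_ to _∔_; id to 𝟘)

-- The constant 2 / 3 is where the two bounds on the loss meet: if both p - 1 and n - p exceeded N -
-- n, their sum n - 1 would be at least 2 (N - n) + 2, so that 3 n ≥ 2 N + 3, which the choice of n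
-- just excludes.
--
-- Three obstacles shape the algorithm. The k weights are not part of the input, so every item
-- proposes the class of its own weight. The number m is given in binary and can be exponential in
-- the size of the input, so there are never more chains than items; the other machines stay empty,
-- which is fair because every chain then has at most one item. Finally, a loop of polynomially many
-- cheap rounds is polynomial only if its accumulator stays small. Therefore every function carries
-- a bound on the size of its result besides one on its time, and the rounds of the algorithm are
-- shown not to create data: they only move or drop items.

private variable
  A B C D : Ty
  S : Set

-- Binary length of sums and products

bitLength-mono : ∀ {a b} → a ≤ b → bitLength a ≤ bitLength b
bitLength-mono a≤b = s≤s (⌊log₂⌋-mono-≤ a≤b)

n<2^bitLength : ∀ n → n < 2 ^ bitLength n
n<2^bitLength n = ≰⇒> λ 2^≤n →
  <-irrefl refl (≤-trans (≤-reflexive (sym (⌊log₂[2^n]⌋≡n (bitLength n)))) (⌊log₂⌋-mono-≤ 2^≤n))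

-- The exponent is a successor because `bitLength 0` is 1.
n<2^k⇒bitLength≤k : ∀ n k → n < 2 ^ suc k → bitLength n ≤ suc k
n<2^k⇒bitLength≤k n k n<2^ = s≤s (log≤ n k n<2^)
  where
  half< : ∀ n m → n < 2 * m → ⌊ n /2⌋ < m
  half< n m n<2m = ≰⇒> λ m≤h → <⇒≱ n<2m
    (≤-trans (*-monoʳ-≤ 2 m≤h)
    (≤-trans (≤-reflexive (cong (⌊ n /2⌋ +_) (+-identityʳ _)))
    (≤-trans (+-monoʳ-≤ ⌊ n /2⌋ (⌊n/2⌋≤⌈n/2⌉ n)) (≤-reflexive (⌊n/2⌋+⌈n/2⌉≡n n)))))
  log≤ : ∀ n k → n < 2 ^ suc k → ⌊log₂ n ⌋ ≤ k
  log≤ zero          zero    _ = z≤n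
  log≤ (suc zero)    zero    _ = z≤n
  log≤ (suc (suc n)) zero    (s≤s (s≤s ()))
  log≤ n             (suc k) n<2^ = ≤-trans (m≤n+m∸n ⌊log₂ n ⌋ 1)
    (s≤s (≤-trans (≤-reflexive (sym (⌊log₂⌊n/2⌋⌋≡⌊log₂n⌋∸1 n))) (log≤ ⌊ n /2⌋ k (half< n (2 ^ suc k) n<2^))))

-- Common source of the bounds for sums and products: both lie below `suc a * suc b`, and each
-- factor is at most a power of two with the binary length as its exponent.
bitLength-< : ∀ a b n → n < suc a * suc b → bitLength n ≤ bitLength a + bitLength b
bitLength-< a b n n< = n<2^k⇒bitLength≤k n _ (<-≤-trans n<
  (≤-trans (*-mono-≤ (n<2^bitLength a) (n<2^bitLength b))
           (≤-reflexive (sym (^-distribˡ-+-* 2 (bitLength a) (bitLength b))))))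

bitLength-+ : ∀ a b → bitLength (a + b) ≤ bitLength a + bitLength b
bitLength-+ a b = bitLength-< a b (a + b)
  (s≤s (≤-trans (m≤m+n (a + b) (a * b)) (≤-reflexive (a+b+ab a b))))
  where a+b+ab : ∀ a b → a + b + a * b ≡ b + a * suc b
        a+b+ab = solve-∀

bitLength-* : ∀ a b → bitLength (a * b) ≤ bitLength a + bitLength b
bitLength-* a b = bitLength-< a b (a * b)
  (s≤s (≤-trans (m≤n+m (a * b) (a + b)) (≤-reflexive (a+b+ab a b))))
  where a+b+ab : ∀ a b → a + b + a * b ≡ b + a * suc b
        a+b+ab = solve-∀

bitLength-suc : ∀ n → bitLength (suc n) ≤ suc (bitLength n)
bitLength-suc n = ≤-trans (bitLength-+ 1 n) ≤-refl

-- Polynomial bounds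

infixr 6 _⊞_
infixr 7 _⊠_
infixr 8 _⊙_

-- Bounds are kept as syntax, which makes them monotone by construction and closed under the
-- composition that sequencing of programs demands. They are turned into the form c * n ^ d only at
-- the end.
data Pol : Set where
  con : ℕ → Pol
  X   : Pol
  _⊞_ _⊠_ _⊙_ : Pol → Pol → Pol

eval : Pol → ℕ → ℕ
eval (con c) n = c
eval X       n = n
eval (p ⊞ q) n = eval p n + eval q n
eval (p ⊠ q) n = eval p n * eval q n
eval (p ⊙ q) n = eval p (eval q n)

eval-mono : ∀ p {m n} → m ≤ n → eval p m ≤ eval p n
eval-mono (con c) m≤n = ≤-refl
eval-mono X       m≤n = m≤n
eval-mono (p ⊞ q) m≤n = +-mono-≤ (eval-mono p m≤n) (eval-mono q m≤n)
eval-mono (p ⊠ q) m≤n = *-mono-≤ (eval-mono p m≤n) (eval-mono q m≤n)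
eval-mono (p ⊙ q) m≤n = eval-mono p (eval-mono q m≤n)

eval≤monomial : ∀ p → ∃ λ c → ∃ λ d → ∀ n → 1 ≤ n → eval p n ≤ c * n ^ d
eval≤monomial (con c) = c , 0 , λ n _ → ≤-reflexive (sym (*-identityʳ c))
eval≤monomial X       = 1 , 1 , λ n _ → ≤-reflexive (sym (trans (*-identityˡ _) (*-identityʳ n)))
eval≤monomial (p ⊞ q) with eval≤monomial p | eval≤monomial q
... | c , d , p≤ | c′ , d′ , q≤ = c + c′ , d + d′ , λ { n@(suc _) 1≤n → begin
    eval p n + eval q n                       ≤⟨ +-mono-≤ (p≤ n 1≤n) (q≤ n 1≤n) ⟩
    c * n ^ d + c′ * n ^ d′                   ≤⟨ +-mono-≤ (*-monoʳ-≤ c (^-monoʳ-≤ n (m≤m+n d d′)))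
                                                          (*-monoʳ-≤ c′ (^-monoʳ-≤ n (m≤n+m d′ d))) ⟩
    c * n ^ (d + d′) + c′ * n ^ (d + d′)      ≡⟨ sym (*-distribʳ-+ (n ^ (d + d′)) c c′) ⟩
    (c + c′) * n ^ (d + d′)                   ∎ }
  where open ≤-Reasoning
eval≤monomial (p ⊠ q) with eval≤monomial p | eval≤monomial q
... | c , d , p≤ | c′ , d′ , q≤ = c * c′ , d + d′ , λ n 1≤n → begin
    eval p n * eval q n                       ≤⟨ *-mono-≤ (p≤ n 1≤n) (q≤ n 1≤n) ⟩
    (c * n ^ d) * (c′ * n ^ d′)               ≡⟨ [m*n]*[o*p]≡[m*o]*[n*p] c (n ^ d) c′ (n ^ d′) ⟩
    (c * c′) * (n ^ d * n ^ d′)               ≡⟨ cong (c * c′ *_) (sym (^-distribˡ-+-* n d d′)) ⟩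
    (c * c′) * n ^ (d + d′)                   ∎
  where open ≤-Reasoning
eval≤monomial (p ⊙ q) with eval≤monomial p | eval≤monomial q
-- The constant of `q` is raised to `suc c′`, so that the argument handed to the bound of `p` is at
-- least 1 even if `c′` is 0.
... | c , d , p≤ | c′ , d′ , q≤ = c * suc c′ ^ d , d′ * d , λ { n@(suc _) 1≤n → begin
    eval p (eval q n)                         ≤⟨ eval-mono p (≤-trans (q≤ n 1≤n) (*-monoˡ-≤ (n ^ d′) (n≤1+n c′))) ⟩
    eval p (suc c′ * n ^ d′)                  ≤⟨ p≤ _ (*-mono-≤ {1} {suc c′} {1} {n ^ d′} (s≤s z≤n) (m^n>0 n d′)) ⟩
    c * (suc c′ * n ^ d′) ^ d                 ≡⟨ cong (c *_) (^-distribʳ-* (suc c′) (n ^ d′) d) ⟩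
    c * (suc c′ ^ d * (n ^ d′) ^ d)           ≡⟨ cong (λ e → c * (suc c′ ^ d * e)) (^-*-assoc n d′ d) ⟩
    c * (suc c′ ^ d * n ^ (d′ * d))           ≡⟨ sym (*-assoc c _ _) ⟩
    c * suc c′ ^ d * n ^ (d′ * d)             ∎ }
  where
  open ≤-Reasoning
  ^-distribʳ-* : ∀ a b k → (a * b) ^ k ≡ a ^ k * b ^ k
  ^-distribʳ-* a b zero    = refl
  ^-distribʳ-* a b (suc k) = trans (cong (a * b *_) (^-distribʳ-* a b k)) ([m*n]*[o*p]≡[m*o]*[n*p] a b (a ^ k) (b ^ k))

-- Functions computed in polynomial time

size≥1 : ∀ A x → 1 ≤ size A x
size≥1 unit     _        = ≤-refl
size≥1 nat      _        = s≤s z≤n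
size≥1 (A ⊗ B)  _        = s≤s z≤n
size≥1 (A ⊕ B)  (inj₁ _) = s≤s z≤n
size≥1 (A ⊕ B)  (inj₂ _) = s≤s z≤n
size≥1 (list A) []       = ≤-refl
size≥1 (list A) (_ ∷ _)  = s≤s z≤n

length≤size : ∀ A xs → length xs ≤ size (list A) xs
length≤size A []       = z≤n
length≤size A (x ∷ xs) = s≤s (≤-trans (length≤size A xs) (m≤n+m _ (size A x)))

-- The bound on the size of the result is what makes this notion closed under composition: the time
-- of a second program is measured in the size of the intermediate value.
record Poly (A B : Ty) (f : ⟦ A ⟧ → ⟦ B ⟧) : Set where
  field
    prog         : Prog A B
    run≡         : ∀ x → run prog x ≡ f x
    timeB sizeB  : Pol
    time≤        : ∀ x → time prog x ≤ eval timeB (size A x)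
    size≤        : ∀ x → size B (f x) ≤ eval sizeB (size A x)

open Poly

polynomialTime : ∀ {A B f} (P : Poly A B f) → PolynomialTime (prog P)
polynomialTime {A} P with eval≤monomial (timeB P)
... | c , d , bound = c , d , λ x → ≤-trans (time≤ P x) (bound (size A x) (size≥1 A x))

basic : ∀ {A B} {f : ⟦ A ⟧ → ⟦ B ⟧} (p : Prog A B) → (∀ x → run p x ≡ f x) → (∀ x → time p x ≡ 1) →
        (S : Pol) → (∀ x → size B (f x) ≤ eval S (size A x)) → Poly A B f
basic p r t S s = record
  { prog = p ; run≡ = r ; timeB = con 1 ; sizeB = S ; time≤ = λ x → ≤-reflexive (t x) ; size≤ = s }

ext : ∀ {f g : ⟦ A ⟧ → ⟦ B ⟧} → Poly A B f → (∀ x → f x ≡ g x) → Poly A B g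
ext {A} {B} P f≡g = record
  { prog = prog P ; run≡ = λ x → trans (run≡ P x) (f≡g x) ; timeB = timeB P ; sizeB = sizeB P
  ; time≤ = time≤ P
  ; size≤ = λ x → subst (λ y → size B y ≤ eval (sizeB P) (size A x)) (f≡g x) (size≤ P x) }

idP : Poly A A (λ x → x)
idP = basic id (λ _ → refl) (λ _ → refl) X (λ _ → ≤-refl)

fstP : Poly (A ⊗ B) A proj₁
fstP = basic fst (λ _ → refl) (λ _ → refl) X (λ (x , y) → m≤n⇒m≤1+n (m≤m+n _ _))

sndP : Poly (A ⊗ B) B proj₂
sndP = basic snd (λ _ → refl) (λ _ → refl) X (λ (x , y) → m≤n⇒m≤1+n (m≤n+m _ _))

litP : ∀ n → Poly A nat (λ _ → n)
litP n = basic (lit n) (λ _ → refl) (λ _ → refl) (con (bitLength n)) (λ _ → ≤-refl)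

nilP : Poly A (list B) (λ _ → [])
nilP = basic nil (λ _ → refl) (λ _ → refl) (con 1) (λ _ → ≤-refl)

infixr 5 _⟫P_

_⟫P_ : ∀ {f : ⟦ A ⟧ → ⟦ B ⟧} {g : ⟦ B ⟧ → ⟦ C ⟧} → Poly A B f → Poly B C g → Poly A C (λ x → g (f x))
_⟫P_ {A} {B} {C} {f} {g} P Q = record
  { prog  = prog P ⟫ prog Q
  ; run≡  = λ x → trans (cong (run (prog Q)) (run≡ P x)) (run≡ Q (f x))
  ; timeB = con 1 ⊞ timeB P ⊞ timeB Q ⊙ sizeB P
  ; sizeB = sizeB Q ⊙ sizeB P
  ; time≤ = λ x → s≤s (+-mono-≤ (time≤ P x)
      (≤-trans (≤-reflexive (cong (time (prog Q)) (run≡ P x)))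
      (≤-trans (time≤ Q (f x)) (eval-mono (timeB Q) (size≤ P x)))))
  ; size≤ = λ x → ≤-trans (size≤ Q (f x)) (eval-mono (sizeB Q) (size≤ P x)) }

⟪_,_⟫ : ∀ {f : ⟦ A ⟧ → ⟦ B ⟧} {g : ⟦ A ⟧ → ⟦ C ⟧} → Poly A B f → Poly A C g → Poly A (B ⊗ C) (λ x → f x , g x)
⟪ P , Q ⟫ = record
  { prog  = ⟨ prog P , prog Q ⟩
  ; run≡  = λ x → cong₂ _,_ (run≡ P x) (run≡ Q x)
  ; timeB = con 1 ⊞ timeB P ⊞ timeB Q
  ; sizeB = con 1 ⊞ sizeB P ⊞ sizeB Q
  ; time≤ = λ x → s≤s (+-mono-≤ (time≤ P x) (time≤ Q x))
  ; size≤ = λ x → s≤s (+-mono-≤ (size≤ P x) (size≤ Q x)) }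

inlP : ∀ {f : ⟦ A ⟧ → ⟦ B ⟧} → Poly A B f → Poly A (B ⊕ C) (λ x → inj₁ (f x))
inlP P = _⟫P_ {g = inj₁} P (basic inl (λ _ → refl) (λ _ → refl) (con 1 ⊞ X) (λ _ → ≤-refl))

inrP : ∀ {f : ⟦ A ⟧ → ⟦ B ⟧} → Poly A B f → Poly A (C ⊕ B) (λ x → inj₂ (f x))
inrP P = _⟫P_ {g = inj₂} P (basic inr (λ _ → refl) (λ _ → refl) (con 1 ⊞ X) (λ _ → ≤-refl))

unitP : Poly A unit (λ _ → tt)
unitP = basic drop (λ _ → refl) (λ _ → refl) (con 1) (λ _ → ≤-refl)

consP : ∀ {f : ⟦ A ⟧ → ⟦ B ⟧} {g : ⟦ A ⟧ → List ⟦ B ⟧} → Poly A B f → Poly A (list B) g →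
        Poly A (list B) (λ x → f x ∷ g x)
consP P Q = _⟫P_ {g = λ (y , ys) → y ∷ ys} ⟪ P , Q ⟫ (basic cons (λ _ → refl) (λ _ → refl) X (λ _ → ≤-refl))

arith : ∀ {f g : ⟦ A ⟧ → ℕ} (h : ℕ → ℕ → ℕ) (p : Prog (nat ⊗ nat) nat) →
        (∀ a b → run p (a , b) ≡ h a b) → (∀ a b → time p (a , b) ≡ suc (bitLength a + bitLength b)) →
        (∀ a b → bitLength (h a b) ≤ bitLength a + bitLength b) →
        Poly A nat f → Poly A nat g → Poly A nat (λ x → h (f x) (g x))
arith h p r t s P Q = _⟫P_ {g = λ (a , b) → h a b} ⟪ P , Q ⟫ record
  { prog = p ; run≡ = λ (a , b) → r a b ; timeB = X ; sizeB = X
  ; time≤ = λ (a , b) → ≤-reflexive (t a b) ; size≤ = λ (a , b) → m≤n⇒m≤1+n (s a b) }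

addP mulP monusP : ∀ {f g : ⟦ A ⟧ → ℕ} → Poly A nat f → Poly A nat g → Poly A nat _
addP {f = f} {g}   = arith {f = f} {g} _+_ add (λ _ _ → refl) (λ _ _ → refl) bitLength-+
mulP {f = f} {g}   = arith {f = f} {g} _*_ mul (λ _ _ → refl) (λ _ _ → refl) bitLength-*
monusP {f = f} {g} = arith {f = f} {g} _∸_ monus (λ _ _ → refl) (λ _ _ → refl)
  λ a b → ≤-trans (bitLength-mono (m∸n≤m a b)) (m≤m+n _ _)

sucP : ∀ {f : ⟦ A ⟧ → ℕ} → Poly A nat f → Poly A nat (λ x → suc (f x))
sucP P = addP (litP 1) P

⌜_⌝ : Bool → ⟦ bool ⟧
⌜ b ⌝ = if b then inj₁ tt else inj₂ tt

PolyB : (A : Ty) → (⟦ A ⟧ → Bool) → Set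
PolyB A b = Poly A bool (λ x → ⌜ b x ⌝)

size⌜⌝ : ∀ b → size bool ⌜ b ⌝ ≡ 2
size⌜⌝ true  = refl
size⌜⌝ false = refl

leqP : ∀ {f g : ⟦ A ⟧ → ℕ} → Poly A nat f → Poly A nat g → PolyB A (λ x → f x ≤ᵇ g x)
leqP P Q = _⟫P_ {g = λ (a , b) → ⌜ a ≤ᵇ b ⌝} ⟪ P , Q ⟫ record
  { prog = leq ; run≡ = λ _ → refl ; timeB = X ; sizeB = con 2
  ; time≤ = λ _ → ≤-refl ; size≤ = λ (a , b) → ≤-reflexive (size⌜⌝ (a ≤ᵇ b)) }

caseP : ∀ {h : ⟦ D ⟧ → ⟦ A ⟧ ⊎ ⟦ B ⟧} {f : ⟦ A ⊗ D ⟧ → ⟦ C ⟧} {g : ⟦ B ⊗ D ⟧ → ⟦ C ⟧} →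
        Poly D (A ⊕ B) h → Poly (A ⊗ D) C f → Poly (B ⊗ D) C g →
        Poly D C (λ z → [ (λ x → f (x , z)) , (λ y → g (y , z)) ] (h z))
caseP {D} {A} {B} {C} {h} {f} {g} H P Q = _⟫P_ {g = λ (y , z) → [ (λ x → f (x , z)) , (λ y → g (y , z)) ] y} ⟪ H , idP ⟫ record
  { prog  = branch (prog P) (prog Q)
  ; run≡  = λ { (inj₁ x , z) → run≡ P (x , z) ; (inj₂ y , z) → run≡ Q (y , z) }
  ; timeB = con 1 ⊞ timeB P ⊞ timeB Q
  ; sizeB = sizeB P ⊞ sizeB Q
  ; time≤ = λ { (inj₁ x , z) → s≤s (≤-trans (time≤ P (x , z)) (≤-trans (eval-mono (timeB P) (s≤s (n≤1+n _))) (m≤m+n _ _)))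
              ; (inj₂ y , z) → s≤s (≤-trans (time≤ Q (y , z)) (≤-trans (eval-mono (timeB Q) (s≤s (n≤1+n _))) (m≤n+m _ _))) }
  ; size≤ = λ { (inj₁ x , z) → ≤-trans (size≤ P (x , z)) (≤-trans (eval-mono (sizeB P) (s≤s (n≤1+n _))) (m≤m+n _ _))
              ; (inj₂ y , z) → ≤-trans (size≤ Q (y , z)) (≤-trans (eval-mono (sizeB Q) (s≤s (n≤1+n _))) (m≤n+m _ _)) } }

ifP : ∀ {b : ⟦ A ⟧ → Bool} {f g : ⟦ A ⟧ → ⟦ B ⟧} → PolyB A b → Poly A B f → Poly A B g →
      Poly A B (λ x → if b x then f x else g x)
ifP {A} {B} {b} {f} {g} H P Q = ext (caseP H (sndP ⟫P P) (sndP ⟫P Q)) λ x → lemma (b x) x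
  where
  lemma : ∀ c x → [ (λ _ → f x) , (λ _ → g x) ] ⌜ c ⌝ ≡ (if c then f x else g x)
  lemma true  x = refl
  lemma false x = refl

listCase : {A B : Set} → B → (A → List A → B) → List A → B
listCase n c []       = n
listCase n c (x ∷ xs) = c x xs

unconsP : Poly (list A) (unit ⊕ (A ⊗ list A)) (listCase (inj₁ tt) (λ x xs → inj₂ (x , xs)))
unconsP {A} = record
  { prog = uncons ; run≡ = λ { [] → refl ; (_ ∷ _) → refl } ; timeB = con 1 ; sizeB = con 1 ⊞ X ⊞ con 1
  ; time≤ = λ { [] → ≤-refl ; (_ ∷ _) → ≤-refl }
  ; size≤ = λ { [] → s≤s (s≤s z≤n) ; (x ∷ xs) → s≤s (m≤m+n _ 1) } }

listCaseP : ∀ {l : ⟦ C ⟧ → List ⟦ A ⟧} {n : ⟦ C ⟧ → ⟦ B ⟧} {c : ⟦ (A ⊗ list A) ⊗ C ⟧ → ⟦ B ⟧} →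
            Poly C (list A) l → Poly C B n → Poly ((A ⊗ list A) ⊗ C) B c →
            Poly C B (λ z → listCase (n z) (λ x xs → c ((x , xs) , z)) (l z))
listCaseP {l = l} {n} {c} L N K = ext (caseP (L ⟫P unconsP) (sndP ⟫P N) K) λ z → lemma z (l z)
  where
  lemma : ∀ z xs → [ (λ _ → n z) , (λ y → c (y , z)) ] (listCase (inj₁ tt) (λ x xs → inj₂ (x , xs)) xs)
          ≡ listCase (n z) (λ x xs → c ((x , xs) , z)) xs
  lemma z []       = refl
  lemma z (x ∷ xs) = refl

module _ {l : ⟦ D ⟧ → List ⟦ A ⟧} {e : ⟦ D ⟧ → ⟦ B ⟧} {s : ⟦ A ⊗ B ⊗ D ⟧ → ⟦ B ⟧} where

  private
    loop : ⟦ D ⟧ → List ⟦ A ⟧ → ⟦ B ⟧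
    loop z = foldr (λ x y → s (x , y , z)) (e z)

    head≤ : ∀ x xs z {N} → size (list A) (x ∷ xs) + size D z ≤ N → size A x + size D z ≤ N
    head≤ x xs z h = ≤-trans (+-monoˡ-≤ (size D z) (m≤n⇒m≤1+n (m≤m+n (size A x) _))) h

    tail≤ : ∀ x xs z {N} → size (list A) (x ∷ xs) + size D z ≤ N → size (list A) xs + size D z ≤ N
    tail≤ x xs z h = ≤-trans (+-monoˡ-≤ (size D z) (m≤n⇒m≤1+n (m≤n+m _ (size A x)))) h

    length≤ : ∀ xs z {N} → size (list A) xs + size D z ≤ N → length xs ≤ N
    length≤ xs z h = ≤-trans (length≤size A xs) (≤-trans (m≤m+n _ (size D z)) h)

  -- A polynomial step may double its accumulator, so its iteration can be exponential. A bound
  -- `acc` on all partial results prevents this: each of the at most N rounds then works on data of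
  -- polynomial size.
  boundedFoldrP : Poly D (list A) l → Poly D B e → Poly (A ⊗ B ⊗ D) B s → (acc : Pol) →
                  (∀ z xs → size B (loop z xs) ≤ eval acc (size (list A) xs + size D z)) →
                  Poly D B (λ z → loop z (l z))
  boundedFoldrP L E S acc bound = _⟫P_ {g = λ (xs , z) → loop z xs} ⟪ L , idP ⟫ record
    { prog  = fold (prog E) (prog S)
    ; run≡  = λ (xs , z) → run≡-fold z xs
    ; timeB = con 1 ⊞ timeB E ⊞ X ⊠ (con 1 ⊞ timeB S ⊙ iter)
    ; sizeB = acc
    ; time≤ = λ (xs , z) → s≤s (+-mono-≤
        (≤-trans (time≤ E z) (eval-mono (timeB E) (m≤n⇒m≤1+n (m≤n+m _ _))))
        (≤-trans (foldTime≤ z _ xs (n≤1+n _)) (*-monoˡ-≤ _ (length≤ xs z (n≤1+n _)))))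
    ; size≤ = λ (xs , z) → acc≤ z _ xs (n≤1+n _) }
    where
    iter : Pol
    -- Bounds the input of one round, a nested pair of element, accumulator and context.
    iter = con 1 ⊞ X ⊞ con 1 ⊞ acc ⊞ X
    run≡-fold : ∀ z xs → foldr (λ x y → run (prog S) (x , y , z)) (run (prog E) z) xs ≡ loop z xs
    run≡-fold z []       = run≡ E z
    run≡-fold z (x ∷ xs) = trans (cong (λ y → run (prog S) (x , y , z)) (run≡-fold z xs)) (run≡ S _)
    acc≤ : ∀ z N xs → size (list A) xs + size D z ≤ N → size B (loop z xs) ≤ eval acc N
    acc≤ z N xs h = ≤-trans (bound z xs) (eval-mono acc h)
    foldTime≤ : ∀ z N xs → size (list A) xs + size D z ≤ N →
      foldTime (λ x y → run (prog S) (x , y , z)) (λ x y → time (prog S) (x , y , z)) (run (prog E) z) xs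
      ≤ length xs * suc (eval (timeB S) (eval iter N))
    foldTime≤ z N []       h = z≤n
    foldTime≤ z N (x ∷ xs) h = s≤s (+-mono-≤
      (≤-trans (≤-reflexive (cong (λ y → time (prog S) (x , y , z)) (run≡-fold z xs)))
      (≤-trans (time≤ S _) (eval-mono (timeB S) (s≤s (+-mono-≤
        (≤-trans (m≤m+n _ _) (head≤ x xs z h))
        (s≤s (+-mono-≤ (acc≤ z N xs (tail≤ x xs z h)) (≤-trans (m≤n+m _ _) h))))))))
      (foldTime≤ z N xs (tail≤ x xs z h)))

  -- A loop is polynomial if each iteration adds to its accumulator at most a
  -- polynomial amount in the size of the data that do not change.

  foldrP : Poly D (list A) l → Poly D B e → Poly (A ⊗ B ⊗ D) B s → (G : Pol) →
           (∀ x y z → size B (s (x , y , z)) ≤ size B y + eval G (size A x + size D z)) →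
           Poly D B (λ z → loop z (l z))
  foldrP L E S G growth = boundedFoldrP L E S (sizeB E ⊞ X ⊠ G) λ z xs →
    ≤-trans (acc≤ z _ xs ≤-refl) (+-monoʳ-≤ (eval (sizeB E) _) (*-monoˡ-≤ (eval G _) (length≤ xs z ≤-refl)))
    where
    acc≤ : ∀ z N xs → size (list A) xs + size D z ≤ N →
           size B (loop z xs) ≤ eval (sizeB E) N + length xs * eval G N
    acc≤ z N []       h = ≤-trans (≤-trans (size≤ E z) (eval-mono (sizeB E) (≤-trans (m≤n+m _ 1) h))) (m≤m+n _ _)
    acc≤ z N (x ∷ xs) h = ≤-trans (growth x _ z)
      (≤-trans (+-mono-≤ (acc≤ z N xs (tail≤ x xs z h)) (eval-mono G (head≤ x xs z h)))
      (≤-reflexive (trans (+-assoc (eval (sizeB E) N) _ _) (cong (eval (sizeB E) N +_) (+-comm (length xs * _) _)))))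

-- The algorithm

item chain : Ty
item  = nat ⊗ nat ⊗ nat ⊗ nat ⊗ nat
chain = list item

Item Chain : Set
Item  = ⟦ item ⟧
Chain = ⟦ chain ⟧

-- The tag tells apart intervals that occur more than once. The weight stays a fraction, to be
-- compared by cross multiplication.
tag sᵢ eᵢ num den : Item → ℕ
tag = proj₁
sᵢ  = proj₁ ∘ proj₂
eᵢ  = proj₁ ∘ proj₂ ∘ proj₂
num = proj₁ ∘ proj₂ ∘ proj₂ ∘ proj₂
den = proj₂ ∘ proj₂ ∘ proj₂ ∘ proj₂

_≡ᵇ′_ : ℕ → ℕ → Bool
a ≡ᵇ′ b = (a ≤ᵇ b) ∧ (b ≤ᵇ a)

-- One round of a selection by a right fold: the new element takes over the head or goes right
-- behind it, so that no element is lost. If nothing satisfies `p`, the head is arbitrary, and the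
-- user of the selection has to test it.
push : (S → Bool) → S → List S → List S
push p y = listCase (y ∷ []) (λ h t → if p y then y ∷ h ∷ t else h ∷ y ∷ t)

-- The first element of xs that satisfies p moves to the head.

pull : (S → Bool) → List S → List S → List S
pull p = foldr (push p)

-- Insertion sort: when a sorted list is pulled onto `x ∷ []`, entries that start after x end up
-- behind x, and the others pass in front of it one by one.
sortByStart : List Item → List Item
sortByStart = foldr (λ x → pull (λ y → sᵢ y ≤ᵇ sᵢ x) (x ∷ [])) []

-- Creating m chains could take exponential time, as m is given in binary. The list `L` limits their
-- number to `m ⊓ length L`.
emptyChains : ℕ → List Item → List Chain
emptyChains m = foldr (λ _ cs → if suc (length cs) ≤ᵇ m then [] ∷ cs else cs) []

fits : ℕ → Chain → Bool
fits θ = listCase true (λ x _ → θ ≤ᵇ sᵢ x)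

-- Used on items of decreasing start: a chain that has just been extended
-- starts before all the others, so the chains stay sorted, and the first one
-- that fits is the best fit.

place : Item → List Chain → List Chain
place x cs = listCase cs (λ h t → if fits (eᵢ x) h then (x ∷ h) ∷ t else cs) (pull (fits (eᵢ x)) [] cs)

greedy : ℕ → List Item → List Chain
greedy m L = foldr place (emptyChains m L) (sortByStart L)

-- The least q with  a ≤ b * q , if it is at most the length of the fuel.

ceil : List S → ℕ → ℕ → ℕ
ceil fuel b a = foldr (λ _ q → if suc (b * q) ≤ᵇ a then suc q else q) 0 fuel

-- A and B exchange what comes after the time t.  In the back part an item of
-- B that contains t is dropped.

cutFront cutBack : ℕ → Chain → Chain → Chain
cutFront t A B = filterᵇ (λ x → eᵢ x ≤ᵇ t) A ++ filterᵇ (λ x → t ≤ᵇ sᵢ x) B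
cutBack  t A B = filterᵇ (λ x → eᵢ x ≤ᵇ t) (filterᵇ (λ x → not (t ≤ᵇ sᵢ x)) B) ++ filterᵇ (λ x → not (eᵢ x ≤ᵇ t)) A

split : ℕ → Chain → Chain → Chain × Chain
split τ A B = foldr (λ a acc → if length (cutFront (eᵢ a) A B) ≡ᵇ′ τ
                               then (cutFront (eᵢ a) A B , cutBack (eᵢ a) A B) else acc) ([] , []) A

State : Set
State = List Chain × List Chain × ℕ

low : ℕ → Chain → Bool
low τ c = suc (length c) ≤ᵇ τ

-- If no remaining chain is shorter than τ, the surplus of A may be thrown away: later targets do
-- not exceed τ, so each of the other chains can meet them alone.
balanceWith : ℕ → Chain → List Chain → List Chain → ℕ → State
balanceWith τ A rest out n =
  listCase ([] , proj₁ (split τ A []) ∷ out , n ∸ τ)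
    (λ B rest′ → if low τ B
      then (proj₂ (split τ A B) ∷ rest′ , proj₁ (split τ A B) ∷ out , n ∸ τ)
      else (B ∷ rest′ , proj₁ (split τ A []) ∷ out , n ∸ τ))
    (pull (low τ) [] rest)

balance : List Item → State → State
balance L (pool , out , n) =
  listCase (pool , out , n)
    (λ A rest → balanceWith (ceil L (length pool) n) A rest out n)
    (pull (λ c → ceil L (length pool) n ≤ᵇ length c) [] pool)

-- The folded list only counts the rounds, one for each chain. `L` is long enough to be the fuel of
-- every quotient, as the target never exceeds the number of items.
balanceAll : List Item → List Chain → State
balanceAll L cs = foldr (λ _ → balance L) (cs , [] , ceil L 3 (2 * length (concat cs))) cs

classSchedule : ℕ → List Item → List Chain
classSchedule m L = proj₁ (proj₂ (balanceAll L (greedy m L)))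

-- No cross multiplication here: rationals are in lowest terms, so equal weights have equal
-- numerators and equal denominators.
sameWeight : Item → Item → Bool
sameWeight c x = (num c ≡ᵇ′ num x) ∧ (den c ≡ᵇ′ den x)

-- (Ds , v , d) stands for chains Ds of total weight v / d.

Candidate : Set
Candidate = List Chain × ℕ × ℕ

candidate : ℕ → List Item → Item → Candidate
candidate m L c = Ds , length (concat Ds) * num c , den c
  where Ds = classSchedule m (filterᵇ (sameWeight c) L)

better : Candidate → Candidate → Candidate
better new@(_ , v′ , d′) old@(_ , v , d) = if v * d′ ≤ᵇ v′ * d then new else old

-- Each item stands for its weight class, so the distinct weights need not be listed; meeting a
-- class repeatedly does no harm.
best : ℕ → List Item → Candidate
best m L = foldr (λ c → better (candidate m L c)) ([] , 0 , 1) L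

entry : Ty
entry = rational ⊗ rational ⊗ rational

-- The numerator, as long as the rational is nonnegative.
magnitude : ⟦ rational ⟧ → ℕ
magnitude q = [ (λ n → n) , (λ n → n) ] (proj₁ q)

_≤ᴱ_ : ⟦ rational ⟧ → ⟦ rational ⟧ → Bool
p ≤ᴱ q = magnitude p * proj₂ q ≤ᵇ magnitude q * proj₂ p

rank : List ⟦ entry ⟧ → ⟦ rational ⟧ → ℕ
rank E t = length (filterᵇ (λ k → proj₁ (proj₂ k) ≤ᴱ t) E)

toItem : List ⟦ entry ⟧ → ℕ → ⟦ entry ⟧ → Item
toItem E i (s , e , v) = i , rank E s , rank E e , magnitude v , proj₂ v

-- Positions are counted from the end, as a fold from the right finds them.

enumerate : {R S : Set} → (ℕ → R → S) → List R → List S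
enumerate f = foldr (λ x acc → f (length acc) x ∷ acc) []

items : List ⟦ entry ⟧ → List Item
items E = enumerate (toItem E) E

hasTag : ℕ → Chain → Bool
hasTag i c = 1 ≤ᵇ length (filterᵇ (λ x → i ≡ᵇ′ tag x) c)

machineOf : List Chain → ℕ → ⟦ unit ⊕ nat ⟧
machineOf Ds i = foldr (λ c r → if hasTag i c then inj₂ 0 else [ inj₁ , (λ k → inj₂ (suc k)) ] r) (inj₁ tt) Ds

algorithm : ⟦ instanceTy ⟧ → ⟦ scheduleTy ⟧
algorithm (m , E) = enumerate (λ i _ → machineOf (proj₁ (best m (items E))) i) E

-- Conservation of totals by the steps of the algorithm

total : (S → ℕ) → List S → ℕ
total f xs = sum (map f xs)

total-++ : ∀ (f : S → ℕ) xs ys → total f (xs ++ ys) ≡ total f xs + total f ys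
total-++ f xs ys = trans (cong sum (map-++ f xs ys)) (sum-++ (map f xs) (map f ys))

total-push : ∀ (f : S → ℕ) p y l → total f (push p y l) ≡ f y + total f l
total-push f p y []      = refl
total-push f p y (h ∷ t) with p y
... | true  = refl
... | false = x∙yz≈y∙xz (f h) (f y) (total f t)

total-pull : ∀ (f : S → ℕ) p i xs → total f (pull p i xs) ≡ total f i + total f xs
total-pull f p i []       = sym (+-identityʳ _)
total-pull f p i (x ∷ xs) = trans (total-push f p x (pull p i xs)) (trans (cong (f x +_) (total-pull f p i xs))
  (x∙yz≈y∙xz (f x) (total f i) (total f xs)))

total-filter : ∀ (f : S → ℕ) p xs → total f (filterᵇ p xs) + total f (filterᵇ (not ∘ p) xs) ≡ total f xs
total-filter f p [] = refl
total-filter f p (x ∷ xs) with p x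
... | true  = trans (+-assoc (f x) _ _) (cong (f x +_) (total-filter f p xs))
... | false = trans (x∙yz≈y∙xz (total f (filterᵇ p xs)) (f x) _) (cong (f x +_) (total-filter f p xs))

total-filter-≤ : ∀ (f : S → ℕ) p xs → total f (filterᵇ p xs) ≤ total f xs
total-filter-≤ f p xs = ≤-trans (m≤m+n _ _) (≤-reflexive (total-filter f p xs))

-- The filters on A are complementary, so each of its items lands in exactly one part. Those on B
-- are disjoint and miss only the items that contain t.
total-cut : ∀ (f : Item → ℕ) t A B →
    total f (cutFront t A B) + total f (cutBack t A B) ≤ total f A + total f B
total-cut f t A B = begin
  total f (cutFront t A B) + total f (cutBack t A B)
    ≡⟨ cong₂ _+_ (total-++ f A₁ B₂) (total-++ f B₁ A₂) ⟩
  total f A₁ + total f B₂ + (total f B₁ + total f A₂)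
    ≤⟨ +-monoʳ-≤ (total f A₁ + total f B₂) (+-monoˡ-≤ _ (total-filter-≤ f (λ x → eᵢ x ≤ᵇ t) B₀)) ⟩
  total f A₁ + total f B₂ + (total f B₀ + total f A₂)
    ≡⟨ rearrange (total f A₁) (total f B₂) (total f B₀) (total f A₂) ⟩
  (total f A₁ + total f A₂) + (total f B₂ + total f B₀)
    ≡⟨ cong₂ _+_ (total-filter f _ A) (total-filter f _ B) ⟩
  total f A + total f B ∎
  where
  open ≤-Reasoning
  A₁ = filterᵇ (λ x → eᵢ x ≤ᵇ t) A
  A₂ = filterᵇ (λ x → not (eᵢ x ≤ᵇ t)) A
  B₂ = filterᵇ (λ x → t ≤ᵇ sᵢ x) B
  B₀ = filterᵇ (λ x → not (t ≤ᵇ sᵢ x)) B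
  B₁ = filterᵇ (λ x → eᵢ x ≤ᵇ t) B₀
  rearrange : ∀ a b c d → a + b + (c + d) ≡ (a + d) + (b + c)
  rearrange = solve-∀

≡ᵇ′⇒≡ : ∀ a b → (a ≡ᵇ′ b) ≡ true → a ≡ b
≡ᵇ′⇒≡ a b eq with a ≤ᵇ b in a≤b | b ≤ᵇ a in b≤a
≡ᵇ′⇒≡ a b _ | true | true = ≤-antisym (≤ᵇ⇒≤ a b (subst T (sym a≤b) tt)) (≤ᵇ⇒≤ b a (subst T (sym b≤a) tt))

split-elim : (P : Chain × Chain → Set) → ∀ τ A B → P ([] , []) →
             (∀ {a} → a ∈ A → length (cutFront (eᵢ a) A B) ≡ τ → P (cutFront (eᵢ a) A B , cutBack (eᵢ a) A B)) →
             P (split τ A B)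
split-elim P τ A B default cut = loop A (λ a∈ → a∈)
  where
  loop : ∀ A′ → (∀ {a} → a ∈ A′ → a ∈ A) →
         P (foldr (λ a acc → if length (cutFront (eᵢ a) A B) ≡ᵇ′ τ
                             then (cutFront (eᵢ a) A B , cutBack (eᵢ a) A B) else acc) ([] , []) A′)
  loop []       _   = default
  loop (a ∷ A′) sub with length (cutFront (eᵢ a) A B) ≡ᵇ′ τ in eq
  ... | true  = cut (sub (here refl)) (≡ᵇ′⇒≡ _ τ eq)
  ... | false = loop A′ (sub ∘ there)

-- The function `f` is arbitrary because two kinds matter: the size of an item bounds the memory,
-- and indicators of items show that none is duplicated.
total-split : ∀ (f : Item → ℕ) τ A B →
              total f (proj₁ (split τ A B)) + total f (proj₂ (split τ A B)) ≤ total f A + total f B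
total-split f τ A B = split-elim (λ (c , d) → total f c + total f d ≤ total f A + total f B) τ A B z≤n
  λ {a} _ _ → total-cut f (eᵢ a) A B

total-place : ∀ (f : Chain → ℕ) (g : Item → ℕ) → (∀ x c → f (x ∷ c) ≡ g x + f c) →
              ∀ x cs → total f (place x cs) ≤ g x + total f cs
total-place f g f-∷ x cs with pull (fits (eᵢ x)) [] cs | total-pull f (fits (eᵢ x)) [] cs
... | []    | _  = m≤n+m _ _
... | h ∷ t | eq with fits (eᵢ x) h
...   | true  = ≤-reflexive (trans (cong (_+ total f t) (f-∷ x h)) (trans (+-assoc (g x) (f h) (total f t)) (cong (g x +_) eq)))
...   | false = m≤n+m _ _

-- `f` stands for the size of a chain as well as for a sum over its items. The second hypothesis is
-- separate because `f []` may be positive, so that the first one at `B = []` does not bound the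
-- front by `f A`.
module _ (f : Chain → ℕ)
         (f-split : ∀ τ A B → f (proj₁ (split τ A B)) + f (proj₂ (split τ A B)) ≤ f A + f B)
         (f-split-[] : ∀ τ A → f (proj₁ (split τ A [])) ≤ f A) where

  total-balance : ∀ (L : List Item) (st : State) → let (pool , out , n) = st ; (pool′ , out′ , n′) = balance L st in
                  total f pool′ + total f out′ ≤ total f pool + total f out
  total-balance L (pool , out , n) with ceil L (length pool) n
  ... | τ with pull (λ c → τ ≤ᵇ length c) [] pool | total-pull f (λ c → τ ≤ᵇ length c) [] pool
  ... | []       | _  = ≤-refl
  ... | A ∷ rest | eq with pull (low τ) [] rest | total-pull f (low τ) [] rest
  ...   | []        | eq′ = +-monoˡ-≤ (total f out)
            (≤-trans (f-split-[] τ A) (≤-trans (m≤m+n _ _) (≤-reflexive eq)))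
  ...   | B ∷ rest′ | eq′ with low τ B
  ...     | true  = begin
    f back + total f rest′ + (f front + total f out)   ≡⟨ r₁ (f back) (total f rest′) (f front) (total f out) ⟩
    (f front + f back) + (total f rest′ + total f out) ≤⟨ +-monoˡ-≤ _ (f-split τ A B) ⟩
    (f A + f B) + (total f rest′ + total f out)        ≡⟨ r₂ (f A) (f B) (total f rest′) (total f out) ⟩
    f A + (f B + total f rest′) + total f out          ≡⟨ cong (λ z → f A + z + total f out) eq′ ⟩
    f A + total f rest + total f out                   ≡⟨ cong (_+ total f out) eq ⟩
    total f pool + total f out                         ∎
    where
    open ≤-Reasoning
    front = proj₁ (split τ A B)
    back  = proj₂ (split τ A B)
    r₁ : ∀ a b c d → a + b + (c + d) ≡ (c + a) + (b + d)
    r₁ = solve-∀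
    r₂ : ∀ a b c d → (a + b) + (c + d) ≡ a + (b + c) + d
    r₂ = solve-∀
  ...     | false = begin
    total f (B ∷ rest′) + (f front + total f out)      ≤⟨ +-monoʳ-≤ (total f (B ∷ rest′)) (+-monoˡ-≤ _ (f-split-[] τ A)) ⟩
    total f (B ∷ rest′) + (f A + total f out)          ≡⟨ cong (_+ _) eq′ ⟩
    total f rest + (f A + total f out)                 ≡⟨ r (total f rest) (f A) (total f out) ⟩
    f A + total f rest + total f out                   ≡⟨ cong (_+ total f out) eq ⟩
    total f pool + total f out                         ∎
    where
    open ≤-Reasoning
    front = proj₁ (split τ A [])
    r : ∀ a b c → a + (b + c) ≡ b + a + c
    r = solve-∀

-- The algorithm as a polynomial-time program

size⁺ : ∀ A → ⟦ A ⟧ → ℕ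
size⁺ A x = suc (size A x)

size-list : ∀ A xs → size (list A) xs ≡ suc (total (size⁺ A) xs)
size-list A []       = refl
size-list A (x ∷ xs) = cong suc (trans (cong (size A x +_) (size-list A xs)) (+-suc _ _))

size-++ : ∀ A xs ys → size (list A) (xs ++ ys) ≤ size (list A) ys + size (list A) xs
size-++ A []       ys = m≤m+n _ 1
size-++ A (x ∷ xs) ys = ≤-trans (s≤s (+-monoʳ-≤ (size A x) (size-++ A xs ys))) (≤-reflexive (r (size A x) _ _))
  where r : ∀ a b c → suc (a + (b + c)) ≡ b + suc (a + c)
        r = solve-∀

cons-growth : ∀ a b c → suc (a + b) ≤ b + (1 + (a + c))
cons-growth a b c = ≤-trans (m≤m+n (suc (a + b)) c) (≤-reflexive (r a b c))
  where r : ∀ a b c → suc (a + b) + c ≡ b + (1 + (a + c))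
        r = solve-∀

notP : ∀ {b : ⟦ A ⟧ → Bool} → PolyB A b → PolyB A (λ x → not (b x))
notP {b = b} P = ext (ifP P (inrP unitP) (inlP unitP)) λ x → lemma (b x)
  where lemma : ∀ c → (if c then inj₂ tt else inj₁ tt) ≡ ⌜ not c ⌝
        lemma true  = refl
        lemma false = refl

andP : ∀ {b c : ⟦ A ⟧ → Bool} → PolyB A b → PolyB A c → PolyB A (λ x → b x ∧ c x)
andP {b = b} {c} P Q = ext (ifP P Q (inrP unitP)) λ x → lemma (b x) (c x)
  where lemma : ∀ b c → (if b then ⌜ c ⌝ else inj₂ tt) ≡ ⌜ b ∧ c ⌝
        lemma true  c = refl
        lemma false c = refl

eqP : ∀ {f g : ⟦ A ⟧ → ℕ} → Poly A nat f → Poly A nat g → PolyB A (λ x → f x ≡ᵇ′ g x)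
eqP P Q = andP (leqP P Q) (leqP Q P)

filterP : ∀ {b : ⟦ A ⊗ D ⟧ → Bool} {l : ⟦ D ⟧ → List ⟦ A ⟧} → PolyB (A ⊗ D) b → Poly D (list A) l →
          Poly D (list A) (λ z → filterᵇ (λ x → b (x , z)) (l z))
filterP {A} {D} {b} {l} P L = ext (foldrP L nilP
    (ifP (⟪ fstP , sndP ⟫P sndP ⟫ ⟫P P) (consP fstP (sndP ⟫P fstP)) (sndP ⟫P fstP))
    (con 1 ⊞ X) growth) (λ z → lemma z (l z))
  where
  growth : ∀ x y z →
      size (list A) (if b (x , z) then x ∷ y else y) ≤ size (list A) y + (1 + (size A x + size D z))
  growth x y z with b (x , z)
  ... | true  = cons-growth (size A x) _ _
  ... | false = m≤m+n _ _
  lemma : ∀ z xs → foldr (λ x y → if b (x , z) then x ∷ y else y) [] xs ≡ filterᵇ (λ x → b (x , z)) xs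
  lemma z []       = refl
  lemma z (x ∷ xs) with b (x , z)
  ... | true  = cong (x ∷_) (lemma z xs)
  ... | false = lemma z xs

lengthP : ∀ {l : ⟦ D ⟧ → List ⟦ A ⟧} → Poly D (list A) l → Poly D nat (λ z → length (l z))
lengthP {l = l} L = ext (foldrP L (litP 0) (sucP (sndP ⟫P fstP)) (con 1)
    (λ _ y _ → ≤-trans (bitLength-suc y) (≤-reflexive (sym (+-comm (bitLength y) 1))))) (λ z → lemma (l z))
  where
  lemma : ∀ {S : Set} (xs : List S) → foldr (λ _ → suc) 0 xs ≡ length xs
  lemma []       = refl
  lemma (x ∷ xs) = cong suc (lemma xs)

appendP : ∀ {f g : ⟦ D ⟧ → List ⟦ A ⟧} → Poly D (list A) f → Poly D (list A) g →
          Poly D (list A) (λ z → f z ++ g z)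
appendP {D} {A} {f} {g} P Q = ext (foldrP P Q (consP fstP (sndP ⟫P fstP)) (con 1 ⊞ X)
    (λ x y z → cons-growth (size A x) _ (size D z))) (λ z → lemma (f z) (g z))
  where
  lemma : ∀ xs ys → foldr _∷_ ys xs ≡ xs ++ ys
  lemma []       ys = refl
  lemma (x ∷ xs) ys = cong (x ∷_) (lemma xs ys)

concatP : ∀ {l : ⟦ D ⟧ → List (List ⟦ A ⟧)} → Poly D (list (list A)) l → Poly D (list A) (λ z → concat (l z))
concatP {D} {A} {l} L = ext (foldrP L nilP (appendP fstP (sndP ⟫P fstP)) X
    (λ x y z → ≤-trans (size-++ A x y) (+-monoʳ-≤ (size (list A) y) (m≤m+n _ _)))) (λ z → lemma (l z))
  where
  lemma : ∀ xss → foldr _++_ [] xss ≡ concat xss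
  lemma []         = refl
  lemma (xs ∷ xss) = cong (xs ++_) (lemma xss)

pullP : ∀ {p : ⟦ A ⊗ D ⟧ → Bool} {i l : ⟦ D ⟧ → List ⟦ A ⟧} → PolyB (A ⊗ D) p → Poly D (list A) i →
    Poly D (list A) l →
        Poly D (list A) (λ z → pull (λ x → p (x , z)) (i z) (l z))
pullP {A} {D} {p} P I L = foldrP L I
    (listCaseP (sndP ⟫P fstP) (consP fstP nilP)
      (ifP (⟪ sndP ⟫P fstP , sndP ⟫P sndP ⟫P sndP ⟫ ⟫P P)
           (consP (sndP ⟫P fstP) (consP (fstP ⟫P fstP) (fstP ⟫P sndP)))
           (consP (fstP ⟫P fstP) (consP (sndP ⟫P fstP) (fstP ⟫P sndP)))))
    (con 1 ⊞ X)
    (λ x y z → ≤-trans (≤-reflexive (size-push (λ x → p (x , z)) x y)) (cons-growth (size A x) _ (size D z)))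
  where
  size-push : ∀ p x y → size (list A) (push p x y) ≡ suc (size A x + size (list A) y)
  size-push p x y = trans (size-list A (push p x y)) (cong suc (trans (total-push (size⁺ A) p x y)
    (trans (sym (+-suc (size A x) _)) (cong (size A x +_) (sym (size-list A y))))))

size-pull : ∀ A p i xs → size (list A) (pull p i xs) ≡ size (list A) i + total (size⁺ A) xs
size-pull A p i xs = trans (size-list A (pull p i xs)) (trans (cong suc (total-pull (size⁺ A) p i xs))
  (cong (_+ total (size⁺ A) xs) (sym (size-list A i))))

sP eP numP denP : ∀ {f : ⟦ D ⟧ → Item} → Poly D item f → Poly D nat _
sP {f = f}   P = _⟫P_ {f = f} P (sndP ⟫P fstP)
eP {f = f}   P = _⟫P_ {f = f} P (sndP ⟫P sndP ⟫P fstP)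
numP {f = f} P = _⟫P_ {f = f} P (sndP ⟫P sndP ⟫P sndP ⟫P fstP)
denP {f = f} P = _⟫P_ {f = f} P (sndP ⟫P sndP ⟫P sndP ⟫P sndP)

sortP : ∀ {l : ⟦ D ⟧ → List Item} → Poly D (list item) l → Poly D (list item) (λ z → sortByStart (l z))
sortP {D} L = foldrP L nilP (pullP (leqP (sP fstP) (sP (sndP ⟫P fstP))) (consP fstP nilP) (sndP ⟫P fstP))
  (con 1 ⊞ X) λ x y z → ≤-trans (≤-reflexive (trans (size-pull item (λ y → sᵢ y ≤ᵇ sᵢ x) (x ∷ []) y) (r x y)))
    (cons-growth (size item x) (size (list item) y) (size D z))
  where
  r : ∀ x y → size (list item) (x ∷ []) + total (size⁺ item) y ≡ suc (size item x + size (list item) y)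
  r x y = cong suc (trans (+-assoc (size item x) 1 _) (cong (size item x +_) (sym (size-list item y))))

emptyChainsP : ∀ {m : ⟦ D ⟧ → ℕ} {l : ⟦ D ⟧ → List Item} → Poly D nat m → Poly D (list item) l →
               Poly D (list chain) (λ z → emptyChains (m z) (l z))
emptyChainsP {m = m} M L = foldrP L nilP
  (ifP (leqP (sucP (lengthP (sndP ⟫P fstP))) (sndP ⟫P sndP ⟫P M)) (consP nilP (sndP ⟫P fstP)) (sndP ⟫P fstP))
  (con 2) λ _ y z → growth (suc (length y) ≤ᵇ m z) y
  where
  growth : ∀ b y → size (list chain) (if b then [] ∷ y else y) ≤ size (list chain) y + 2
  growth true  y = ≤-reflexive (+-comm 2 _)
  growth false y = m≤m+n _ _

fitsP : ∀ {θ : ⟦ D ⟧ → ℕ} {c : ⟦ D ⟧ → Chain} → Poly D nat θ → Poly D chain c → PolyB D (λ z → fits (θ z) (c z))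
fitsP {θ = θ} {c} Θ K = ext (listCaseP K (inlP unitP) (leqP (sndP ⟫P Θ) (sP (fstP ⟫P fstP)))) λ z → lemma (θ z) (c z)
  where
  lemma : ∀ θ c → listCase (inj₁ tt) (λ x _ → ⌜ θ ≤ᵇ sᵢ x ⌝) c ≡ ⌜ fits θ c ⌝
  lemma θ []      = refl
  lemma θ (_ ∷ _) = refl

placeP : Poly (item ⊗ list chain) (list chain) (λ (x , cs) → place x cs)
placeP = listCaseP (pullP (fitsP (eP (sndP ⟫P fstP)) fstP) nilP sndP) sndP
  (ifP (fitsP (eP (sndP ⟫P fstP)) (fstP ⟫P fstP))
    (consP (consP (sndP ⟫P fstP) (fstP ⟫P fstP)) (fstP ⟫P sndP))
    (sndP ⟫P sndP))

size-chain-∷ : ∀ x c → suc (size chain (x ∷ c)) ≡ suc (size item x) + suc (size chain c)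
size-chain-∷ x c = cong suc (sym (+-suc (size item x) (size chain c)))

greedyP : ∀ {m : ⟦ D ⟧ → ℕ} {l : ⟦ D ⟧ → List Item} → Poly D nat m → Poly D (list item) l →
          Poly D (list chain) (λ z → greedy (m z) (l z))
greedyP {D} M L = foldrP (sortP L) (emptyChainsP M L) (⟪ fstP , sndP ⟫P fstP ⟫ ⟫P placeP) (con 1 ⊞ X) λ x y z → begin
    size (list chain) (place x y)                    ≡⟨ size-list chain (place x y) ⟩
    suc (total (size⁺ chain) (place x y))       ≤⟨ s≤s (total-place (size⁺ chain) (size⁺ item) size-chain-∷ x y) ⟩
    suc (suc (size item x) + total (size⁺ chain) y) ≡⟨ cong suc (sym (+-suc (size item x) _)) ⟩
    suc (size item x + suc (total (size⁺ chain) y)) ≡⟨ cong (λ k → suc (size item x + k)) (sym (size-list chain y)) ⟩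
    suc (size item x + size (list chain) y)          ≤⟨ cons-growth (size item x) _ (size D z) ⟩
    size (list chain) y + (1 + (size item x + size D z)) ∎
  where open ≤-Reasoning

ceilP : ∀ {l : ⟦ D ⟧ → List ⟦ A ⟧} {b a : ⟦ D ⟧ → ℕ} → Poly D (list A) l → Poly D nat b → Poly D nat a →
        Poly D nat (λ z → ceil (l z) (b z) (a z))
ceilP {b = b} {a} L P Q = foldrP L (litP 0)
  (ifP (leqP (sucP (mulP (sndP ⟫P sndP ⟫P P) (sndP ⟫P fstP))) (sndP ⟫P sndP ⟫P Q)) (sucP (sndP ⟫P fstP)) (sndP ⟫P fstP))
  (con 1) λ _ q z → growth (suc (b z * q) ≤ᵇ a z) q
  where
  growth : ∀ c q → bitLength (if c then suc q else q) ≤ bitLength q + 1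
  growth true  q = ≤-trans (bitLength-suc q) (≤-reflexive (+-comm 1 _))
  growth false q = m≤m+n _ 1

cutFrontP cutBackP : ∀ {t : ⟦ D ⟧ → ℕ} {a b : ⟦ D ⟧ → Chain} → Poly D nat t → Poly D chain a → Poly D chain b → Poly D chain _
cutFrontP {t = t} {a} {b} T P Q = ext {g = λ z → cutFront (t z) (a z) (b z)} (appendP (filterP (leqP (eP fstP) (sndP ⟫P T)) P) (filterP (leqP (sndP ⟫P T) (sP fstP)) Q)) (λ _ → refl)
cutBackP {t = t} {a} {b} T P Q = ext {g = λ z → cutBack (t z) (a z) (b z)} (appendP (filterP (leqP (eP fstP) (sndP ⟫P T)) (filterP (notP (leqP (sndP ⟫P T) (sP fstP))) Q))
  (filterP (notP (leqP (eP fstP) (sndP ⟫P T))) P)) (λ _ → refl)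

splitP : ∀ {t : ⟦ D ⟧ → ℕ} {a b : ⟦ D ⟧ → Chain} → Poly D nat t → Poly D chain a → Poly D chain b →
         Poly D (chain ⊗ chain) (λ z → split (t z) (a z) (b z))
splitP {D} {t} {a} {b} T P Q = foldrP P ⟪ nilP , nilP ⟫
  (ifP (eqP (lengthP (fstP′ F)) (sndP ⟫P sndP ⟫P T)) ⟪ fstP′ F , fstP′ K ⟫ (sndP ⟫P fstP))
  (sizeB FK ⊙ (con 1 ⊞ X)) λ x y z → growth (length (cutFront (eᵢ x) (a z) (b z)) ≡ᵇ′ t z) x y z
  where
  fstP′ : ∀ {B} {f : ⟦ item ⊗ D ⟧ → ⟦ B ⟧} → Poly (item ⊗ D) B f → Poly (item ⊗ (chain ⊗ chain) ⊗ D) B (λ (x , _ , z) → f (x , z))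
  fstP′ R = ⟪ fstP , sndP ⟫P sndP ⟫ ⟫P R
  F  = cutFrontP (eP fstP) (sndP ⟫P P) (sndP ⟫P Q)
  K  = cutBackP (eP fstP) (sndP ⟫P P) (sndP ⟫P Q)
  FK = ⟪ F , K ⟫
  growth : ∀ c x y z →
      size (chain ⊗ chain) (if c then (cutFront (eᵢ x) (a z) (b z) , cutBack (eᵢ x) (a z) (b z)) else y)
           ≤ size (chain ⊗ chain) y + eval (sizeB FK) (suc (size item x + size D z))
  growth true  x y z = ≤-trans (size≤ FK (x , z)) (m≤n+m _ (size (chain ⊗ chain) y))
  growth false x y z = m≤m+n _ _

state : Ty
state = list chain ⊗ list chain ⊗ nat

balanceWithP : Poly (nat ⊗ chain ⊗ list chain ⊗ list chain ⊗ nat) state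
                    (λ (τ , A , rest , out , n) → balanceWith τ A rest out n)
balanceWithP = listCaseP (pullP (leqP (sucP (lengthP fstP)) (sndP ⟫P τP)) nilP (sndP ⟫P sndP ⟫P fstP))
    ⟪ nilP , ⟪ alone , n∸τ ⟫ ⟫
    (ifP (leqP (sucP (lengthP short)) (sndP ⟫P τP))
      ⟪ consP (AB ⟫P sndP) rest′ , ⟪ consP (AB ⟫P fstP) (sndP ⟫P outP) , sndP ⟫P n∸τ ⟫ ⟫
      ⟪ consP short rest′ , ⟪ sndP ⟫P alone , sndP ⟫P n∸τ ⟫ ⟫)
  where
  τP    = fstP
  AP    = sndP ⟫P fstP
  outP  = sndP ⟫P sndP ⟫P sndP ⟫P fstP
  n∸τ   = monusP (sndP ⟫P sndP ⟫P sndP ⟫P sndP) τP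
  alone = consP (splitP τP AP nilP ⟫P fstP) outP
  short = fstP ⟫P fstP
  rest′ = fstP ⟫P sndP
  AB    = splitP (sndP ⟫P τP) (sndP ⟫P AP) short

balanceP : Poly (list item ⊗ state) state (λ (L , st) → balance L st)
balanceP = listCaseP (pullP (leqP (sndP ⟫P τP) (lengthP fstP)) nilP poolP) sndP
    (⟪ sndP ⟫P τP , ⟪ fstP ⟫P fstP , ⟪ fstP ⟫P sndP , ⟪ sndP ⟫P outP , sndP ⟫P nP ⟫ ⟫ ⟫ ⟫ ⟫P balanceWithP)
  where
  poolP = sndP ⟫P fstP
  outP  = sndP ⟫P sndP ⟫P fstP
  nP    = sndP ⟫P sndP ⟫P sndP
  τP    = ceilP fstP (lengthP poolP) nP

balance-remaining : ∀ (L : List Item) (st : State) → proj₂ (proj₂ (balance L st)) ≤ proj₂ (proj₂ st)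
balance-remaining L (pool , out , n) with ceil L (length pool) n
... | τ with pull (λ c → τ ≤ᵇ length c) [] pool
... | []       = ≤-refl
... | A ∷ rest with pull (low τ) [] rest
...   | []    = m∸n≤m n τ
...   | B ∷ _ with low τ B
...     | true  = m∸n≤m n τ
...     | false = m∸n≤m n τ

size-split : ∀ τ A B → suc (size chain (proj₁ (split τ A B))) + suc (size chain (proj₂ (split τ A B))) ≤
             suc (size chain A) + suc (size chain B)
size-split τ A B = begin
  suc (size chain F) + suc (size chain K)      ≡⟨ cong₂ _+_ (cong suc (size-list item F)) (cong suc (size-list item K)) ⟩
  suc (suc (f F)) + suc (suc (f K))            ≡⟨ r (f F) (f K) ⟩
  4 + (f F + f K)                              ≤⟨ +-monoʳ-≤ 4 (total-split (size⁺ item) τ A B) ⟩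
  4 + (f A + f B)                              ≡⟨ sym (r (f A) (f B)) ⟩
  suc (suc (f A)) + suc (suc (f B))            ≡⟨ sym (cong₂ _+_ (cong suc (size-list item A)) (cong suc (size-list item B))) ⟩
  suc (size chain A) + suc (size chain B)      ∎
  where
  open ≤-Reasoning
  f = total (size⁺ item)
  F = proj₁ (split τ A B)
  K = proj₂ (split τ A B)
  r : ∀ a b → suc (suc a) + suc (suc b) ≡ 4 + (a + b)
  r = solve-∀

size-split-[] : ∀ τ A → suc (size chain (proj₁ (split τ A []))) ≤ suc (size chain A)
size-split-[] τ A = begin
  suc (size chain F)  ≡⟨ cong suc (size-list item F) ⟩
  suc (suc (f F))     ≤⟨ s≤s (s≤s (≤-trans (m≤m+n (f F) (f K)) (≤-trans (total-split (size⁺ item) τ A []) (≤-reflexive (+-identityʳ _))))) ⟩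
  suc (suc (f A))     ≡⟨ cong suc (sym (size-list item A)) ⟩
  suc (size chain A)  ∎
  where
  open ≤-Reasoning
  f = total (size⁺ item)
  F = proj₁ (split τ A [])
  K = proj₂ (split τ A [])

-- Items are only moved or dropped and the remaining target only decreases. Hence the balancing loop
-- has growth 0.
size-balance : ∀ (L : List Item) (st : State) → size state (balance L st) ≤ size state st
size-balance L st = begin
  size state (balance L st)                 ≡⟨ size-state (balance L st) ⟩
  4 + (g pool′ + g out′ + bitLength n′)     ≤⟨ +-monoʳ-≤ 4 (+-mono-≤ (total-balance _ size-split size-split-[] L st) (bitLength-mono (balance-remaining L st))) ⟩
  4 + (g pool + g out + bitLength n)        ≡⟨ sym (size-state st) ⟩
  size state st                             ∎
  where
  open ≤-Reasoning
  g     = total (size⁺ chain)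
  pool  = proj₁ st
  out   = proj₁ (proj₂ st)
  n     = proj₂ (proj₂ st)
  pool′ = proj₁ (balance L st)
  out′  = proj₁ (proj₂ (balance L st))
  n′    = proj₂ (proj₂ (balance L st))
  r : ∀ a b c → suc (suc a + suc (suc b + c)) ≡ 4 + (a + b + c)
  r = solve-∀
  size-state : ∀ (st : State) →
      size state st ≡ 4 + (g (proj₁ st) + g (proj₁ (proj₂ st)) + bitLength (proj₂ (proj₂ st)))
  size-state (pool , out , n) = trans (cong suc (cong₂ _+_ (size-list chain pool) (cong suc (cong (_+ bitLength n) (size-list chain out)))))
    (r (g pool) (g out) (bitLength n))

balanceAllP : Poly (list item ⊗ list chain) state (λ (L , cs) → balanceAll L cs)
balanceAllP = foldrP sndP ⟪ sndP , ⟪ nilP , ceilP fstP (litP 3) (mulP (litP 2) (lengthP (concatP sndP))) ⟫ ⟫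
  (⟪ sndP ⟫P sndP ⟫P fstP , sndP ⟫P fstP ⟫ ⟫P balanceP) (con 0)
  λ _ st z → ≤-trans (size-balance (proj₁ z) st) (m≤m+n _ 0)

classScheduleP : ∀ {m : ⟦ D ⟧ → ℕ} {l : ⟦ D ⟧ → List Item} → Poly D nat m → Poly D (list item) l →
                 Poly D (list chain) (λ z → classSchedule (m z) (l z))
classScheduleP M L = ⟪ L , greedyP M L ⟫ ⟫P balanceAllP ⟫P sndP ⟫P fstP

candidateTy : Ty
candidateTy = list chain ⊗ nat ⊗ nat

candidateP : Poly (item ⊗ nat ⊗ list item) candidateTy (λ (c , m , L) → candidate m L c)
candidateP = ⟪ Ds , ⟪ mulP (lengthP (concatP Ds)) (numP fstP) , denP fstP ⟫ ⟫
  where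
  sameP = andP (eqP (numP (sndP ⟫P fstP)) (numP fstP)) (eqP (denP (sndP ⟫P fstP)) (denP fstP))
  Ds = classScheduleP (sndP ⟫P fstP) (filterP sameP (sndP ⟫P sndP))

bestP : Poly (nat ⊗ list item) candidateTy (λ (m , L) → best m L)
bestP = foldrP sndP ⟪ nilP , ⟪ litP 0 , litP 1 ⟫ ⟫
  (ifP (leqP (mulP (acc ⟫P sndP ⟫P fstP) (new ⟫P sndP ⟫P sndP)) (mulP (new ⟫P sndP ⟫P fstP) (acc ⟫P sndP ⟫P sndP))) new acc)
  (sizeB candidateP ⊙ (con 1 ⊞ X))
  λ c acc z → growth (proj₁ (proj₂ acc) * den c ≤ᵇ proj₁ (proj₂ (candidate (proj₁ z) (proj₂ z) c)) * proj₂ (proj₂ acc)) c acc z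
  where
  acc = sndP ⟫P fstP
  new = ⟪ fstP , sndP ⟫P sndP ⟫ ⟫P candidateP
  growth : ∀ b c acc z → size candidateTy (if b then candidate (proj₁ z) (proj₂ z) c else acc)
           ≤ size candidateTy acc + eval (sizeB candidateP) (suc (size item c + size (nat ⊗ list item) z))
  growth true  c acc z = ≤-trans (size≤ candidateP (c , z)) (m≤n+m _ (size candidateTy acc))
  growth false c acc z = m≤m+n _ _

magnitudeP : Poly rational nat magnitude
magnitudeP = caseP fstP fstP fstP

leℚP : ∀ {f g : ⟦ D ⟧ → ⟦ rational ⟧} → Poly D rational f → Poly D rational g → PolyB D (λ z → f z ≤ᴱ g z)
leℚP P Q = leqP (mulP (P ⟫P magnitudeP) (Q ⟫P sndP)) (mulP (Q ⟫P magnitudeP) (P ⟫P sndP))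

rankP : ∀ {l : ⟦ D ⟧ → List ⟦ entry ⟧} {t : ⟦ D ⟧ → ⟦ rational ⟧} → Poly D (list entry) l →
    Poly D rational t →
        Poly D nat (λ z → rank (l z) (t z))
rankP L T = lengthP (filterP (leℚP (fstP ⟫P sndP ⟫P fstP) (sndP ⟫P T)) L)

toItemP : Poly (list entry ⊗ nat ⊗ entry) item (λ (E , i , x) → toItem E i x)
toItemP = ⟪ sndP ⟫P fstP , ⟪ rankP fstP (sndP ⟫P sndP ⟫P fstP) , ⟪ rankP fstP (sndP ⟫P sndP ⟫P sndP ⟫P fstP) ,
  ⟪ sndP ⟫P sndP ⟫P sndP ⟫P sndP ⟫P magnitudeP , sndP ⟫P sndP ⟫P sndP ⟫P sndP ⟫P sndP ⟫ ⟫ ⟫ ⟫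

length-enumerate : ∀ {S T : Set} (f : ℕ → S → T) xs → length (enumerate f xs) ≡ length xs
length-enumerate f []       = refl
length-enumerate f (x ∷ xs) = cong suc (length-enumerate f xs)

-- The index handed to `F` is the length of the accumulator, so the growth of a round is not a
-- function of fixed data as `foldrP` requires. It is bounded all the same, since that length never
-- exceeds the length of the list.
enumerateP : ∀ {f : ⟦ nat ⊗ A ⊗ D ⟧ → ⟦ B ⟧} {l : ⟦ D ⟧ → List ⟦ A ⟧} → Poly (nat ⊗ A ⊗ D) B f →
    Poly D (list A) l →
             Poly D (list B) (λ z → enumerate (λ i x → f (i , x , z)) (l z))
enumerateP {A} {D} {B} {f} F L = boundedFoldrP L nilP
    (consP (⟪ lengthP (sndP ⟫P fstP) , ⟪ fstP , sndP ⟫P sndP ⟫ ⟫ ⟫P F) (sndP ⟫P fstP))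
    (con 1 ⊞ X ⊠ (con 1 ⊞ entryB))
    λ z xs → ≤-trans (bound z _ xs ≤-refl) (s≤s (*-monoˡ-≤ _ (≤-trans (length≤size A xs) (m≤m+n _ (size D z)))))
  where
  entryB = sizeB F ⊙ (con 3 ⊞ X ⊞ X ⊞ X)
  bitLength≤ : ∀ n → bitLength n ≤ suc n
  bitLength≤ zero    = ≤-refl
  bitLength≤ (suc n) = ≤-trans (bitLength-suc n) (s≤s (bitLength≤ n))
  r : ∀ n → suc (suc n + suc (n + n)) ≡ 3 + (n + (n + n))
  r = solve-∀
  bound : ∀ z N xs → size (list A) xs + size D z ≤ N →
          size (list B) (enumerate (λ i x → f (i , x , z)) xs) ≤ 1 + length xs * (1 + eval entryB N)
  bound z N []       h = ≤-refl
  bound z N (x ∷ xs) h = s≤s (≤-trans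
    (+-mono-≤ (≤-trans (size≤ F (i , x , z)) (eval-mono (sizeB F) (≤-trans
        (s≤s (+-mono-≤ i≤ (s≤s (+-mono-≤ (≤-trans (≤-trans (m≤m+n (size A x) _) (n≤1+n _)) (≤-trans (m≤m+n _ (size D z)) h)) (≤-trans (m≤n+m _ (size (list A) (x ∷ xs))) h)))))
        (≤-reflexive (r N)))))
      (bound z N xs (≤-trans (+-monoˡ-≤ (size D z) (m≤n⇒m≤1+n (m≤n+m _ (size A x)))) h)))
    (≤-reflexive (+-suc _ _)))
    where
    i = length (enumerate (λ i x → f (i , x , z)) xs)
    i≤ : bitLength i ≤ suc N
    i≤ = ≤-trans (bitLength≤ i) (s≤s (≤-trans (≤-reflexive (length-enumerate (λ i x → f (i , x , z)) xs))
      (≤-trans (length≤size A xs) (≤-trans (m≤n+m _ (suc (size A x))) (≤-trans (m≤m+n _ (size D z)) h)))))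

machineOfP : Poly (list chain ⊗ nat) (unit ⊕ nat) (λ (Ds , i) → machineOf Ds i)
machineOfP = foldrP fstP (inlP unitP)
  (ifP (leqP (litP 1) (lengthP (filterP (eqP (sndP ⟫P sndP ⟫P sndP ⟫P sndP) (fstP ⟫P fstP)) fstP)))
    (inrP (litP 0)) (caseP (sndP ⟫P fstP) (inlP fstP) (inrP (sucP fstP))))
  (con 2) λ c r z → growth (hasTag (proj₂ z) c) r
  where
  growth : ∀ b r → size (unit ⊕ nat) (if b then inj₂ 0 else [ inj₁ , (λ k → inj₂ (suc k)) ] r) ≤ size (unit ⊕ nat) r + 2
  growth true  r        = m≤n+m 2 _
  growth false (inj₁ _) = m≤m+n 2 2
  growth false (inj₂ k) = s≤s (≤-trans (bitLength-suc k) (≤-trans (≤-reflexive (+-comm 1 _)) (+-monoʳ-≤ (bitLength k) (s≤s z≤n))))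

algorithmP : Poly instanceTy scheduleTy algorithm
algorithmP = ⟪ idP , ⟪ fstP , itemsP ⟫ ⟫P bestP ⟫P fstP ⟫ ⟫P
    enumerateP (⟪ sndP ⟫P sndP ⟫P sndP , fstP ⟫ ⟫P machineOfP) (fstP ⟫P sndP)
  where
  itemsP : Poly instanceTy (list item) (λ (m , E) → items E)
  itemsP = enumerateP (⟪ sndP ⟫P sndP ⟫P sndP , ⟪ fstP , sndP ⟫P fstP ⟫ ⟫ ⟫P toItemP) sndP

-- A linear inequality a ≤ b follows from a hypothesis l ≤ r, possibly a sum of
-- several, if a + r and b + l are the same up to a slack k.

linear : ∀ {l r a b} → l ≤ r → ∀ k → a + r + k ≡ b + l → a ≤ b
linear {l} {r} {a} {b} l≤r k eq = +-cancelʳ-≤ l a b (≤-trans (+-monoʳ-≤ a l≤r) (≤-trans (m≤m+n _ k) (≤-reflexive eq)))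

-- The solver for commutative monoids has no numeral but 0, so 1 enters as a further variable,
-- called `i` below.
linearly : ∀ {n} (a b l r k : Expr n) → Expr n × Expr n
linearly a b l r k = (a ∔ r) ∔ k ⊜ b ∔ l

-- Boolean tests, rearranged lists and the best fit

≤ᵇ-true : ∀ {a b} → a ≤ b → (a ≤ᵇ b) ≡ true
≤ᵇ-true a≤b = Equivalence.to T-≡ (≤⇒≤ᵇ a≤b)

true-≤ᵇ : ∀ {a b} → (a ≤ᵇ b) ≡ true → a ≤ b
true-≤ᵇ {a} {b} eq = ≤ᵇ⇒≤ a b (Equivalence.from T-≡ eq)

false-≤ᵇ : ∀ {a b} → (a ≤ᵇ b) ≡ false → b < a
false-≤ᵇ eq = ≰⇒> λ a≤b → case-⊥ (trans (sym (≤ᵇ-true a≤b)) eq)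
  where case-⊥ : true ≡ false → ⊥
        case-⊥ ()

≤ᵇ-false : ∀ {a b} → b < a → (a ≤ᵇ b) ≡ false
≤ᵇ-false {a} {b} b<a with a ≤ᵇ b in eq
... | false = refl
... | true  = ⊥-elim (<⇒≱ b<a (true-≤ᵇ eq))

𝟙 : Bool → ℕ
𝟙 true  = 1
𝟙 false = 0

𝟙≤1 : ∀ b → 𝟙 b ≤ 1
𝟙≤1 true  = ≤-refl
𝟙≤1 false = z≤n

All-push : ∀ {P : S → Set} p y l → P y → All P l → All P (push p y l)
All-push p y []      py []         = py ∷ []
All-push p y (h ∷ t) py (ph ∷ pt) with p y
... | true  = py ∷ ph ∷ pt
... | false = ph ∷ py ∷ pt

All-pull : ∀ {P : S → Set} p i xs → All P i → All P xs → All P (pull p i xs)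
All-pull p i []       pi []         = pi
All-pull p i (x ∷ xs) pi (px ∷ pxs) = All-push p x _ px (All-pull p i xs pi pxs)

pull-[] : ∀ (p : S → Bool) xs → pull p [] xs ≡ [] → xs ≡ []
pull-[] p []       eq = refl
pull-[] p (x ∷ xs) eq with pull p [] xs
pull-[] p (x ∷ xs) () | []
pull-[] p (x ∷ xs) eq | h ∷ t with p x
pull-[] p (x ∷ xs) () | h ∷ t | true
pull-[] p (x ∷ xs) () | h ∷ t | false

-- An element that satisfies `p` takes the head and yields it only to another such element, so a
-- head without the property excludes all.
pull-none : ∀ (p : S → Bool) xs {h t} → pull p [] xs ≡ h ∷ t → p h ≡ false → All (λ x → p x ≡ false) xs
pull-none p []       ()   _
pull-none p (x ∷ xs) eq ph with pull p [] xs in eq′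
... | [] with refl ← eq | refl ← pull-[] p xs eq′ = ph ∷ []
... | h ∷ t with p x in px
...   | false with refl ← eq = px ∷ pull-none p xs eq′ ph
...   | true  with refl ← eq with () ← trans (sym ph) px

_⊰_ : Item → Item → Set
x ⊰ y = eᵢ x ≤ sᵢ y

Valid : Item → Set
Valid x = sᵢ x < eᵢ x

IsChain : Chain → Set
IsChain c = AllPairs _⊰_ c × All Valid c

-- The order by first start, with empty chains last. Phrased through `fits`, it needs no start time
-- for an empty chain.
_≼_ : Chain → Chain → Set
c ≼ c′ = ∀ θ → fits θ c ≡ true → fits θ c′ ≡ true

FirstFit : ℕ → Chain → List Chain → Set
FirstFit e h t = AllPairs _≼_ t × (fits e h ≡ true → All (λ c → fits e c ≡ true → h ≼ c) t)

pull-first : ∀ e cs {h t} → AllPairs _≼_ cs → pull (fits e) [] cs ≡ h ∷ t → FirstFit e h t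
pull-first e []       _ ()
pull-first e (c ∷ cs) (c≼ ∷ ≼cs) eq with pull (fits e) [] cs in eq′ | All-pull (fits e) [] cs [] c≼
... | [] | _ with refl ← eq = [] , λ _ → []
... | h ∷ t | c≼h ∷ c≼t with pull-first e cs ≼cs eq′ | fits e c in fc
...   | ≼t , first | false with refl ← eq = c≼t ∷ ≼t , λ fh → (λ fc′ → case fc fc′) ∷ first fh
  where case : ∀ {b} {P : Set} → b ≡ false → b ≡ true → P
        case refl ()
-- If `c` fits, so do all chains after it; `h` is then the least of these and may return to the
-- front of `t` without disturbing the order.
...   | ≼t , first | true  with refl ← eq =
  All.zipWith (λ (f , c≼c′) → f (c≼c′ e fc)) (first (c≼h e fc) , c≼t) ∷ ≼t ,
  λ _ → All.map const (c≼h ∷ c≼t)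

-- That `h ∷ t` is a permutation of `cs` is recorded in the two forms in which it is applied: equal
-- totals and transfer of `All`.
data PlaceView (x : Item) (cs : List Chain) : List Chain → Set₁ where
  placed   : ∀ h t → fits (eᵢ x) h ≡ true → (∀ f → f h + total f t ≡ total f cs) →
             (∀ {P : Chain → Set} → All P cs → All P (h ∷ t)) →
             (AllPairs _≼_ cs → AllPairs _≼_ t × All (λ c → fits (eᵢ x) c ≡ true → h ≼ c) t) →
             PlaceView x cs ((x ∷ h) ∷ t)
  rejected : All (λ c → fits (eᵢ x) c ≡ false) cs → PlaceView x cs cs

placeView : ∀ x cs → PlaceView x cs (place x cs)
placeView x cs with pull (fits (eᵢ x)) [] cs in eq
... | [] rewrite pull-[] _ cs eq = rejected []
... | h ∷ t with fits (eᵢ x) h in fh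
...   | false = rejected (pull-none _ cs eq fh)
...   | true  = placed h t fh (λ f → trans (cong (total f) (sym eq)) (total-pull f _ [] cs))
                (λ {P} ps → subst (All P) eq (All-pull _ [] cs [] ps))
                (λ ≼cs → let ≼t , first = pull-first (eᵢ x) cs ≼cs eq in ≼t , first fh)

-- The greedy schedule accepts the maximum number of items

record GreedyInvariant (p : ℕ) (L : List Item) (cs : List Chain) : Set where
  field
    chains  : All IsChain cs
    sorted  : AllPairs _≼_ cs
    -- The chains start no earlier than the items processed so far. So the next item, which starts
    -- no later than these, makes its chain the first one in the order.
    later   : ∀ θ → All (λ y → θ ≤ sᵢ y) L → All (λ c → fits θ c ≡ true) cs
    count≤  : total length cs ≤ length L
    width   : length cs ≡ p

open GreedyInvariant

fits-∷ : ∀ {θ x c} → θ ≤ sᵢ x → fits θ (x ∷ c) ≡ true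
fits-∷ = ≤ᵇ-true

chain-∷ : ∀ x c → Valid x → fits (eᵢ x) c ≡ true → IsChain c → IsChain (x ∷ c)
chain-∷ x []      vx _  _                                = [] ∷ [] , vx ∷ []
chain-∷ x (y ∷ c) vx fy (y⊰ ∷ ⊰c , vy ∷ vc) =
  (x⊰y ∷ All.map (λ y⊰z → ≤-trans x⊰y (≤-trans (<⇒≤ vy) y⊰z)) y⊰) ∷ y⊰ ∷ ⊰c , vx ∷ vy ∷ vc
  where x⊰y : x ⊰ y
        x⊰y = true-≤ᵇ {eᵢ x} fy

width≡ : ∀ {x cs cs′} → PlaceView x cs cs′ → length cs′ ≡ length cs
width≡ {cs = cs} (placed h t _ tot _ _) = trans (sym (one (h ∷ t))) (trans (tot (λ _ → 1)) (one cs))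
  where one : ∀ {S : Set} (xs : List S) → total (λ _ → 1) xs ≡ length xs
        one []       = refl
        one (x ∷ xs) = cong suc (one xs)
width≡ (rejected _) = refl

greedy-invariant : ∀ {p cs₀} → GreedyInvariant p [] cs₀ → ∀ L → All Valid L →
                   AllPairs (λ x y → sᵢ x ≤ sᵢ y) L → GreedyInvariant p L (foldr place cs₀ L)
greedy-invariant inv₀ []      _ _ = inv₀
greedy-invariant {p} {cs₀} inv₀ (x ∷ L) (vx ∷ vL) (x≤ ∷ ≤L) = step (placeView x cs)
  where
  cs  = foldr place cs₀ L
  inv : GreedyInvariant p L cs
  inv = greedy-invariant inv₀ L vL ≤L
  step : ∀ {cs′} → PlaceView x cs cs′ → GreedyInvariant p (x ∷ L) cs′
  step v@(rejected _) = record
    { chains = chains inv ; sorted = sorted inv ; later = λ { θ (_ ∷ θ≤) → later inv θ θ≤ }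
    ; count≤ = m≤n⇒m≤1+n (count≤ inv) ; width = width inv }
  step v@(placed h t fh tot all first) = record
    { chains = let cs′ = all (chains inv) in chain-∷ x h vx fh (All.head cs′) ∷ All.tail cs′
    ; sorted = All.map (λ {c} fc θ fx → fits-mono {θ} {sᵢ x} {c} (true-≤ᵇ fx) fc) (All.tail (all (later inv (sᵢ x) x≤)))
               ∷ proj₁ (first (sorted inv))
    ; later  = λ { θ (θ≤x ∷ θ≤) → fits-∷ {θ} {x} {h} θ≤x ∷ All.tail (all (later inv θ θ≤)) }
    ; count≤ = s≤s (≤-trans (≤-reflexive (tot length)) (count≤ inv))
    ; width  = trans (width≡ v) (width inv) }
    where
    fits-mono : ∀ {θ θ′ c} → θ ≤ θ′ → fits θ′ c ≡ true → fits θ c ≡ true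
    fits-mono {c = []}    _    _ = refl
    fits-mono {c = y ∷ c} θ≤θ′ f = ≤ᵇ-true (≤-trans θ≤θ′ (true-≤ᵇ f))

∑-mono : ∀ {n} {f g : Fin n → ℕ} → (∀ i → f i ≤ g i) → ∑ f ≤ ∑ g
∑-mono {zero}  f≤g = z≤n
∑-mono {suc n} f≤g = +-mono-≤ (f≤g zero) (∑-mono (f≤g ∘ suc))

∑-strict : ∀ {n} {f g : Fin n → ℕ} i → f i < g i → (∀ i → f i ≤ g i) → ∑ f < ∑ g
∑-strict {suc n} zero    fi<gi f≤g = +-mono-≤ fi<gi (∑-mono (f≤g ∘ suc))
∑-strict {suc n} (suc i) fi<gi f≤g = +-mono-≤-< (f≤g zero) (∑-strict i fi<gi (f≤g ∘ suc))

∑-update : ∀ {n} {f g : Fin n → ℕ} i → (∀ j → j ≢ i → g j ≡ f j) → ∑ g + f i ≡ ∑ f + g i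
∑-update {suc n} {f} {g} zero    same = trans
  (cong (λ z → g zero + z + f zero) (∑-cong (λ j → same (suc j) λ ())))
  (r (g zero) (∑ (f ∘ suc)) (f zero))
  where
  r : ∀ a b c → a + b + c ≡ c + b + a
  r = solve-∀
∑-update {suc n} {f} {g} (suc i) same = trans (+-assoc (g zero) _ _)
  (trans (cong₂ _+_ (same zero λ ()) (∑-update i (λ j j≢i → same (suc j) (j≢i ∘ Fin.suc-injective))))
    (sym (+-assoc (f zero) _ _)))

∑-zero : ∀ n → ∑ {n} (const 0) ≡ 0
∑-zero zero    = refl
∑-zero (suc n) = ∑-zero n

∑-one : ∀ n → ∑ {n} (λ _ → 1) ≡ n
∑-one zero    = refl
∑-one (suc n) = cong suc (∑-one n)

total-mono : ∀ {f g : S → ℕ} {xs} → All (λ x → f x ≤ g x) xs → total f xs ≤ total g xs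
total-mono []          = z≤n
total-mono (f≤g ∷ fs≤gs) = +-mono-≤ f≤g (total-mono fs≤gs)

busy : ℕ → Chain → ℕ
busy θ c = 𝟙 (not (fits θ c))

𝟙-not : ∀ {b c} → (b ≡ true → c ≡ true) → 𝟙 (not c) ≤ 𝟙 (not b)
𝟙-not {true}  {true}  _ = z≤n
𝟙-not {true}  {false} f with () ← f refl
𝟙-not {false} {c}     _ = 𝟙≤1 (not c)

-- Any schedule τ is kept track of by the start φ of the first item of each
-- machine; K is an upper bound of all times.

module Domination {m : ℕ} (τ : Item → Maybe (Fin m)) (K : ℕ) where

  φ : List Item → Fin m → ℕ
  φ []      i = K
  φ (x ∷ L) i = if does (Maybe.≡-dec Fin._≟_ (τ x) (just i)) then sᵢ x else φ L i

  busyᵗ : ℕ → List Item → ℕ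
  busyᵗ θ L = ∑ (λ i → 𝟙 (not (θ ≤ᵇ φ L i)))

  accepted : List Item → ℕ
  accepted = total (λ x → 𝟙 (is-just (τ x)))

  Compatible : Item → Item → Set
  Compatible x y = sᵢ x ≤ sᵢ y × (∀ i → τ x ≡ just i → τ y ≡ just i → x ⊰ y)

  φ-same : ∀ x L i → τ x ≡ just i → φ (x ∷ L) i ≡ sᵢ x
  φ-same x L i eq with Maybe.≡-dec Fin._≟_ (τ x) (just i)
  ... | yes _ = refl
  ... | no ne = ⊥-elim (ne eq)

  φ-other : ∀ x L i → τ x ≢ just i → φ (x ∷ L) i ≡ φ L i
  φ-other x L i ne with Maybe.≡-dec Fin._≟_ (τ x) (just i)
  ... | yes eq = ⊥-elim (ne eq)
  ... | no _   = refl

  φ≥ : ∀ θ L i → θ ≤ K → All (λ y → τ y ≡ just i → θ ≤ sᵢ y) L → θ ≤ φ L i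
  φ≥ θ []      i θ≤K _ = θ≤K
  φ≥ θ (x ∷ L) i θ≤K (θ≤x ∷ θ≤L) with Maybe.≡-dec Fin._≟_ (τ x) (just i)
  ... | yes eq = θ≤x eq
  ... | no _   = φ≥ θ L i θ≤K θ≤L

  busyᵗ-reject : ∀ θ x L → τ x ≡ nothing → busyᵗ θ (x ∷ L) ≡ busyᵗ θ L
  busyᵗ-reject θ x L eq = ≤-antisym (∑-mono λ i → ≤-reflexive (same i)) (∑-mono λ i → ≤-reflexive (sym (same i)))
    where
    same : ∀ i → 𝟙 (not (θ ≤ᵇ φ (x ∷ L) i)) ≡ 𝟙 (not (θ ≤ᵇ φ L i))
    same i = cong (λ z → 𝟙 (not (θ ≤ᵇ z))) (φ-other x L i λ eq′ → case (trans (sym eq) eq′))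
      where case : nothing ≡ just i → ⊥
            case ()

  busyᵗ-accept : ∀ θ x L i → τ x ≡ just i →
                 busyᵗ θ (x ∷ L) + 𝟙 (not (θ ≤ᵇ φ L i)) ≡ busyᵗ θ L + 𝟙 (not (θ ≤ᵇ sᵢ x))
  busyᵗ-accept θ x L i eq = trans
    (∑-update i λ j j≢i → cong (λ z → 𝟙 (not (θ ≤ᵇ z))) (φ-other x L j λ eq′ → j≢i (Maybe.just-injective (trans (sym eq′) eq))))
    (cong (λ z → busyᵗ θ L + 𝟙 (not (θ ≤ᵇ z))) (φ-same x L i eq))

  -- Machine `i` is free at e and busy at θ, and no machine busy at e is free at the later time θ.
  busyᵗ-< : ∀ {e θ} L i → e ≤ φ L i → φ L i < θ → busyᵗ e L < busyᵗ θ L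
  busyᵗ-< {e} {θ} L i e≤φ φ<θ = ∑-strict i
    (subst₂ (λ b c → 𝟙 (not b) < 𝟙 (not c)) (sym (≤ᵇ-true e≤φ)) (sym (≤ᵇ-false φ<θ)) ≤-refl)
    (λ j → 𝟙-not {θ ≤ᵇ φ L j} {e ≤ᵇ φ L j} λ θ≤ → ≤ᵇ-true (≤-trans (≤-trans e≤φ (<⇒≤ φ<θ)) (true-≤ᵇ θ≤)))

  busyᵗ<m : ∀ {e} L i → e ≤ φ L i → busyᵗ e L < m
  busyᵗ<m {e} L i e≤φ = <-≤-trans
    (∑-strict {g = λ _ → 1} i (subst (λ b → 𝟙 (not b) < 1) (sym (≤ᵇ-true e≤φ)) ≤-refl) (λ j → 𝟙≤1 _))
    (≤-reflexive (∑-one m))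

  -- In addition to accepting at least as many items as τ, the greedy schedule
  -- has to be ahead by the number of machines on which it may fall behind.

  Dominated : List Item → List Chain → Set
  Dominated L cs = ∀ θ → accepted L + total (busy θ) cs ≤ total length cs + busyᵗ θ L

  -- In these inequalities the letters T and G refer to τ and the greedy
  -- schedule, n to accepted items, b to busy machines (before e with an index
  -- e), h and t to the chosen chain and the others, σ and α to machines that
  -- start before θ with and without the new item.

  private
    placed-reject : ∀ {nT nG bT bG lh lt bh bt σ} → nG ≡ lh + lt → bh + bt ≡ bG → nT + bG ≤ nG + bT →
        σ ≤ 1 → nT + (σ + bt) ≤ suc (lh + lt) + bT
    placed-reject {nT} {nG} {bT} {bG} {lh} {lt} {bh} {bt} {σ} lG bG≡ inv σ≤1 = linear (+-mono-≤ (+-mono-≤ (+-mono-≤ (≤-reflexive lG) (≤-reflexive bG≡)) inv) σ≤1) bh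
      (solve 10 (λ nT nG bT bG lh lt bh bt σ i →
        linearly (nT ∔ (σ ∔ bt)) ((i ∔ (lh ∔ lt)) ∔ bT) (((nG ∔ (bh ∔ bt)) ∔ (nT ∔ bG)) ∔ σ) ((((lh ∔ lt) ∔ bG) ∔ (nG ∔ bT)) ∔ i) bh)
        refl nT nG bT bG lh lt bh bt σ 1)

    placed-accept : ∀ {nT lG bT bT′ bt α σ} → nT + bt + α ≤ lG + bT → bT + σ ≡ bT′ + α →
        suc nT + (σ + bt) ≤ suc lG + bT′
    placed-accept {nT} {lG} {bT} {bT′} {bt} {α} {σ} key upd = linear (+-mono-≤ key (≤-reflexive upd)) 0
      (solve 8 (λ nT lG bT bT′ bt α σ i →
        linearly ((i ∔ nT) ∔ (σ ∔ bt)) ((i ∔ lG) ∔ bT′) (((nT ∔ bt) ∔ α) ∔ (bT ∔ σ)) ((lG ∔ bT) ∔ (bT′ ∔ α)) 𝟘)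
        refl nT lG bT bT′ bt α σ 1)

    ahead : ∀ {nT nG bT bt α bh} → nT + (bh + bt) ≤ nG + bT → α ≤ bh → nT + bt + α ≤ nG + bT
    ahead {nT} {nG} {bT} {bt} {α} {bh} inv α≤ = linear (+-mono-≤ inv α≤) 0
      (solve 7 (λ nT nG bT bt α bh i →
        linearly ((nT ∔ bt) ∔ α) (nG ∔ bT) ((nT ∔ (bh ∔ bt)) ∔ α) ((nG ∔ bT) ∔ bh) 𝟘)
        refl nT nG bT bt α bh 1)

    behind : ∀ {nT nG bT bTₑ bt btₑ bh α} → nT + (bh + btₑ) ≤ nG + bTₑ → bTₑ < bT → bt ≤ btₑ → α ≤ 1 →
        nT + bt + α ≤ nG + bT
    behind {nT} {nG} {bT} {bTₑ} {bt} {btₑ} {bh} {α} inv lt le α≤1 = linear (+-mono-≤ (+-mono-≤ (+-mono-≤ inv lt) le) α≤1) bh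
      (solve 9 (λ nT nG bT bTₑ bt btₑ bh α i →
        linearly ((nT ∔ bt) ∔ α) (nG ∔ bT) ((((nT ∔ (bh ∔ btₑ)) ∔ (i ∔ bTₑ)) ∔ bt) ∔ α) ((((nG ∔ bTₑ) ∔ bT) ∔ btₑ) ∔ i) bh)
        refl nT nG bT bTₑ bt btₑ bh α 1)

    full : ∀ {nT nG bGₑ bTₑ m} → nT + bGₑ ≤ nG + bTₑ → bTₑ < m → m ≤ bGₑ → suc nT ≤ nG
    full {nT} {nG} {bGₑ} {bTₑ} {m} inv lt le = linear (+-mono-≤ (+-mono-≤ inv lt) le) 0
      (solve 6 (λ nT nG bGₑ bTₑ m i →
        linearly (i ∔ nT) nG (((nT ∔ bGₑ) ∔ (i ∔ bTₑ)) ∔ m) (((nG ∔ bTₑ) ∔ m) ∔ bGₑ) 𝟘)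
        refl nT nG bGₑ bTₑ m 1)

    rejected-accept : ∀ {nT bG nG bT bT′ α} → nT + bG + α ≤ nG + bT → bT + 1 ≡ bT′ + α →
        suc nT + bG ≤ nG + bT′
    rejected-accept {nT} {bG} {nG} {bT} {bT′} {α} key upd = linear (+-mono-≤ key (≤-reflexive upd)) 0
      (solve 7 (λ nT bG nG bT bT′ α i →
        linearly ((i ∔ nT) ∔ bG) (nG ∔ bT′) (((nT ∔ bG) ∔ α) ∔ (bT ∔ i)) ((nG ∔ bT) ∔ (bT′ ∔ α)) 𝟘)
        refl nT bG nG bT bT′ α 1)

    total-0 : ∀ θ {cs} → All (λ c → fits θ c ≡ true) cs → total (busy θ) cs ≡ 0
    total-0 θ [] = refl
    total-0 θ (eq ∷ eqs) rewrite eq = total-0 θ eqs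

    total-1 : ∀ θ {cs} → All (λ c → fits θ c ≡ false) cs → total (busy θ) cs ≡ length cs
    total-1 θ [] = refl
    total-1 θ (eq ∷ eqs) rewrite eq = cong suc (total-1 θ eqs)

    length≤total : ∀ e {cs} → All (λ c → fits e c ≡ false) cs → length cs ≤ total length cs
    length≤total e []                    = z≤n
    length≤total e {(x ∷ c) ∷ cs} (_ ∷ fs) = s≤s (≤-trans (length≤total e fs) (m≤n+m _ (length c)))

  module _ {p x L cs} (inv : GreedyInvariant p L cs) (room : m ≤ p ⊎ suc (length L) ≤ p)
           (vx : Valid x) (x≤K : eᵢ x ≤ K) (compatible : All (Compatible x) L) (dom : Dominated L cs) where

    private
      e = eᵢ x

      e≤φ : ∀ {i} → τ x ≡ just i → e ≤ φ L i
      e≤φ {i} τx = φ≥ e L i x≤K (All.map (λ (_ , c) τy → c i τx τy) compatible)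

      step-reject : ∀ {cs′} → PlaceView x cs cs′ → τ x ≡ nothing → ∀ θ →
                    accepted L + total (busy θ) cs′ ≤ total length cs′ + busyᵗ θ (x ∷ L)
      step-reject (rejected _) τx θ rewrite busyᵗ-reject θ x L τx = dom θ
      step-reject (placed h t _ tot _ _) τx θ rewrite busyᵗ-reject θ x L τx =
        placed-reject {accepted L} {lh = length h} {total length t} {busy θ h} (sym (tot length)) (tot (busy θ)) (dom θ) (𝟙≤1 _)

      -- Critical is a θ at which machine `i` of τ is busy and `h` is free. As `h` is the best fit,
      -- every other chain free at `e` is free at θ too, so domination at `e` may be used instead;
      -- at that time machine `i` is free, which supplies the missing unit.
      key : ∀ {i h t} → τ x ≡ just i → fits e h ≡ true → (∀ f → f h + total f t ≡ total f cs) →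
            All (λ c → fits e c ≡ true → h ≼ c) t → ∀ θ →
            accepted L + total (busy θ) t + 𝟙 (not (θ ≤ᵇ φ L i)) ≤ total length cs + busyᵗ θ L
      key {i} {h} {t} τx fh tot first θ with φ L i <? θ
      ... | no φ≮θ rewrite ≤ᵇ-true {θ} {φ L i} (≮⇒≥ φ≮θ) =
        ahead {accepted L} {total length cs} {busyᵗ θ L} {bh = busy θ h} (subst (λ z → accepted L + z ≤ total length cs + busyᵗ θ L) (sym (tot (busy θ))) (dom θ)) z≤n
      ... | yes φ<θ with fits θ h in fθ
      ...   | false = ahead {accepted L} {total length cs} {busyᵗ θ L} {bh = 1}
        (subst (λ z → accepted L + z ≤ total length cs + busyᵗ θ L) (trans (sym (tot (busy θ))) (cong (λ b → 𝟙 (not b) + total (busy θ) t) fθ)) (dom θ)) (𝟙≤1 _)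
      ...   | true  = behind {accepted L} {total length cs} {busyᵗ θ L} {busyᵗ e L} {btₑ = total (busy e) t} {bh = busy e h} {𝟙 (not (θ ≤ᵇ φ L i))}
        (subst (λ z → accepted L + z ≤ total length cs + busyᵗ e L) (sym (tot (busy e))) (dom e))
        (busyᵗ-< L i (e≤φ τx) φ<θ)
        (total-mono (All.map (λ {c} h≼ → 𝟙-not {fits e c} {fits θ c} λ fc → h≼ fc θ fθ) first)) (𝟙≤1 _)

      step-accept : ∀ {cs′ i} → PlaceView x cs cs′ → τ x ≡ just i → ∀ θ →
                    suc (accepted L) + total (busy θ) cs′ ≤ total length cs′ + busyᵗ θ (x ∷ L)
      step-accept {i = i} (placed h t fh tot _ first) τx θ =
        placed-accept {lG = length h + total length t} {bt = total (busy θ) t}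
          (subst (λ z → accepted L + total (busy θ) t + 𝟙 (not (θ ≤ᵇ φ L i)) ≤ z + busyᵗ θ L) (sym (tot length)) (key τx fh tot (proj₂ (first (GreedyInvariant.sorted inv))) θ))
          (sym (busyᵗ-accept θ x L i τx))
      -- All chains are busy at `e`, but machine `i` of τ is free, so domination at `e` puts the
      -- greedy schedule strictly ahead. This settles θ up to the start of x. For a later θ, either
      -- x makes machine `i` busy, which pays for x, or machine `i` was busy before, and domination
      -- at `e` applies as in `key`.
      step-accept {i = i} (rejected none) τx θ = by-start (≤-<-connex θ (sᵢ x))
        where
        m≤busy : m ≤ total (busy e) cs
        m≤busy = ≤-trans (enough room) (≤-reflexive (sym (trans (total-1 e none) (width inv))))
          where
          enough : m ≤ p ⊎ suc (length L) ≤ p → m ≤ p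
          enough (inj₁ m≤p) = m≤p
          -- With more chains than items processed, some chain is empty and would have taken x.
          enough (inj₂ L<p) = ⊥-elim (<⇒≱ L<p (≤-trans (≤-reflexive (sym (width inv))) (≤-trans (length≤total e none) (count≤ inv))))
        by-start : θ ≤ sᵢ x ⊎ sᵢ x < θ →
            suc (accepted L) + total (busy θ) cs ≤ total length cs + busyᵗ θ (x ∷ L)
        by-start (inj₁ θ≤s) rewrite total-0 θ (later inv θ (All.map (λ (s≤ , _) → ≤-trans θ≤s s≤) compatible)) =
          ≤-trans (≤-reflexive (+-identityʳ _)) (≤-trans (full {accepted L} (dom e) (busyᵗ<m L i (e≤φ τx)) m≤busy) (m≤m+n _ _))
        by-start (inj₂ s<θ) = rejected-accept {accepted L} {total (busy θ) cs} {α = 𝟙 (not (θ ≤ᵇ φ L i))} (by-φ (≤-<-connex θ (φ L i)))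
          (trans (cong (λ b → busyᵗ θ L + 𝟙 (not b)) (sym (≤ᵇ-false s<θ))) (sym (busyᵗ-accept θ x L i τx)))
          where
          by-φ : θ ≤ φ L i ⊎ φ L i < θ →
              accepted L + total (busy θ) cs + 𝟙 (not (θ ≤ᵇ φ L i)) ≤ total length cs + busyᵗ θ L
          by-φ (inj₁ θ≤φ) rewrite ≤ᵇ-true θ≤φ = ≤-trans (≤-reflexive (+-identityʳ _)) (dom θ)
          by-φ (inj₂ φ<θ) = behind {accepted L} {bTₑ = busyᵗ e L} {bh = 0} (dom e) (busyᵗ-< L i (e≤φ τx) φ<θ)
            (total-mono (All.map (λ {c} fc → 𝟙-not {fits e c} {fits θ c} λ fc′ → case fc fc′) none)) (𝟙≤1 _)
            where case : ∀ {b} {P : Set} → b ≡ false → b ≡ true → P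
                  case refl ()

    dominated-step : ∀ {cs′} → PlaceView x cs cs′ → Dominated (x ∷ L) cs′
    dominated-step {cs′} v θ = by-cases (τ x) refl
      where
      goal : Maybe (Fin m) → Set
      goal r = 𝟙 (is-just r) + accepted L + total (busy θ) cs′ ≤ total length cs′ + busyᵗ θ (x ∷ L)
      by-cases : ∀ r → τ x ≡ r → goal (τ x)
      by-cases nothing  τx = subst goal (sym τx) (step-reject v τx θ)
      by-cases (just i) τx = subst goal (sym τx) (step-accept v τx θ)

  dominated : ∀ {p cs₀} → GreedyInvariant p [] cs₀ → ∀ L → m ≤ p ⊎ length L ≤ p → All Valid L → All (λ x → eᵢ x ≤ K) L →
              AllPairs Compatible L → Dominated L (foldr place cs₀ L)
  dominated inv₀ [] _ _ _ _ θ = ≤-trans (≤-reflexive (total-0 θ (later inv₀ θ []))) z≤n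
  dominated {p} {cs₀} inv₀ (x ∷ L) room (vx ∷ vL) (x≤K ∷ L≤K) (cx ∷ cL) =
    dominated-step (greedy-invariant inv₀ L vL (AllPairs.map proj₁ cL)) room vx x≤K cx
      (dominated inv₀ L (weaken room) vL L≤K cL) (placeView x _)
    where weaken : m ≤ p ⊎ suc (length L) ≤ p → m ≤ p ⊎ length L ≤ p
          weaken (inj₁ h) = inj₁ h
          weaken (inj₂ h) = inj₂ (<⇒≤ h)

-- Sorting and the maximality of the greedy schedule

AllPairs-push : ∀ {R : S → S → Set} → Symmetric R → ∀ p y l → All (R y) l → AllPairs R l →
    AllPairs R (push p y l)
AllPairs-push sym-R p y []      _          _          = [] ∷ []
AllPairs-push sym-R p y (h ∷ t) (yh ∷ yt) (ht ∷ Rt) with p y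
... | true  = (yh ∷ yt) ∷ ht ∷ Rt
... | false = (sym-R yh ∷ ht) ∷ yt ∷ Rt

AllPairs-insert : ∀ {R : S → S → Set} → Symmetric R → ∀ p x ys → All (R x) ys → AllPairs R ys →
                  AllPairs R (pull p (x ∷ []) ys)
AllPairs-insert sym-R p x []       _          _          = [] ∷ []
AllPairs-insert sym-R p x (y ∷ ys) (xy ∷ xys) (yys ∷ Rys) =
  AllPairs-push sym-R p y _ (All-pull p _ ys (sym-R xy ∷ []) yys) (AllPairs-insert sym-R p x ys xys Rys)

pull-rejects : ∀ (p : S → Bool) x ys → All (λ y → p y ≡ false) ys → pull p (x ∷ []) ys ≡ x ∷ ys
pull-rejects p x []       []         = refl
pull-rejects p x (y ∷ ys) (py ∷ pys) rewrite pull-rejects p x ys pys | py = refl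

_≤ˢ_ : Item → Item → Set
x ≤ˢ y = sᵢ x ≤ sᵢ y

insert-sorted : ∀ x ys → AllPairs _≤ˢ_ ys → AllPairs _≤ˢ_ (pull (λ y → sᵢ y ≤ᵇ sᵢ x) (x ∷ []) ys)
insert-sorted x []       _             = [] ∷ []
insert-sorted x (y ∷ ys) (y≤ys ∷ ≤ys) with sᵢ y ≤? sᵢ x
... | no y≰x rewrite pull-rejects (λ y → sᵢ y ≤ᵇ sᵢ x) x ys
                       (All.map (λ y≤z → ≤ᵇ-false (<-≤-trans (≰⇒> y≰x) y≤z)) y≤ys)
                   | ≤ᵇ-false (≰⇒> y≰x) =
  (<⇒≤ (≰⇒> y≰x) ∷ All.map (≤-trans (<⇒≤ (≰⇒> y≰x))) y≤ys) ∷ y≤ys ∷ ≤ys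
... | yes y≤x with pull (λ y → sᵢ y ≤ᵇ sᵢ x) (x ∷ []) ys | insert-sorted x ys ≤ys
                 | All-pull (λ y → sᵢ y ≤ᵇ sᵢ x) (x ∷ []) ys (y≤x ∷ []) y≤ys
...   | []    | _   | _ = [] ∷ []
...   | h ∷ t | ≤ht | y≤ rewrite ≤ᵇ-true y≤x = y≤ ∷ ≤ht

sort-sorted : ∀ L → AllPairs _≤ˢ_ (sortByStart L)
sort-sorted []      = []
sort-sorted (x ∷ L) = insert-sorted x _ (sort-sorted L)

All-sort : ∀ {P : Item → Set} L → All P L → All P (sortByStart L)
All-sort []      []       = []
All-sort (x ∷ L) (p ∷ ps) = All-pull _ (x ∷ []) _ (p ∷ []) (All-sort L ps)

AllPairs-sort : ∀ {R : Item → Item → Set} → Symmetric R → ∀ L → AllPairs R L → AllPairs R (sortByStart L)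
AllPairs-sort sym-R []      []         = []
AllPairs-sort sym-R (x ∷ L) (xR ∷ Rs) = AllPairs-insert sym-R _ x _ (All-sort L xR) (AllPairs-sort sym-R L Rs)

total-sort : ∀ f L → total f (sortByStart L) ≡ total f L
total-sort f []      = refl
total-sort f (x ∷ L) = trans (total-pull f (λ y → sᵢ y ≤ᵇ sᵢ x) (x ∷ []) (sortByStart L)) (cong₂ _+_ (+-identityʳ (f x)) (total-sort f L))

total-one : ∀ (xs : List S) → total (const 1) xs ≡ length xs
total-one []       = refl
total-one (x ∷ xs) = cong suc (total-one xs)

total-0 : ∀ {f : S → ℕ} {xs} → All (λ x → f x ≡ 0) xs → total f xs ≡ 0
total-0 []         = refl
total-0 (eq ∷ eqs) = cong₂ _+_ eq (total-0 eqs)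

length-pull : ∀ (p : S → Bool) i xs → length (pull p i xs) ≡ length i + length xs
length-pull p i xs = trans (sym (total-one (pull p i xs))) (trans (total-pull (const 1) p i xs) (cong₂ _+_ (total-one i) (total-one xs)))

length-sort : ∀ L → length (sortByStart L) ≡ length L
length-sort L = trans (sym (total-one (sortByStart L))) (trans (total-sort (const 1) L) (total-one L))

emptyChains-empty : ∀ m L → All (_≡ []) (emptyChains m L)
emptyChains-empty m []      = []
emptyChains-empty m (x ∷ L) with suc (length (emptyChains m L)) ≤ᵇ m
... | true  = refl ∷ emptyChains-empty m L
... | false = emptyChains-empty m L

length-emptyChains : ∀ m L → length (emptyChains m L) ≡ m ⊓ length L
length-emptyChains m []      = sym (⊓-zeroʳ m)
length-emptyChains m (x ∷ L) with suc (length (emptyChains m L)) ≤ᵇ m in eq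
... | true  = trans (cong suc len) (sym (m≥n⇒m⊓n≡n (subst (λ k → suc k ≤ m) len (true-≤ᵇ eq))))
  where
  len : length (emptyChains m L) ≡ length L
  len = trans (length-emptyChains m L) (m≥n⇒m⊓n≡n (≮⇒≥ λ m<L → <⇒≱ (true-≤ᵇ {suc (length (emptyChains m L))} eq)
    (≤-reflexive (sym (trans (length-emptyChains m L) (m≤n⇒m⊓n≡m (<⇒≤ m<L)))))))
... | false = trans (length-emptyChains m L) (trans (m≤n⇒m⊓n≡m m≤L) (sym (m≤n⇒m⊓n≡m (m≤n⇒m≤1+n m≤L))))
  where
  m≤L : m ≤ length L
  m≤L = ≤-trans (≤-pred (false-≤ᵇ eq)) (≤-trans (≤-reflexive (length-emptyChains m L)) (m⊓n≤n m (length L)))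

emptyChains-invariant : ∀ m L → GreedyInvariant (m ⊓ length L) [] (emptyChains m L)
emptyChains-invariant m L = record
  { chains = All.map (λ { refl → [] , [] }) empty
  ; sorted = ≼-empty empty
  ; later  = λ θ _ → All.map (λ { refl → refl }) empty
  ; count≤ = ≤-reflexive (total-0 (All.map (cong length) empty))
  ; width  = length-emptyChains m L }
  where
  empty = emptyChains-empty m L
  ≼-empty : ∀ {cs} → All (_≡ []) cs → AllPairs _≼_ cs
  ≼-empty []          = []
  ≼-empty (_ ∷ es) = All.map (λ { refl _ _ → refl }) es ∷ ≼-empty es

greedyInvariant : ∀ m L → All Valid L → GreedyInvariant (m ⊓ length L) (sortByStart L) (greedy m L)
greedyInvariant m L vL = greedy-invariant (emptyChains-invariant m L) (sortByStart L) (All-sort L vL) (sort-sorted L)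

total-greedy : ∀ f m L → total (total f) (greedy m L) ≤ total f L
total-greedy f m L = ≤-trans (loop (sortByStart L)) (≤-reflexive (total-sort f L))
  where
  loop : ∀ xs → total (total f) (foldr place (emptyChains m L) xs) ≤ total f xs
  loop []       = ≤-reflexive (total-0 (All.map (cong (total f)) (emptyChains-empty m L)))
  loop (x ∷ xs) = ≤-trans (total-place (total f) f (λ _ _ → refl) x (foldr place (emptyChains m L) xs)) (+-monoʳ-≤ (f x) (loop xs))

module _ {m} (τ : Item → Maybe (Fin m)) where

  Disjoint : Item → Item → Set
  Disjoint x y = Valid x × Valid y × (∀ i → τ x ≡ just i → τ y ≡ just i → x ⊰ y ⊎ y ⊰ x)

  Disjoint-sym : Symmetric Disjoint
  Disjoint-sym (vx , vy , d) = vy , vx , λ i τy τx → [ inj₂ , inj₁ ] (d i τx τy)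

  greedy-maximum : ∀ L → All Valid L → AllPairs Disjoint L →
                   total (λ x → 𝟙 (is-just (τ x))) L ≤ total length (greedy m L)
  greedy-maximum L vL dL = begin
    accepted L                    ≡⟨ sym (total-sort _ L) ⟩
    accepted (sortByStart L)      ≤⟨ m≤m+n _ _ ⟩
    -- At time 0 nothing is busy, so domination there compares the two numbers of accepted items.
    accepted (sortByStart L) + total (busy 0) (greedy m L) ≤⟨ dominated (emptyChains-invariant m L) (sortByStart L) room
         (All-sort L vL) (All-sort L (ends≤ L)) (AllPairs.map compatible (AllPairs.zip (sort-sorted L , AllPairs-sort Disjoint-sym L dL))) 0 ⟩
    total length (greedy m L) + busyᵗ 0 (sortByStart L) ≡⟨ cong (total length (greedy m L) +_) (∑-zero m) ⟩
    total length (greedy m L) + 0 ≡⟨ +-identityʳ _ ⟩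
    total length (greedy m L)     ∎
    where
    open ≤-Reasoning
    open Domination τ (total eᵢ L)
    ends≤ : ∀ L → All (λ x → eᵢ x ≤ total eᵢ L) L
    ends≤ []      = []
    ends≤ (x ∷ L) = m≤m+n _ _ ∷ All.map (λ e≤ → ≤-trans e≤ (m≤n+m _ (eᵢ x))) (ends≤ L)
    room : m ≤ m ⊓ length L ⊎ length (sortByStart L) ≤ m ⊓ length L
    room with ≤-total m (length L)
    ... | inj₁ m≤L = inj₁ (≤-reflexive (sym (m≤n⇒m⊓n≡m m≤L)))
    ... | inj₂ L≤m = inj₂ (≤-reflexive (trans (length-sort L) (sym (m≥n⇒m⊓n≡n L≤m))))
    compatible : ∀ {x y} → x ≤ˢ y × Disjoint x y → Compatible x y
    compatible (x≤y , vx , vy , d) = x≤y , λ i τx τy →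
      [ (λ x⊰y → x⊰y) , (λ y⊰x → ⊥-elim (<⇒≱ vy (≤-trans y⊰x x≤y))) ] (d i τx τy)

ceil-lower : ∀ (fuel : List S) b a {q} → ceil fuel b a ≡ suc q → b * q < a
ceil-lower []         b a ()
ceil-lower (_ ∷ fuel) b a eq with suc (b * ceil fuel b a) ≤ᵇ a in le
... | true  with refl ← eq = true-≤ᵇ le
... | false = ceil-lower fuel b a eq

-- Either the search stops at a sufficient quotient, or it counts up to the whole length of the
-- fuel, where the hypothesis takes over.
ceil-upper : ∀ (fuel : List S) b a → a ≤ b * length fuel → a ≤ b * ceil fuel b a
ceil-upper fuel b a a≤ = [ (λ le → le) , (λ eq → subst (λ q → a ≤ b * q) (sym eq) a≤) ] (loop fuel)
  where
  loop : ∀ fuel → a ≤ b * ceil fuel b a ⊎ ceil fuel b a ≡ length fuel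
  loop []         = inj₂ refl
  loop (_ ∷ fuel) with suc (b * ceil fuel b a) ≤ᵇ a in le
  ... | false = inj₁ (≤-pred (false-≤ᵇ le))
  ... | true  with loop fuel
  ...   | inj₁ a≤bq = ⊥-elim (<⇒≱ (true-≤ᵇ {suc (b * ceil fuel b a)} le) a≤bq)
  ...   | inj₂ eq   = inj₂ (cong suc eq)

-- Exchanging the ends of two chains

All-filter : ∀ (p : S → Bool) xs → All (λ x → p x ≡ true) (filterᵇ p xs)
All-filter p []       = []
All-filter p (x ∷ xs) with p x in eq
... | true  = eq ∷ All-filter p xs
... | false = All-filter p xs

All-filter⁺ : ∀ {P : S → Set} p {xs} → All P xs → All P (filterᵇ p xs)
All-filter⁺ p = All.filter⁺ (T? ∘ p)

chain-filter : ∀ p {c} → IsChain c → IsChain (filterᵇ p c)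
chain-filter p (⊰c , vc) = AllPairs.filter⁺ (T? ∘ p) ⊰c , All-filter⁺ p vc

chain-++ : ∀ t {c d} → IsChain c → IsChain d → All (λ x → eᵢ x ≤ t) c → All (λ y → t ≤ sᵢ y) d → IsChain (c ++ d)
chain-++ t (⊰c , vc) (⊰d , vd) c≤t t≤d =
  AllPairs.++⁺ ⊰c ⊰d (All.map (λ x≤t → All.map (≤-trans x≤t) t≤d) c≤t) , All.++⁺ vc vd

chain-cutFront : ∀ t {A B} → IsChain A → IsChain B → IsChain (cutFront t A B)
chain-cutFront t {A} {B} cA cB = chain-++ t (chain-filter _ cA) (chain-filter _ cB)
  (All.map true-≤ᵇ (All-filter (λ x → eᵢ x ≤ᵇ t) A)) (All.map true-≤ᵇ (All-filter (λ x → t ≤ᵇ sᵢ x) B))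

not-true : ∀ {b} → not b ≡ true → b ≡ false
not-true {false} _ = refl

-- No item of A crosses the end of another one, so A itself is cut without loss.
chain-at-end : ∀ {A a} → IsChain A → a ∈ A → All (λ x → eᵢ x ≤ eᵢ a ⊎ eᵢ a ≤ sᵢ x) A
chain-at-end (x⊰ ∷ ⊰c , vx ∷ vc) (here refl) = inj₁ ≤-refl ∷ All.map inj₂ x⊰
chain-at-end (x⊰ ∷ ⊰c , vx ∷ vc) (there a∈c) =
  inj₁ (≤-trans (All.lookup x⊰ a∈c) (<⇒≤ (All.lookup vc a∈c))) ∷ chain-at-end (⊰c , vc) a∈c

chain-cutBack : ∀ {A B a} → IsChain A → IsChain B → a ∈ A → IsChain (cutBack (eᵢ a) A B)
chain-cutBack {A} {B} {a} cA cB a∈A = chain-++ t (chain-filter _ (chain-filter _ cB)) (chain-filter _ cA)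
  (All.map true-≤ᵇ (All-filter (λ x → eᵢ x ≤ᵇ t) (filterᵇ (λ x → not (t ≤ᵇ sᵢ x)) B)))
  (All.zipWith (λ (late , or) → [ (λ e≤t → ⊥-elim (<⇒≱ (false-≤ᵇ (not-true late)) e≤t)) , (λ t≤s → t≤s) ] or)
    (All-filter (λ x → not (eᵢ x ≤ᵇ t)) A , All-filter⁺ (λ x → not (eᵢ x ≤ᵇ t)) (chain-at-end cA a∈A)))
  where t = eᵢ a

chain-split : ∀ τ {A B} → IsChain A → IsChain B →
    IsChain (proj₁ (split τ A B)) × IsChain (proj₂ (split τ A B))
chain-split τ {A} {B} cA cB = split-elim (λ (c , d) → IsChain c × IsChain d) τ A B (([] , []) , [] , [])
  λ {a} a∈A _ → chain-cutFront (eᵢ a) cA cB , chain-cutBack cA cB a∈A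

length-filter : ∀ (p : S → Bool) xs → length (filterᵇ p xs) + length (filterᵇ (not ∘ p) xs) ≡ length xs
length-filter p xs = trans (cong₂ _+_ (sym (total-one (filterᵇ p xs))) (sym (total-one (filterᵇ (not ∘ p) xs))))
  (trans (total-filter (const 1) p xs) (total-one xs))

crossing≤1 : ∀ t {c} → AllPairs _⊰_ c → All (λ x → sᵢ x < t) c → All (λ x → t < eᵢ x) c → length c ≤ 1
crossing≤1 t []               _            _            = z≤n
crossing≤1 t (_ ∷ [])         _            _            = ≤-refl
crossing≤1 t ((x⊰y ∷ _) ∷ _ ∷ _) (_ ∷ y<t ∷ _) (t<x ∷ _) = ⊥-elim (<-irrefl refl (<-trans t<x (≤-<-trans x⊰y y<t)))

length-cutFront : ∀ t A B → length (cutFront t A B) ≡ length (filterᵇ (λ x → eᵢ x ≤ᵇ t) A) + length (filterᵇ (λ x → t ≤ᵇ sᵢ x) B)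
length-cutFront t A B = length-++ (filterᵇ (λ x → eᵢ x ≤ᵇ t) A)

private
  -- A₁ and A₂ count the items of A that end by t and the others; B₂ those of B that start from t
  -- on, and B₀ the others, of which B₁ end by t and B₃ contain t. F and K are the lengths of front
  -- and back.
  cut-count : ∀ {A₁ A₂ B₀ B₁ B₂ B₃ A B F K} → A ≡ A₁ + A₂ → B ≡ B₂ + B₀ → B₀ ≡ B₁ + B₃ → A₁ + B₂ ≡ F →
      B₁ + A₂ ≡ K → B₃ ≤ 1 → A + B ≤ suc (F + K)
  cut-count {A₁} {A₂} {B₀} {B₁} {B₂} {B₃} {A} {B} {F} {K} a b b₀ f k b₃ = linear (+-mono-≤ (+-mono-≤ (+-mono-≤ (+-mono-≤ (+-mono-≤ (≤-reflexive a) (≤-reflexive b)) (≤-reflexive b₀)) (≤-reflexive f)) (≤-reflexive k)) b₃) 0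
    (solve 11 (λ A₁ A₂ B₀ B₁ B₂ B₃ A B F K i →
      linearly (A ∔ B) (i ∔ (F ∔ K)) (((((A ∔ B) ∔ B₀) ∔ (A₁ ∔ B₂)) ∔ (B₁ ∔ A₂)) ∔ B₃) ((((((A₁ ∔ A₂) ∔ (B₂ ∔ B₀)) ∔ (B₁ ∔ B₃)) ∔ F) ∔ K) ∔ i) 𝟘)
      refl A₁ A₂ B₀ B₁ B₂ B₃ A B F K 1)

-- Only the item of B that contains the cutting time is lost.

length-cut : ∀ {A B a} → IsChain B →
             length A + length B ≤ suc (length (cutFront (eᵢ a) A B) + length (cutBack (eᵢ a) A B))
length-cut {A} {B} {a} cB = cut-count {B₁ = length B₁}
  (sym (length-filter (λ x → eᵢ x ≤ᵇ t) A)) (sym (length-filter (λ x → t ≤ᵇ sᵢ x) B))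
  (sym (length-filter (λ x → eᵢ x ≤ᵇ t) B₀)) (sym (length-cutFront t A B)) (sym (length-++ B₁))
  (crossing≤1 t (proj₁ (chain-filter (λ x → not (eᵢ x ≤ᵇ t)) (chain-filter _ cB)))
    (All-filter⁺ _ (All.map (false-≤ᵇ ∘ not-true) (All-filter (λ x → not (t ≤ᵇ sᵢ x)) B)))
    (All.map (false-≤ᵇ ∘ not-true) (All-filter (λ x → not (eᵢ x ≤ᵇ t)) B₀)))
  where
  t  = eᵢ a
  B₀ = filterᵇ (λ x → not (t ≤ᵇ sᵢ x)) B
  B₁ = filterᵇ (λ x → eᵢ x ≤ᵇ t) B₀

length-cut-[] : ∀ t A → length A ≤ length (cutFront t A []) + length (cutBack t A [])
length-cut-[] t A = ≤-reflexive (trans (sym (length-filter (λ x → eᵢ x ≤ᵇ t) A))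
  (cong (_+ length (cutBack t A [])) (sym (trans (length-cutFront t A []) (+-identityʳ _)))))

filter-none : ∀ (p : S → Bool) {xs} → All (λ x → p x ≡ false) xs → filterᵇ p xs ≡ []
filter-none p []         = refl
filter-none p (eq ∷ eqs) rewrite eq = filter-none p eqs

filter-keep : ∀ (p : S → Bool) x xs → p x ≡ true → filterᵇ p (x ∷ xs) ≡ x ∷ filterᵇ p xs
filter-keep p x xs px rewrite px = refl

filter-filter : ∀ (p q : S → Bool) → (∀ x → q x ≡ true → p x ≡ true) → ∀ xs →
    filterᵇ q (filterᵇ p xs) ≡ filterᵇ q xs
filter-filter p q q⇒p []       = refl
filter-filter p q q⇒p (x ∷ xs) with p x in px | q x in qx
... | true  | true  rewrite qx = cong (x ∷_) (filter-filter p q q⇒p xs)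
... | true  | false rewrite qx = filter-filter p q q⇒p xs
... | false | false = filter-filter p q q⇒p xs
... | false | true  with () ← trans (sym px) (q⇒p x qx)

-- As the cutting time moves along A, the length of the front part grows from
-- length B to length A, by at most one at each end of an item of A.

exact-cut : ∀ τ A B → IsChain A → length B < τ → τ ≤ length A → ∃ λ a → a ∈ A × length (cutFront (eᵢ a) A B) ≡ τ
exact-cut (suc τ) []      B _ _   ()
exact-cut (suc τ) (a ∷ A) B (a⊰ ∷ ⊰A , va ∷ vA) B<τ (s≤s τ≤A) with suc τ ≤? suc (length B₁)
  where B₁ = filterᵇ (λ x → eᵢ a ≤ᵇ sᵢ x) B
-- At the end of `a` at least τ items of B still follow. B has at most τ, so these are exactly τ,
-- and `a` completes the target `suc τ`.
... | yes τ≤ = a , here refl , (begin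
    length (cutFront (eᵢ a) (a ∷ A) B)   ≡⟨ length-cutFront (eᵢ a) (a ∷ A) B ⟩
    length (filterᵇ (λ x → eᵢ x ≤ᵇ eᵢ a) (a ∷ A)) + length B₁ ≡⟨ cong (λ l → length l + length B₁) only-a ⟩
    suc (length B₁)                      ≡⟨ cong suc (≤-antisym (≤-trans (m≤m+n _ _)
                                              (≤-trans (≤-reflexive (length-filter (λ x → eᵢ a ≤ᵇ sᵢ x) B)) (≤-pred B<τ))) (≤-pred τ≤)) ⟩
    suc τ                                ∎)
  where
  open ≡-Reasoning
  B₁ = filterᵇ (λ x → eᵢ a ≤ᵇ sᵢ x) B
  only-a : filterᵇ (λ x → eᵢ x ≤ᵇ eᵢ a) (a ∷ A) ≡ a ∷ []
  only-a rewrite ≤ᵇ-true (≤-refl {eᵢ a}) = cong (a ∷_) (filter-none _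
    (All.zipWith (λ (a⊰x , vx) → ≤ᵇ-false (≤-<-trans a⊰x vx)) (a⊰ , vA)))
-- `a` is in front of every later cut and accounts for one item, so the target drops to τ. Of B,
-- only `B₁` can still contribute.
... | no τ≰ = let (a′ , a′∈A , eq) = exact-cut τ A B₁ (⊰A , vA) (≤-pred (≰⇒> τ≰)) τ≤A in
  a′ , there a′∈A , (begin
    length (cutFront (eᵢ a′) (a ∷ A) B)  ≡⟨ length-cutFront (eᵢ a′) (a ∷ A) B ⟩
    length (filterᵇ (λ x → eᵢ x ≤ᵇ eᵢ a′) (a ∷ A)) + length (filterᵇ (λ x → eᵢ a′ ≤ᵇ sᵢ x) B)
      ≡⟨ cong₂ (λ l l′ → length l + length l′) (filter-keep (λ x → eᵢ x ≤ᵇ eᵢ a′) a A (≤ᵇ-true (before a′∈A)))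
           (sym (filter-filter (λ x → eᵢ a ≤ᵇ sᵢ x) (λ x → eᵢ a′ ≤ᵇ sᵢ x)
             (λ x le → ≤ᵇ-true {eᵢ a} {sᵢ x} (≤-trans (before a′∈A) (true-≤ᵇ le))) B)) ⟩
    suc (length (A′ a′) + length (filterᵇ (λ x → eᵢ a′ ≤ᵇ sᵢ x) B₁)) ≡⟨ cong suc (sym (length-cutFront (eᵢ a′) A B₁)) ⟩
    suc (length (cutFront (eᵢ a′) A B₁)) ≡⟨ cong suc eq ⟩
    suc τ                                ∎)
  where
  open ≡-Reasoning
  B₁ = filterᵇ (λ x → eᵢ a ≤ᵇ sᵢ x) B
  A′ = λ a′ → filterᵇ (λ x → eᵢ x ≤ᵇ eᵢ a′) A
  before : ∀ {a′} → a′ ∈ A → eᵢ a ≤ eᵢ a′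
  before a′∈A = ≤-trans (All.lookup a⊰ a′∈A) (<⇒≤ (All.lookup vA a′∈A))

≡ᵇ′-refl : ∀ a → (a ≡ᵇ′ a) ≡ true
≡ᵇ′-refl a rewrite ≤ᵇ-true (≤-refl {a}) = refl

split-found : ∀ (P : Chain × Chain → Set) τ A B → (∃ λ a → a ∈ A × length (cutFront (eᵢ a) A B) ≡ τ) →
              (∀ {a} → a ∈ A → length (cutFront (eᵢ a) A B) ≡ τ → P (cutFront (eᵢ a) A B , cutBack (eᵢ a) A B)) →
              P (split τ A B)
split-found P τ A B (a₀ , a₀∈A , eq₀) cut = loop A (λ a∈ → a∈) a₀∈A
  where
  loop : ∀ A′ → (∀ {a} → a ∈ A′ → a ∈ A) → a₀ ∈ A′ →
         P (foldr (λ a acc → if length (cutFront (eᵢ a) A B) ≡ᵇ′ τ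
                             then (cutFront (eᵢ a) A B , cutBack (eᵢ a) A B) else acc) ([] , []) A′)
  loop (a ∷ A′) sub a₀∈ with length (cutFront (eᵢ a) A B) ≡ᵇ′ τ in eq
  loop (a ∷ A′) sub a₀∈         | true  = cut (sub (here refl)) (≡ᵇ′⇒≡ _ τ eq)
  loop (a ∷ A′) sub (there a₀∈) | false = loop A′ (sub ∘ there) a₀∈
  loop (a ∷ A′) sub (here refl) | false with () ← trans (sym eq) (trans (cong (_≡ᵇ′ τ) eq₀) (≡ᵇ′-refl τ))

record Split (τ : ℕ) (A B : Chain) (F K : Chain) : Set where
  field
    exact    : length F ≡ τ
    loss≤1   : length A + length B ≤ suc (length F + length K)
    lossless : B ≡ [] → length A ≤ length F + length K

split-exact : ∀ τ A B → IsChain A → IsChain B → length B < τ → τ ≤ length A →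
              Split τ A B (proj₁ (split τ A B)) (proj₂ (split τ A B))
split-exact τ A B cA cB B<τ τ≤A = split-found (λ (F , K) → Split τ A B F K) τ A B (exact-cut τ A B cA B<τ τ≤A)
  λ {a} _ eq → record { exact = eq ; loss≤1 = length-cut {A} {B} {a} cB ; lossless = λ { refl → length-cut-[] (eᵢ a) A } }

-- For τ = 0 the default value of `split` is a correct front.
length-alone : ∀ τ A → IsChain A → τ ≤ length A → length (proj₁ (split τ A [])) ≡ τ
length-alone zero    A cA _   = split-elim (λ (F , _) → length F ≡ 0) 0 A [] refl (λ _ eq → eq)
length-alone (suc τ) A cA τ≤A = Split.exact (split-exact (suc τ) A [] cA ([] , []) (s≤s z≤n) τ≤A)

-- The balancing loop

-- N items are enough for p chains with n items in total: all but the last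
-- exchange may lose an item, but only for a chain of at least two items.

Enough : ℕ → ℕ → ℕ → Set
Enough p N n = n + p ≤ suc N ⊎ n + (n ∸ p) ≤ N

private
  -- In these inequalities A, B and K are the lengths of the two chains and of the part that goes
  -- back, R counts the items of the other chains, and n′ is the target left after τ.
  enough-all : ∀ {n n′ p τ A B R K} → n + suc p ≤ suc (A + (B + R)) → n′ + τ ≡ n → A + B ≤ suc (τ + K) →
      n′ + p ≤ suc (K + R)
  enough-all {n} {n′} {p} {τ} {A} {B} {R} {K} e n≡ loss = linear (+-mono-≤ (+-mono-≤ e (≤-reflexive n≡)) loss) 0
    (solve 9 (λ n n′ p τ A B R K i →
      linearly (n′ ∔ p) (i ∔ (K ∔ R)) (((n ∔ (i ∔ p)) ∔ (n′ ∔ τ)) ∔ (A ∔ B)) (((i ∔ (A ∔ (B ∔ R))) ∔ n) ∔ (i ∔ (τ ∔ K))) 𝟘)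
      refl n n′ p τ A B R K 1)

  enough-some : ∀ {n n′ d τ A B R K} → n + suc d ≤ A + (B + R) → n′ + τ ≡ n → A + B ≤ suc (τ + K) →
      n′ + d ≤ K + R
  enough-some {n} {n′} {d} {τ} {A} {B} {R} {K} e n≡ loss = linear (+-mono-≤ (+-mono-≤ e (≤-reflexive n≡)) loss) 0
    (solve 9 (λ n n′ d τ A B R K i →
      linearly (n′ ∔ d) (K ∔ R) (((n ∔ (i ∔ d)) ∔ (n′ ∔ τ)) ∔ (A ∔ B)) (((A ∔ (B ∔ R)) ∔ n) ∔ (i ∔ (τ ∔ K))) 𝟘)
      refl n n′ d τ A B R K 1)

  enough-pair : ∀ {n n′ p d τ} → n′ + τ ≡ n → n ≡ suc p + suc d → 2 ≤ τ → n′ ≤ p + d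
  enough-pair {n} {n′} {p} {d} {τ} n≡ d≡ τ≥2 = linear (+-mono-≤ (+-mono-≤ (≤-reflexive n≡) (≤-reflexive d≡)) τ≥2) 0
    (solve 6 (λ n n′ p d τ i →
      linearly n′ (p ∔ d) (((n′ ∔ τ) ∔ n) ∔ (i ∔ i)) ((n ∔ ((i ∔ p) ∔ (i ∔ d))) ∔ τ) 𝟘)
      refl n n′ p d τ 1)

  enough-one : ∀ {n n′ d A R K} → n + d ≤ A + R → n′ + 1 ≡ n → A ≤ suc K → n′ + d ≤ K + R
  enough-one {n} {n′} {d} {A} {R} {K} e n≡ lossless = linear (+-mono-≤ (+-mono-≤ e (≤-reflexive n≡)) lossless) 0
    (solve 7 (λ n n′ d A R K i →
      linearly (n′ ∔ d) (K ∔ R) (((n ∔ d) ∔ (n′ ∔ i)) ∔ A) (((A ∔ R) ∔ n) ∔ (i ∔ K)) 𝟘)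
      refl n n′ d A R K 1)

-- The bounds on `n` confine this and all later values of τ to q and q + 1. The second form of
-- `enough` takes over as soon as no remaining chain is shorter than τ; each chain can then meet
-- every target alone.
record Pool (q p : ℕ) (pool : List Chain) (n : ℕ) : Set where
  constructor mkPool
  field
    chains : All IsChain pool
    width  : length pool ≡ p
    lower  : q * p ≤ n
    upper  : n ≤ suc q * p
    enough : Enough p (total length pool) n ⊎ All (λ c → n ≤ p * length c) pool

record Output (q k N : ℕ) (out : List Chain) (n : ℕ) : Set where
  constructor mkOutput
  field
    chains : All IsChain out
    width  : length out ≡ k
    sizes  : All (λ c → q ≤ length c × length c ≤ suc q) out
    done   : total length out + n ≡ N

module Step {q p n τ : ℕ} (low-n : q * suc p ≤ n) (high-n : n ≤ suc q * suc p)
            (upper : n ≤ suc p * τ) (lower : ∀ {τ′} → τ ≡ suc τ′ → suc p * τ′ < n) where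

  q≤τ : q ≤ τ
  q≤τ = *-cancelˡ-≤ (suc p) (≤-trans (≤-reflexive (*-comm (suc p) q)) (≤-trans low-n upper))

  τ≤1+q : τ ≤ suc q
  τ≤1+q = bound τ refl
    where
    bound : ∀ t → τ ≡ t → t ≤ suc q
    bound zero    _  = z≤n
    bound (suc t) eq = *-cancelˡ-< (suc p) t (suc q) (<-≤-trans (lower eq) (≤-trans high-n (≤-reflexive (*-comm (suc q) (suc p)))))

  τ≤n : τ ≤ n
  τ≤n = bound τ refl
    where
    bound : ∀ t → τ ≡ t → t ≤ n
    bound zero    _  = z≤n
    bound (suc t) eq = ≤-<-trans (m≤m+n t (p * t)) (lower eq)

  n′ : ℕ
  n′ = n ∸ τ

  n′+τ : n′ + τ ≡ n
  n′+τ = m∸n+n≡m τ≤n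

  low-n′ : q * p ≤ n′
  low-n′ = m+n≤o⇒m≤o∸n (q * p) (by-τ (m≤n⇒m<n∨m≡n τ≤1+q))
    where
    by-τ : τ < suc q ⊎ τ ≡ suc q → q * p + τ ≤ n
    by-τ (inj₁ τ≤q) = ≤-trans (+-monoʳ-≤ (q * p) (≤-pred τ≤q))
      (≤-trans (≤-reflexive (trans (+-comm (q * p) q) (sym (*-suc q p)))) low-n)
    -- Here n > q * suc p by the minimality of τ, and this extra unit is what τ takes beyond q.
    by-τ (inj₂ eq)  = ≤-trans (≤-reflexive (trans (cong (q * p +_) eq) (trans (+-suc (q * p) q)
      (cong suc (trans (+-comm (q * p) q) (cong (q +_) (*-comm q p))))))) (lower eq)

  high-n′ : n′ ≤ suc q * p
  high-n′ = m≤n+o⇒m∸n≤o n τ (≤-trans upper (+-monoʳ-≤ τ (≤-trans (*-monoʳ-≤ p τ≤1+q) (≤-reflexive (*-comm p (suc q))))))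

  upper′ : n′ ≤ p * τ
  upper′ = m≤n+o⇒m∸n≤o n τ upper

  output : ∀ {k N out F} → Output q k N out n → IsChain F → length F ≡ τ → Output q (suc k) N (F ∷ out) n′
  output {N = N} {out} {F} o cF F≡ = mkOutput (cF ∷ Output.chains o) (cong suc (Output.width o))
    ((subst (q ≤_) (sym F≡) q≤τ , subst (_≤ suc q) (sym F≡) τ≤1+q) ∷ Output.sizes o)
    (trans (cong (λ l → l + total length out + n′) F≡) (trans (cong (_+ n′) (+-comm τ _))
      (trans (+-assoc (total length out) τ n′) (trans (cong (total length out +_) (trans (+-comm τ n′) n′+τ)) (Output.done o)))))

  -- In the first form the lost item is paid for by p, which drops by one. In the second form the
  -- reserve is n - p: for τ = 1 it does not change, but B is empty and nothing is lost; for τ ≥ 2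
  -- it drops by at least one, as n loses at least two and p one.
  enough-after : ∀ {A B R F K} → Split τ A B F K → length B < τ →
                 Enough (suc p) (length A + (length B + R)) n → Enough p (length K + R) n′
  enough-after {A} {B} {R} {F} {K} s B<τ (inj₁ e) = inj₁ (enough-all {A = length A} {length B} e n′+τ
    (subst (λ t → length A + length B ≤ suc (t + length K)) (Split.exact s) (Split.loss≤1 s)))
  enough-after {A} {B} {R} {F} {K} s B<τ (inj₂ e) = inj₂ (by-τ τ refl)
    where
    by-τ : ∀ t → τ ≡ t → n′ + (n′ ∸ p) ≤ length K + R
    by-τ zero eq with () ← subst (length B <_) eq B<τ
    by-τ (suc zero) eq = subst (λ d → n′ + d ≤ length K + R) n∸p
        (enough-one {A = length A} (no-B B refl e) (trans (cong (n′ +_) (sym eq)) n′+τ)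
          (subst (λ t → length A ≤ t + length K) (trans (Split.exact s) eq) (Split.lossless s (B≡[] B (subst (length B <_) eq B<τ)))))
      where
      B≡[] : ∀ B → length B < 1 → B ≡ []
      B≡[] []      _         = refl
      B≡[] (_ ∷ _) (s≤s ())
      no-B : ∀ B₀ → B ≡ B₀ → n + (n ∸ suc p) ≤ length A + (length B + R) → n + (n ∸ suc p) ≤ length A + R
      no-B B₀ _ rewrite B≡[] B (subst (length B <_) eq B<τ) = λ e → e
      n∸p : n ∸ suc p ≡ n′ ∸ p
      n∸p = trans (sym (∸-+-assoc n 1 p)) (cong (λ t → n ∸ t ∸ p) (sym eq))
    by-τ (suc (suc t)) eq = ≤-trans (+-monoʳ-≤ n′ n′∸p≤d) (enough-some {d = d} {A = length A} {length B}
        (subst (λ z → n + z ≤ length A + (length B + R)) n∸p≡ e) n′+τ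
        (subst (λ t → length A + length B ≤ suc (t + length K)) (Split.exact s) (Split.loss≤1 s)))
      where
      p<n : suc p < n
      p<n = ≤-<-trans (m≤m*n (suc p) (suc t)) (lower eq)
      d = n ∸ suc (suc p)
      n≡ : n ≡ suc p + suc d
      n≡ = sym (trans (cong suc (+-suc p d)) (m+[n∸m]≡n p<n))
      n∸p≡ : n ∸ suc p ≡ suc d
      n∸p≡ = trans (cong (_∸ suc p) n≡) (m+n∸m≡n (suc p) (suc d))
      n′∸p≤d : n′ ∸ p ≤ d
      n′∸p≤d = m≤n+o⇒m∸n≤o n′ p (enough-pair n′+τ n≡ (subst (2 ≤_) (sym eq) (s≤s (s≤s z≤n))))

  balanceWith-step : ∀ {k N A rest out} → IsChain A → τ ≤ length A → All IsChain rest → length rest ≡ p →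
                     Enough (suc p) (length A + total length rest) n ⊎ All (λ c → n ≤ suc p * length c) rest →
                     Output q k N out n →
                     let (pool′ , out′ , n″) = balanceWith τ A rest out n in Pool q p pool′ n″ × Output q (suc k) N out′ n″
  balanceWith-step {A = A} {rest} {out} cA τ≤A crest len enough o
    with pull (low τ) [] rest in eq | All-pull (low τ) [] rest [] crest
       | length-pull (low τ) [] rest | total-pull length (low τ) [] rest
  -- This is the last machine: A is shortened alone, and the empty pool satisfies the second form of
  -- `enough` vacuously.
  ... | [] | _ | len′ | _ = mkPool [] (trans len′ len) low-n′ high-n′ (inj₂ []) , output o (proj₁ (chain-split τ cA ([] , []))) (length-alone τ A cA τ≤A)
  ... | B ∷ rest′ | cB ∷ crest′ | len′ | tot with low τ B in lowB
  ...   | true  = mkPool (proj₂ (chain-split τ cA cB) ∷ crest′) (trans len′ len) low-n′ high-n′ (inj₁ (enough-after s B<τ before)) ,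
                  output o (proj₁ (chain-split τ cA cB)) (Split.exact s)
    where
    B<τ : length B < τ
    B<τ = true-≤ᵇ lowB
    s = split-exact τ A B cA cB B<τ τ≤A
    -- A chain shorter than τ has at most τ - 1 items, and suc p * (τ - 1) < n. So once all chains
    -- are large, no further exchange takes place.
    large-absurd : All (λ c → n ≤ suc p * length c) rest → ⊥
    large-absurd large = too-short τ refl
      where
      n≤B : n ≤ suc p * length B
      n≤B = All.head (subst (All (λ c → n ≤ suc p * length c)) eq (All-pull (low τ) [] rest [] large))
      too-short : ∀ t → τ ≡ t → ⊥
      too-short zero    eq with () ← subst (length B <_) eq B<τ
      too-short (suc t) eq = <⇒≱ (<-≤-trans (lower eq) n≤B) (*-monoʳ-≤ (suc p) (≤-pred (subst (length B <_) eq B<τ)))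
    before : Enough (suc p) (length A + (length B + total length rest′)) n
    before = [ subst (λ R → Enough (suc p) (length A + R) n) (sym tot) , ⊥-elim ∘ large-absurd ] enough
  ...   | false = mkPool (cB ∷ crest′) (trans len′ len) low-n′ high-n′ (inj₂ all-large) ,
                  output o (proj₁ (chain-split τ cA ([] , []))) (length-alone τ A cA τ≤A)
    where
    all-large : All (λ c → n′ ≤ p * length c) (B ∷ rest′)
    all-large = subst (All (λ c → n′ ≤ p * length c)) eq (All-pull (low τ) [] rest []
      (All.map (λ not-low → ≤-trans upper′ (*-monoʳ-≤ p (≤-pred (false-≤ᵇ not-low)))) (pull-none (low τ) rest eq lowB)))

total≤ : ∀ {t} {cs : List (List S)} → All (λ c → length c ≤ t) cs → total length cs ≤ length cs * t
total≤ []         = z≤n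
total≤ (c≤ ∷ cs≤) = +-mono-≤ c≤ (total≤ cs≤)

Enough⇒≤ : ∀ {p N n} → Enough (suc p) N n → n ≤ N
Enough⇒≤ {p} {N} {n} (inj₁ e) = ≤-trans (m≤m+n n p) (≤-pred (≤-trans (≤-reflexive (sym (+-suc n p))) e))
Enough⇒≤ {p} {N} {n} (inj₂ e) = ≤-trans (m≤m+n n _) e

some : ∀ {P : S → Set} {xs p} → length xs ≡ suc p → All P xs → ∃ P
some _ (px ∷ _) = _ , px

balance-step : ∀ {q p k N pool out n} (L : List Item) → N ≤ length L → Pool q (suc p) pool n →
    Output q k N out n →
               let (pool′ , out′ , n′) = balance L (pool , out , n) in Pool q p pool′ n′ × Output q (suc k) N out′ n′
balance-step {q} {p} {k} {N} {pool} {out} {n} L N≤L (mkPool chains width lower upper enough) o = cases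
  where
  τ = ceil L (length pool) n
  n≤L : n ≤ suc p * length L
  n≤L = ≤-trans (≤-trans (m≤n+m n (total length out)) (≤-trans (≤-reflexive (Output.done o)) N≤L)) (m≤m+n _ _)
  above : n ≤ suc p * τ
  above = subst (λ r → n ≤ r * τ) width (ceil-upper L (length pool) n (subst (λ r → n ≤ r * length L) (sym width) n≤L))
  below : ∀ {t} → τ ≡ suc t → suc p * t < n
  below {t} eq = subst (λ r → r * t < n) width (ceil-lower L (length pool) n eq)
  -- Pigeonhole: suc p chains shorter than τ have at most suc p * (τ - 1) < n items together,
  -- whereas `enough` leaves at least n, or n ≤ suc p * length c for each chain c.
  not-all-short : All (λ c → (τ ≤ᵇ length c) ≡ false) pool → ⊥
  not-all-short short = by-τ τ refl enough
    where
    by-τ : ∀ t → τ ≡ t → Enough (suc p) (total length pool) n ⊎ All (λ c → n ≤ suc p * length c) pool → ⊥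
    by-τ zero    eq _ with c , s ← some width short with () ← subst (length c <_) eq (false-≤ᵇ s)
    by-τ (suc t) eq (inj₁ e) = <⇒≱ (below eq) (≤-trans (Enough⇒≤ e)
      (≤-trans (total≤ (All.map (λ {c} s → ≤-pred (subst (length c <_) eq (false-≤ᵇ s))) short)) (≤-reflexive (cong (_* t) width))))
    by-τ (suc t) eq (inj₂ large) with c , s , n≤ ← some width (All.zip (short , large)) =
      <⇒≱ (<-≤-trans (below eq) n≤) (*-monoʳ-≤ (suc p) (≤-pred (subst (length c <_) eq (false-≤ᵇ s))))
  cases : let (pool′ , out′ , n′) = balance L (pool , out , n) in Pool q p pool′ n′ × Output q (suc k) N out′ n′
  cases with pull (λ c → τ ≤ᵇ length c) [] pool in eq | All-pull (λ c → τ ≤ᵇ length c) [] pool [] chains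
           | length-pull (λ c → τ ≤ᵇ length c) [] pool | total-pull length (λ c → τ ≤ᵇ length c) [] pool
  ... | [] | _ | len | _ with () ← trans len width
  ... | A ∷ rest | cA ∷ crest | len | tot with τ ≤ᵇ length A in long
  ...   | false = ⊥-elim (not-all-short (pull-none (λ c → τ ≤ᵇ length c) pool eq long))
  ...   | true  = Step.balanceWith-step lower upper above below cA (true-≤ᵇ long) crest (suc-injective (trans len width))
    ([ (λ e → inj₁ (subst (λ T → Enough (suc p) T n) (sym tot) e))
     , (λ large → inj₂ (All.tail (subst (All (λ c → n ≤ suc p * length c)) eq (All-pull (λ c → τ ≤ᵇ length c) [] pool [] large)))) ] enough) o

balance-loop : ∀ {q N cs} (L : List Item) → N ≤ length L → Pool q (length cs) cs N →
               ∀ (xs : List S) r → length xs + r ≡ length cs →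
               let (pool , out , n) = foldr (λ _ → balance L) (cs , [] , N) xs in
               Pool q r pool n × Output q (length xs) N out n
balance-loop L N≤L P []       r eq = subst (λ p → Pool _ p _ _) (sym eq) P , mkOutput [] refl [] refl
balance-loop L N≤L P (x ∷ xs) r eq =
  let (P′ , O′) = balance-loop L N≤L P xs (suc r) (trans (+-suc (length xs) r) eq) in balance-step L N≤L P′ O′

length-concat : ∀ (cs : List (List S)) → length (concat cs) ≡ total length cs
length-concat []       = refl
length-concat (c ∷ cs) = trans (length-++ c) (cong (length c +_) (length-concat cs))

balanceAll-output : ∀ {q cs} (L : List Item) → total length cs ≤ length L →
                    let N = ceil L 3 (2 * length (concat cs)) in N ≤ length L → Pool q (length cs) cs N →
                    Output q (length cs) N (proj₁ (proj₂ (balanceAll L cs))) 0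
balanceAll-output {q} {cs} L cs≤L N≤L P = let (P′ , O′) = balance-loop L N≤L P cs 0 (+-identityʳ _) in
  subst (Output q (length cs) _ _) (n≤0⇒n≡0 (≤-trans (Pool.upper P′) (≤-reflexive (*-zeroʳ (suc q))))) O′

private
  two-thirds : ∀ {N n d p} → n + (n + (n + 0)) ≤ 2 + (N + (N + 0)) → 2 + N ≤ n + p → p + d ≡ n → n + d ≤ N
  two-thirds {N} {n} {d} {p} l u n≡ = linear (+-mono-≤ (+-mono-≤ l u) (≤-reflexive n≡)) 0
    (solve 5 (λ N n d p i →
      linearly (n ∔ d) N (((n ∔ (n ∔ (n ∔ 𝟘))) ∔ ((i ∔ i) ∔ N)) ∔ (p ∔ d)) ((((i ∔ i) ∔ (N ∔ (N ∔ 𝟘))) ∔ (n ∔ p)) ∔ n) 𝟘)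
      refl N n d p 1)

-- If the first form fails, p ≥ N + 2 - n, and thus n + (n - p) ≤ 3 n - N - 2 ≤ N.
enough-initially : ∀ p N n → 3 * n ≤ 2 + 2 * N → n ≤ N → Enough p N n
enough-initially p N n 3n≤ n≤N with n + p ≤? suc N
... | yes e = inj₁ e
... | no ne with ≤-total n p
...   | inj₁ n≤p = inj₂ (subst (λ d → n + d ≤ N) (sym (m≤n⇒m∸n≡0 n≤p)) (≤-trans (≤-reflexive (+-identityʳ n)) n≤N))
...   | inj₂ p≤n = inj₂ (two-thirds 3n≤ (≰⇒> ne) (m+[n∸m]≡n p≤n))

-- For n = p both 0 and 1 satisfy the bounds, and 0 is chosen: if there are more machines than
-- chains, some machines are empty, and EF1 asks for the smaller value.
quotient : ∀ p n → (p ≡ 0 → n ≡ 0) → ∃ λ q → q * p ≤ n × n ≤ suc q * p × (n ≤ p → q ≡ 0)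
quotient p n p≡0 with n ≤? p
... | yes n≤p = 0 , z≤n , ≤-trans n≤p (m≤m+n p 0) , λ _ → refl
quotient zero    n p≡0 | no n≰p = ⊥-elim (n≰p (≤-reflexive (p≡0 refl)))
quotient (suc p) n p≡0 | no n≰p = n / suc p , m/n*n≤m n (suc p) ,
  ≤-trans (≤-reflexive (m≡m%n+[m/n]*n n (suc p))) (+-monoˡ-≤ _ (<⇒≤ (m%n<n n (suc p)))) , λ n≤p → ⊥-elim (n≰p n≤p)

-- With indicators for `f`, `part` says that no item is used more often than it occurs in `L`.
-- `empties` makes an empty machine as good as a chain of minimal length.
record Fair (m : ℕ) (L : List Item) (Ds : List Chain) : Set where
  field
    chains  : All IsChain Ds
    width   : length Ds ≡ m ⊓ length L
    q       : ℕ
    sizes   : All (λ c → q ≤ length c × length c ≤ suc q) Ds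
    empties : length Ds < m → q ≡ 0
    part    : ∀ f → total (total f) Ds ≤ total f L
    large   : 2 * total length (greedy m L) ≤ 3 * total length Ds

total-balanceAll : ∀ f L (cs xs : List Chain) n → total (total f) (proj₁ (proj₂ (foldr (λ _ → balance L) (cs , [] , n) xs))) ≤ total (total f) cs
total-balanceAll f L cs xs n = ≤-trans (m≤n+m _ _) (loop xs)
  where
  loop : ∀ (xs : List Chain) → let (pool , out , _) = foldr (λ _ → balance L) (cs , [] , n) xs in
         total (total f) pool + total (total f) out ≤ total (total f) cs
  loop []       = ≤-reflexive (+-identityʳ _)
  loop (x ∷ xs) = ≤-trans (total-balance (total f) (total-split f)
    (λ τ A → ≤-trans (m≤m+n _ _) (≤-trans (total-split f τ A []) (≤-reflexive (+-identityʳ _)))) L (foldr (λ _ → balance L) (cs , [] , n) xs)) (loop xs)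

classSchedule-fair : ∀ m L → All Valid L → Fair m L (classSchedule m L)
classSchedule-fair m L vL = record
  { chains  = Output.chains O
  ; width   = trans (Output.width O) (width inv)
  ; q       = q
  ; sizes   = Output.sizes O
  ; empties = λ Ds<m → q-zero (≤-trans (≤-trans n≤N N≤L) (≤-reflexive (sym (trans (width inv)
                (m≥n⇒m⊓n≡n (≮⇒≥ λ m<L → <-irrefl (m≤n⇒m⊓n≡m (<⇒≤ m<L)) (subst (_< m) (trans (Output.width O) (width inv)) Ds<m)))))))
  ; part    = λ f → ≤-trans (total-balanceAll f L cs cs n) (total-greedy f m L)
  ; large   = ≤-trans upper (≤-reflexive (cong (3 *_) (trans (sym (Output.done O)) (+-identityʳ _)))) }
  where
  open GreedyInvariant
  cs  = greedy m L
  inv = greedyInvariant m L vL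
  N   = total length cs
  n   = ceil L 3 (2 * length (concat cs))
  N≤L : N ≤ length L
  N≤L = ≤-trans (count≤ inv) (≤-reflexive (length-sort L))
  upper : 2 * N ≤ 3 * n
  upper = subst (λ M → 2 * M ≤ 3 * n) (length-concat cs) (ceil-upper L 3 (2 * length (concat cs))
    (≤-trans (*-monoʳ-≤ 2 (≤-trans (≤-reflexive (length-concat cs)) N≤L)) (*-monoˡ-≤ (length L) (n≤1+n 2))))
  lower : ∀ {n₀} → n ≡ suc n₀ → 3 * n₀ < 2 * N
  lower eq = subst (λ M → _ < 2 * M) (length-concat cs) (ceil-lower L 3 (2 * length (concat cs)) eq)
  n≤N : n ≤ N
  n≤N = by-n n refl
    where
    by-n : ∀ k → n ≡ k → k ≤ N
    by-n zero    _  = z≤n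
    by-n (suc k) eq = *-cancelˡ-< 3 k N (<-≤-trans (lower eq) (*-monoˡ-≤ N (n≤1+n 2)))
  3n≤ : 3 * n ≤ 2 + 2 * N
  3n≤ = by-n n refl
    where
    by-n : ∀ k → n ≡ k → 3 * k ≤ 2 + 2 * N
    by-n zero    _  = z≤n
    by-n (suc k) eq = ≤-trans (≤-reflexive (*-suc 3 k)) (s≤s (s≤s (lower eq)))
  quot = quotient (length cs) n λ p≡0 → n≤0⇒n≡0 (≤-trans n≤N (≤-reflexive (empty cs p≡0)))
    where
    empty : ∀ cs → length cs ≡ 0 → total length cs ≡ 0
    empty [] _ = refl
  q      = proj₁ quot
  q-zero = proj₂ (proj₂ (proj₂ quot))
  O : Output q (length cs) n (classSchedule m L) 0
  O = balanceAll-output L N≤L (≤-trans n≤N N≤L) (mkPool (chains inv) refl (proj₁ (proj₂ quot)) (proj₁ (proj₂ (proj₂ quot)))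
        (inj₁ (enough-initially (length cs) N n 3n≤ n≤N)))

-- Rationals

ι : ℕ → ℚ
ι n = pos n ℚ./ 1

toℚᵘ-ι : ∀ n → toℚᵘ (ι n) ℚᵘ.≃ mkℚᵘ (pos n) 0
toℚᵘ-ι n = ℚ.toℚᵘ-fromℚᵘ (mkℚᵘ (pos n) 0)

ι-suc : ∀ n → ι (suc n) ≡ 1ℚ ℚ.+ ι n
ι-suc n = ℚ.toℚᵘ-injective (ℚᵘ.≃-trans (toℚᵘ-ι (suc n)) (ℚᵘ.≃-sym
  (ℚᵘ.≃-trans (ℚ.toℚᵘ-homo-+ 1ℚ (ι n)) (ℚᵘ.≃-trans (ℚᵘ.+-cong (ℚᵘ.≃-refl {toℚᵘ 1ℚ}) (toℚᵘ-ι n))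
    (*≡* (cong (ℤ._* pos 1) (cong (λ k → pos 1 ℤ.+ k) (ℤ.*-identityʳ (pos n)))))))))

ι-+ : ∀ a b → ι (a + b) ≡ ι a ℚ.+ ι b
ι-+ zero    b = sym (ℚ.+-identityˡ (ι b))
ι-+ (suc a) b = trans (ι-suc (a + b)) (trans (cong (1ℚ ℚ.+_) (ι-+ a b)) (trans (sym (ℚ.+-assoc 1ℚ (ι a) (ι b)))
  (cong (ℚ._+ ι b) (sym (ι-suc a)))))

ι-suc-* : ∀ n x → ι (suc n) ℚ.* x ≡ x ℚ.+ ι n ℚ.* x
ι-suc-* n x = trans (cong (ℚ._* x) (ι-suc n)) (trans (ℚ.*-distribʳ-+ x 1ℚ (ι n)) (cong (ℚ._+ ι n ℚ.* x) (ℚ.*-identityˡ x)))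

ι-* : ∀ a b → ι (a * b) ≡ ι a ℚ.* ι b
ι-* zero    b = sym (ℚ.*-zeroˡ (ι b))
ι-* (suc a) b = trans (ι-+ b (a * b)) (trans (cong (ι b ℚ.+_) (ι-* a b)) (sym (ι-suc-* a (ι b))))

0≤ι : ∀ n → 0ℚ ℚ.≤ ι n
0≤ι zero    = ℚ.≤-refl
0≤ι (suc n) = subst (0ℚ ℚ.≤_) (sym (ι-suc n)) (ℚ.+-mono-≤ {0ℚ} {1ℚ} {0ℚ} {ι n} (*≤* (ℤ.+≤+ z≤n)) (0≤ι n))

ι-mono : ∀ {a b} → a ≤ b → ι a ℚ.≤ ι b
ι-mono {a} {b} a≤b = subst₂ ℚ._≤_ (ℚ.+-identityʳ (ι a)) (trans (sym (ι-+ a (b ∸ a))) (cong ι (m+[n∸m]≡n a≤b)))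
  (ℚ.+-monoʳ-≤ (ι a) (0≤ι (b ∸ a)))

ι*-mono : ∀ {a b x} → 0ℚ ℚ.≤ x → a ≤ b → ι a ℚ.* x ℚ.≤ ι b ℚ.* x
ι*-mono {x = x} 0≤x a≤b = ℚ.*-monoʳ-≤-nonNeg x {{ℚ.nonNegative 0≤x}} (ι-mono a≤b)

ι*-pred : ∀ {a b x} → 0ℚ ℚ.≤ x → a ≤ suc b → ι a ℚ.* x ℚ.- x ℚ.≤ ι b ℚ.* x
ι*-pred {a} {b} {x} 0≤x a≤1+b = begin
  ι a ℚ.* x ℚ.- x                  ≤⟨ ℚ.+-monoˡ-≤ (ℚ.- x) (ι*-mono 0≤x a≤1+b) ⟩
  ι (suc b) ℚ.* x ℚ.- x            ≡⟨ cong (ℚ._- x) (trans (ι-suc-* b x) (ℚ.+-comm x (ι b ℚ.* x))) ⟩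
  ι b ℚ.* x ℚ.+ x ℚ.- x            ≡⟨ ℚ.+-assoc (ι b ℚ.* x) x (ℚ.- x) ⟩
  ι b ℚ.* x ℚ.+ (x ℚ.- x)          ≡⟨ cong (ι b ℚ.* x ℚ.+_) (ℚ.+-inverseʳ x) ⟩
  ι b ℚ.* x ℚ.+ 0ℚ                 ≡⟨ ℚ.+-identityʳ (ι b ℚ.* x) ⟩
  ι b ℚ.* x                        ∎
  where open ℚ.≤-Reasoning

three-halves : ∀ {a b x} → 0ℚ ℚ.≤ x → 2 * a ≤ 3 * b → ι a ℚ.* x ℚ.≤ (pos 3 ℚ./ 2) ℚ.* (ι b ℚ.* x)
three-halves {a} {b} {x} 0≤x 2a≤3b = begin
  ι a ℚ.* x                        ≡⟨ ℚ.*-identityˡ (ι a ℚ.* x) ⟨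
  (½ ℚ.* ι 2) ℚ.* (ι a ℚ.* x)      ≡⟨ ℚ.*-assoc ½ (ι 2) (ι a ℚ.* x) ⟩
  ½ ℚ.* (ι 2 ℚ.* (ι a ℚ.* x))      ≡⟨ cong (½ ℚ.*_) (trans (sym (ℚ.*-assoc (ι 2) (ι a) x)) (cong (ℚ._* x) (sym (ι-* 2 a)))) ⟩
  ½ ℚ.* (ι (2 * a) ℚ.* x)          ≤⟨ ℚ.*-monoˡ-≤-nonNeg ½ (ι*-mono 0≤x 2a≤3b) ⟩
  ½ ℚ.* (ι (3 * b) ℚ.* x)          ≡⟨ cong (½ ℚ.*_) (trans (cong (ℚ._* x) (ι-* 3 b)) (ℚ.*-assoc (ι 3) (ι b) x)) ⟩
  ½ ℚ.* (ι 3 ℚ.* (ι b ℚ.* x))      ≡⟨ ℚ.*-assoc ½ (ι 3) (ι b ℚ.* x) ⟨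
  (pos 3 ℚ./ 2) ℚ.* (ι b ℚ.* x)      ∎
  where open ℚ.≤-Reasoning

nn : ℚ → ℕ
nn q = magnitude (encodeℚ q)

numerator≡ : ∀ {q} → 0ℚ ℚ.≤ q → ℚ.↥ q ≡ pos (nn q)
numerator≡ {mkℚ (pos n)    d c} _ = refl
numerator≡ {mkℚ -[1+ n ] d c} (*≤* ())

≤ᴱ-cross : ∀ {p q} → 0ℚ ℚ.≤ p → 0ℚ ℚ.≤ q → nn p * ℚ.↧ₙ q ≤ nn q * ℚ.↧ₙ p → p ℚ.≤ q
≤ᴱ-cross {p} {q} 0≤p 0≤q le = *≤* (subst₂ ℤ._≤_
  (trans (ℤ.pos-* (nn p) (ℚ.↧ₙ q)) (cong (ℤ._* ℚ.↧ q) (sym (numerator≡ 0≤p))))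
  (trans (ℤ.pos-* (nn q) (ℚ.↧ₙ p)) (cong (ℤ._* ℚ.↧ p) (sym (numerator≡ 0≤q)))) (ℤ.+≤+ le))

cross-≤ᴱ : ∀ {p q} → 0ℚ ℚ.≤ p → 0ℚ ℚ.≤ q → p ℚ.≤ q → nn p * ℚ.↧ₙ q ≤ nn q * ℚ.↧ₙ p
cross-≤ᴱ {p} {q} 0≤p 0≤q (*≤* le) = ℤ.drop‿+≤+ (subst₂ ℤ._≤_
  (sym (trans (ℤ.pos-* (nn p) (ℚ.↧ₙ q)) (cong (ℤ._* ℚ.↧ q) (sym (numerator≡ 0≤p)))))
  (sym (trans (ℤ.pos-* (nn q) (ℚ.↧ₙ p)) (cong (ℤ._* ℚ.↧ p) (sym (numerator≡ 0≤q))))) le)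

≤⇒≤ᴱ : ∀ {p q} → 0ℚ ℚ.≤ p → 0ℚ ℚ.≤ q → p ℚ.≤ q → (encodeℚ p ≤ᴱ encodeℚ q) ≡ true
≤⇒≤ᴱ 0≤p 0≤q p≤q = ≤ᵇ-true (cross-≤ᴱ 0≤p 0≤q p≤q)

<⇒≰ᴱ : ∀ {p q} → 0ℚ ℚ.≤ p → 0ℚ ℚ.≤ q → q ℚ.< p → (encodeℚ p ≤ᴱ encodeℚ q) ≡ false
<⇒≰ᴱ {p} {q} 0≤p 0≤q q<p = ≤ᵇ-false (≰⇒> λ le → ℚ.<-irrefl refl (ℚ.<-≤-trans q<p (≤ᴱ-cross 0≤p 0≤q le)))

≤ᴱ⇒≤ : ∀ {p q} → 0ℚ ℚ.≤ p → 0ℚ ℚ.≤ q → (encodeℚ p ≤ᴱ encodeℚ q) ≡ true → p ℚ.≤ q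
≤ᴱ⇒≤ 0≤p 0≤q eq = ≤ᴱ-cross 0≤p 0≤q (true-≤ᵇ eq)

encode-injective : ∀ {p q} → 0ℚ ℚ.≤ p → 0ℚ ℚ.≤ q → nn p ≡ nn q → ℚ.↧ₙ p ≡ ℚ.↧ₙ q → p ≡ q
encode-injective {p} {q} 0≤p 0≤q n≡ d≡ = ℚ.≤-antisym
  (≤ᴱ-cross 0≤p 0≤q (≤-reflexive (cong₂ _*_ n≡ (sym d≡)))) (≤ᴱ-cross 0≤q 0≤p (≤-reflexive (cong₂ _*_ (sym n≡) d≡)))

denominator-* : ∀ {q} → 0ℚ ℚ.≤ q → ι (ℚ.↧ₙ q) ℚ.* q ≡ ι (nn q)
denominator-* {q@(mkℚ (pos n) d-1 c)} _ = ℚ.toℚᵘ-injective (ℚᵘ.≃-trans (ℚ.toℚᵘ-homo-* (ι (suc d-1)) q)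
  (ℚᵘ.≃-trans (ℚᵘ.*-cong (toℚᵘ-ι (suc d-1)) (ℚᵘ.≃-refl {mkℚᵘ (pos n) d-1}))
  (ℚᵘ.≃-trans (*≡* (trans (ℤ.*-identityʳ _) (trans (ℤ.*-comm (pos (suc d-1)) (pos n)) (cong (λ k → pos n ℤ.* pos (suc k)) (sym (+-identityʳ d-1))))))
    (ℚᵘ.≃-sym (toℚᵘ-ι n)))))
denominator-* {mkℚ -[1+ n ] d-1 c} (*≤* ())

-- Multiplication by the product of both denominators turns the two sides into the natural numbers
-- of the hypothesis.
value-≤ : ∀ {a b x y} → 0ℚ ℚ.≤ x → 0ℚ ℚ.≤ y → (a * nn x) * ℚ.↧ₙ y ≤ (b * nn y) * ℚ.↧ₙ x →
    ι a ℚ.* x ℚ.≤ ι b ℚ.* y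
value-≤ {a} {b} {x} {y} 0≤x 0≤y le = ℚ.*-cancelˡ-≤-pos (ι (ℚ.↧ₙ x * ℚ.↧ₙ y)) {{ℚ.normalize-pos (ℚ.↧ₙ x * ℚ.↧ₙ y) 1 {{_}} {{m*n≢0 (ℚ.↧ₙ x) (ℚ.↧ₙ y)}}}}
  (subst₂ ℚ._≤_ (sym (scaled a 0≤x)) (trans (sym (scaled b 0≤y)) (cong (λ d → ι d ℚ.* (ι b ℚ.* y)) (*-comm (ℚ.↧ₙ y) (ℚ.↧ₙ x)))) (ι-mono le))
  where
  scaled : ∀ a {x e} → 0ℚ ℚ.≤ x → ι (ℚ.↧ₙ x * e) ℚ.* (ι a ℚ.* x) ≡ ι ((a * nn x) * e)
  scaled a {x} {e} 0≤x = begin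
    ι (d * e) ℚ.* (ι a ℚ.* x)          ≡⟨ ℚ.*-assoc (ι (d * e)) (ι a) x ⟨
    ι (d * e) ℚ.* ι a ℚ.* x            ≡⟨ cong (ℚ._* x) (sym (ι-* (d * e) a)) ⟩
    ι (d * e * a) ℚ.* x                ≡⟨ cong (λ k → ι k ℚ.* x) (trans (*-assoc d e a) (*-comm d (e * a))) ⟩
    ι (e * a * d) ℚ.* x                ≡⟨ cong (ℚ._* x) (ι-* (e * a) d) ⟩
    ι (e * a) ℚ.* ι d ℚ.* x            ≡⟨ ℚ.*-assoc (ι (e * a)) (ι d) x ⟩
    ι (e * a) ℚ.* (ι d ℚ.* x)          ≡⟨ cong (ι (e * a) ℚ.*_) (denominator-* 0≤x) ⟩
    ι (e * a) ℚ.* ι (nn x)             ≡⟨ sym (ι-* (e * a) (nn x)) ⟩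
    ι (e * a * nn x)                   ≡⟨ cong ι (trans (*-assoc e a (nn x)) (*-comm e (a * nn x))) ⟩
    ι (a * nn x * e)                   ∎
    where
    open ≡-Reasoning
    d = ℚ.↧ₙ x

sum-indicator : ∀ {n} (b : Fin n → Bool) (v : Fin n → ℚ) x → (∀ j → b j ≡ true → v j ≡ x) →
                sumℚ (λ j → if b j then v j else 0ℚ) ≡ ι (∑ (𝟙 ∘ b)) ℚ.* x
sum-indicator {zero}  b v x eq = sym (ℚ.*-zeroˡ x)
sum-indicator {suc n} b v x eq with b zero in b₀
... | true  = trans (cong₂ ℚ._+_ (eq zero b₀) (sum-indicator (b ∘ suc) (v ∘ suc) x (eq ∘ suc)))
                    (sym (ι-suc-* (∑ (𝟙 ∘ b ∘ suc)) x))
... | false = trans (ℚ.+-identityˡ _) (sum-indicator (b ∘ suc) (v ∘ suc) x (eq ∘ suc))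

sum-≤ : ∀ {n} {f : Fin n → ℚ} {β} → (∀ i → f i ℚ.≤ β) → sumℚ f ℚ.≤ ι n ℚ.* β
sum-≤ {zero}  {β = β} _ = ℚ.≤-reflexive (sym (ℚ.*-zeroˡ β))
sum-≤ {suc n} {β = β} f≤ = ℚ.≤-trans (ℚ.+-mono-≤ (f≤ zero) (sum-≤ (f≤ ∘ suc))) (ℚ.≤-reflexive (sym (ι-suc-* n β)))

-- Counting in lists and over indices

length-filter-mono : ∀ (p q : S → Bool) {xs} → All (λ x → p x ≡ true → q x ≡ true) xs →
                     length (filterᵇ p xs) ≤ length (filterᵇ q xs)
length-filter-mono p q []                = z≤n
length-filter-mono p q {x ∷ xs} (f ∷ fs) with p x | q x
... | true  | true  = s≤s (length-filter-mono p q fs)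
... | true  | false with () ← f refl
... | false | true  = m≤n⇒m≤1+n (length-filter-mono p q fs)
... | false | false = length-filter-mono p q fs

length-filter-strict : ∀ (p q : S → Bool) {xs} → All (λ x → p x ≡ true → q x ≡ true) xs →
                       ∀ {x} → x ∈ xs → p x ≡ false → q x ≡ true → length (filterᵇ p xs) < length (filterᵇ q xs)
length-filter-strict p q (f ∷ fs) (here refl) px qx rewrite px | qx = s≤s (length-filter-mono p q fs)
length-filter-strict p q {y ∷ xs} (f ∷ fs) (there x∈) px qx with p y | q y
... | true  | true  = s≤s (length-filter-strict p q fs x∈ px qx)
... | true  | false with () ← f refl
... | false | true  = m≤n⇒m≤1+n (length-filter-strict p q fs x∈ px qx)
... | false | false = length-filter-strict p q fs x∈ px qx

total-tabulate : ∀ {n} (f : S → ℕ) (g : Fin n → S) → total f (List.tabulate g) ≡ ∑ (f ∘ g)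
total-tabulate {n = zero}  f g = refl
total-tabulate {n = suc n} f g = cong (f (g zero) +_) (total-tabulate f (g ∘ suc))

total-filter-𝟙 : ∀ (p : S → Bool) (f : S → ℕ) xs → total f (filterᵇ p xs) ≡ total (λ x → if p x then f x else 0) xs
total-filter-𝟙 p f []       = refl
total-filter-𝟙 p f (x ∷ xs) with p x
... | true  = cong (f x +_) (total-filter-𝟙 p f xs)
... | false = total-filter-𝟙 p f xs

length-filter-𝟙 : ∀ (p : S → Bool) xs → length (filterᵇ p xs) ≡ total (𝟙 ∘ p) xs
length-filter-𝟙 p []       = refl
length-filter-𝟙 p (x ∷ xs) with p x
... | true  = cong suc (length-filter-𝟙 p xs)
... | false = length-filter-𝟙 p xs

∈⇒≤total : ∀ (f : S → ℕ) {x xs} → x ∈ xs → f x ≤ total f xs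
∈⇒≤total f (here refl)       = m≤m+n _ _
∈⇒≤total f {xs = y ∷ _} (there x∈) = ≤-trans (∈⇒≤total f x∈) (m≤n+m _ (f y))

total>0 : ∀ (b : S → Bool) {xs} → 1 ≤ total (𝟙 ∘ b) xs → ∃ λ x → x ∈ xs × b x ≡ true
total>0 b {x ∷ xs} 1≤ with b x in eq
... | true  = x , here refl , eq
... | false = let (y , y∈ , by) = total>0 b 1≤ in y , there y∈ , by

∑-unique : ∀ {n} (b : Fin n → Bool) i → b i ≡ true → (∀ j → b j ≡ true → j ≡ i) → ∑ (𝟙 ∘ b) ≡ 1
∑-unique {n} b i bi unique = trans (sym (+-identityʳ _)) (trans
  (∑-update {f = const 0} {𝟙 ∘ b} i λ j j≢i → others j j≢i (b j) refl) (cong₂ _+_ (∑-zero n) (cong 𝟙 bi)))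
  where
  others : ∀ j → j ≢ i → ∀ c → b j ≡ c → 𝟙 (b j) ≡ 0
  others j j≢i false bj = cong 𝟙 bj
  others j j≢i true  bj = ⊥-elim (j≢i (unique j bj))

∑-total : ∀ {n} (f : Fin n → S → ℕ) xs → ∑ (λ j → total (f j) xs) ≡ total (λ x → ∑ (λ j → f j x)) xs
∑-total {n = n} f []       = ∑-zero n
∑-total f (x ∷ xs) = trans (∑-distrib-+ (λ j → f j x) (λ j → total (f j) xs)) (cong (∑ (λ j → f j x) +_) (∑-total f xs))

total-cong : ∀ {f g : S → ℕ} {xs} → All (λ x → f x ≡ g x) xs → total f xs ≡ total g xs
total-cong []         = refl
total-cong (eq ∷ eqs) = cong₂ _+_ eq (total-cong eqs)

_≟ᴵ_ : DecidableEquality Item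
_≟ᴵ_ = Product.≡-dec _≟_ (Product.≡-dec _≟_ (Product.≡-dec _≟_ (Product.≡-dec _≟_ _≟_)))

-- Take the indicator of x for `f`.
total-≤⇒∈ : ∀ {xs ys} → (∀ f → total f xs ≤ total f ys) → ∀ {x : Item} → x ∈ xs → x ∈ ys
total-≤⇒∈ {xs} {ys} le {x} x∈ with total>0 same {ys} (≤-trans (≤-trans one (∈⇒≤total (𝟙 ∘ same) x∈)) (le (𝟙 ∘ same)))
  where
  same : Item → Bool
  same y = does (x ≟ᴵ y)
  one : 1 ≤ 𝟙 (same x)
  one with x ≟ᴵ x
  ... | yes _ = ≤-refl
  ... | no ne = ⊥-elim (ne refl)
... | y , y∈ , eq with x ≟ᴵ y
...   | yes refl = y∈
...   | no _ with () ← eq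

enumerate-tabulate : ∀ {R S : Set} {n} (f : ℕ → R → S) (g : Fin n → R) →
                     enumerate f (List.tabulate g) ≡ List.tabulate (λ j → f (n ∸ suc (toℕ j)) (g j))
enumerate-tabulate {n = zero}  f g = refl
enumerate-tabulate {n = suc n} f g = cong₂ (λ k l → f k (g zero) ∷ l)
  (trans (cong length (enumerate-tabulate f (g ∘ suc))) (length-tabulate _)) (enumerate-tabulate f (g ∘ suc))

-- From chains to machines, and the choice of the best candidate

findMachine : ∀ m (Ds : List Chain) → length Ds ≤ m → ℕ → Maybe (Fin m)
findMachine m       []       _        t = nothing
findMachine (suc m) (D ∷ Ds) (s≤s le) t = if hasTag t D then just zero else Maybe.map suc (findMachine m Ds le t)

encode-findMachine : ∀ m Ds le t → encodeMachine (findMachine m Ds le t) ≡ machineOf Ds t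
encode-findMachine m       []       le       t = refl
encode-findMachine (suc m) (D ∷ Ds) (s≤s le) t with hasTag t D
... | true  = refl
... | false with findMachine m Ds le t | encode-findMachine m Ds le t
...   | nothing | eq = cong [ inj₁ , (λ k → inj₂ (suc k)) ] eq
...   | just x  | eq = cong [ inj₁ , (λ k → inj₂ (suc k)) ] eq

chainOf : ∀ {m} → List Chain → Fin m → Chain
chainOf []       _       = []
chainOf (D ∷ Ds) zero    = D
chainOf (D ∷ Ds) (suc x) = chainOf Ds x

chainOf-elim : ∀ {m} {P : Chain → Set} Ds (x : Fin m) → (length Ds < m → P []) → All P Ds → P (chainOf Ds x)
chainOf-elim {suc m} []       x       P[] []       = P[] (s≤s z≤n)
chainOf-elim {suc m} (D ∷ Ds) zero    P[] (p ∷ ps) = p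
chainOf-elim {suc m} (D ∷ Ds) (suc x) P[] (p ∷ ps) = chainOf-elim Ds x (P[] ∘ s≤s) ps

tagCount : ℕ → Chain → ℕ
tagCount t = total (λ y → 𝟙 (t ≡ᵇ′ tag y))

hasTag-count : ∀ t D → tagCount t D ≤ 1 → tagCount t D ≡ 𝟙 (hasTag t D)
hasTag-count t D le rewrite length-filter-𝟙 (λ y → t ≡ᵇ′ tag y) D with tagCount t D | le
... | zero  | _         = refl
... | suc _ | s≤s z≤n = refl

total-chainOf : ∀ {m} (f : Chain → ℕ) Ds (x : Fin m) → f [] ≡ 0 → f (chainOf Ds x) ≤ total f Ds
total-chainOf f []       x       f[] = ≤-reflexive f[]
total-chainOf f (D ∷ Ds) zero    f[] = m≤m+n _ _
total-chainOf f (D ∷ Ds) (suc x) f[] = ≤-trans (total-chainOf f Ds x f[]) (m≤n+m _ (f D))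

isMachine : ∀ {m} → Maybe (Fin m) → Fin m → Bool
isMachine r x = does (Maybe.≡-dec Fin._≟_ r (just x))

isMachine-suc : ∀ {m} (r : Maybe (Fin m)) x → isMachine (Maybe.map suc r) (suc x) ≡ isMachine r x
isMachine-suc nothing  x = refl
isMachine-suc (just y) x with y Fin.≟ x
... | yes _ = refl
... | no  _ = refl

isMachine-zero : ∀ {m} (r : Maybe (Fin m)) → isMachine (Maybe.map suc r) zero ≡ false
isMachine-zero nothing  = refl
isMachine-zero (just y) = refl

-- As the tag occurs at most once in all chains together, the chain found first is the only one with
-- this tag. Membership is expressed as a count because counts can be summed to the length of a
-- chain.
findMachine-count : ∀ m Ds le t → total (tagCount t) Ds ≤ 1 → ∀ x →
                    𝟙 (isMachine (findMachine m Ds le t) x) ≡ tagCount t (chainOf Ds x)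
findMachine-count m       []       le       t h x = refl
findMachine-count (suc m) (D ∷ Ds) (s≤s le) t h x with hasTag t D | hasTag-count t D (≤-trans (m≤m+n _ _) h)
findMachine-count (suc m) (D ∷ Ds) (s≤s le) t h zero    | true  | eq = sym eq
findMachine-count (suc m) (D ∷ Ds) (s≤s le) t h (suc x) | true  | eq =
  sym (n≤0⇒n≡0 (≤-trans (total-chainOf (tagCount t) Ds x refl) (≤-pred (subst (λ k → k + total (tagCount t) Ds ≤ 1) eq h))))
findMachine-count (suc m) (D ∷ Ds) (s≤s le) t h zero    | false | eq =
  trans (cong 𝟙 (isMachine-zero (findMachine m Ds le t))) (sym eq)
findMachine-count (suc m) (D ∷ Ds) (s≤s le) t h (suc x) | false | eq =
  trans (cong 𝟙 (isMachine-suc (findMachine m Ds le t) x)) (findMachine-count m Ds le t (≤-trans (m≤n+m _ (tagCount t D)) h) x)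

is-just-map : ∀ {A B : Set} {f : A → B} (r : Maybe A) → is-just (Maybe.map f r) ≡ is-just r
is-just-map nothing  = refl
is-just-map (just _) = refl

findMachine-total : ∀ m Ds le t → total (tagCount t) Ds ≤ 1 →
    𝟙 (is-just (findMachine m Ds le t)) ≡ total (tagCount t) Ds
findMachine-total m       []       le       t h = refl
findMachine-total (suc m) (D ∷ Ds) (s≤s le) t h with hasTag t D | hasTag-count t D (≤-trans (m≤m+n _ _) h)
... | true  | eq = sym (trans (cong (_+ total (tagCount t) Ds) eq) (cong suc (n≤0⇒n≡0 (≤-pred (subst (λ k → k + total (tagCount t) Ds ≤ 1) eq h)))))
... | false | eq = trans (cong 𝟙 (is-just-map (findMachine m Ds le t)))
  (trans (findMachine-total m Ds le t (≤-trans (m≤n+m _ (tagCount t D)) h)) (sym (cong (_+ total (tagCount t) Ds) eq)))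

module _ (f : S → Candidate) where

  private
    value denom : S → ℕ
    value c = proj₁ (proj₂ (f c))
    denom c = proj₂ (proj₂ (f c))

  record BestOf (xs : List S) (acc : Candidate) : Set where
    field
      arg     : S
      arg∈    : arg ∈ xs
      is      : acc ≡ f arg
      maximal : All (λ c → value c * denom arg ≤ value arg * denom c) xs

  -- Transitivity of the comparison by cross multiplication cancels the denominator of the old best
  -- candidate, which therefore has to be positive.
  best-of-step : ∀ x xs acc → 0 < proj₂ (proj₂ acc) → BestOf xs acc → BestOf (x ∷ xs) (better (f x) acc)
  best-of-step x xs _ 0<c record { arg = c ; arg∈ = c∈ ; is = refl ; maximal = max } with value c * denom x ≤ᵇ value x * denom c in le
  ... | false = record { arg = c ; arg∈ = there c∈ ; is = refl ; maximal = <⇒≤ (false-≤ᵇ le) ∷ max }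
  ... | true  = record { arg = x ; arg∈ = here refl ; is = refl
                       ; maximal = ≤-refl ∷ All.map (λ {z} → transitive (value z) (denom z)) max }
    where
    open ≤-Reasoning
    swap-last : ∀ a b d → a * b * d ≡ a * d * b
    swap-last a b d = trans (*-assoc a b d) (trans (cong (a *_) (*-comm b d)) (sym (*-assoc a d b)))
    transitive : ∀ v d → v * denom c ≤ value c * d → v * denom x ≤ value x * d
    transitive v d le′ = *-cancelʳ-≤ _ _ (denom c) {{>-nonZero 0<c}} (begin
      v * denom x * denom c          ≡⟨ swap-last v (denom x) (denom c) ⟩
      v * denom c * denom x          ≤⟨ *-monoˡ-≤ (denom x) le′ ⟩
      value c * d * denom x          ≡⟨ swap-last (value c) d (denom x) ⟩
      value c * denom x * d          ≤⟨ *-monoˡ-≤ d (true-≤ᵇ {value c * denom x} {value x * denom c} le) ⟩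
      value x * denom c * d          ≡⟨ swap-last (value x) (denom c) d ⟩
      value x * d * denom c          ∎)

  best-of : ∀ x xs → All (λ c → 0 < denom c) (x ∷ xs) →
            BestOf (x ∷ xs) (foldr (λ c → better (f c)) ([] , 0 , 1) (x ∷ xs))
  -- The initial value 0 / 1 loses against any candidate, as `better` prefers the new one in case of
  -- a tie.
  best-of x []       _          = record { arg = x ; arg∈ = here refl ; is = refl ; maximal = ≤-refl ∷ [] }
  best-of x (y ∷ ys) (_ ∷ 0<ys) = best-of-step x (y ∷ ys) _ (subst (λ acc → 0 < proj₂ (proj₂ acc)) (sym (BestOf.is rest)) (All.lookup 0<ys (BestOf.arg∈ rest))) rest
    where rest = best-of y ys 0<ys

∧-true : ∀ {a b} → a ∧ b ≡ true → a ≡ true × b ≡ true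
∧-true {true} {true} _ = refl , refl

-- Instances as lists of items

module Encoded {n : ℕ} (ℐ : Instance n) (positive : ∀ j → 0ℚ ℚ.< weight (ℐ j)) where

  entryOf : Fin n → ⟦ entry ⟧
  entryOf j = encodeℚ (start (ℐ j)) , encodeℚ (end (ℐ j)) , encodeℚ (weight (ℐ j))

  entries : List ⟦ entry ⟧
  entries = List.tabulate entryOf

  itemOf : Fin n → Item
  itemOf j = toItem entries (n ∸ suc (toℕ j)) (entryOf j)

  allItems : List Item
  allItems = List.tabulate itemOf

  items≡ : items entries ≡ allItems
  items≡ = enumerate-tabulate (toItem entries) entryOf

  end≥0 : ∀ j → 0ℚ ℚ.≤ end (ℐ j)
  end≥0 j = ℚ.≤-trans (start≥0 (ℐ j)) (ℚ.<⇒≤ (start<end (ℐ j)))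

  weight≥0 : ∀ j → 0ℚ ℚ.≤ weight (ℐ j)
  weight≥0 j = ℚ.<⇒≤ (positive j)

  before-mono : ∀ {s t} → 0ℚ ℚ.≤ s → 0ℚ ℚ.≤ t → s ℚ.≤ t →
                All (λ k → (proj₁ (proj₂ k) ≤ᴱ encodeℚ s) ≡ true → (proj₁ (proj₂ k) ≤ᴱ encodeℚ t) ≡ true) entries
  before-mono 0≤s 0≤t s≤t = All.tabulate⁺ λ k e≤s → ≤⇒≤ᴱ (end≥0 k) 0≤t (ℚ.≤-trans (≤ᴱ⇒≤ (end≥0 k) 0≤s e≤s) s≤t)

  -- The end of interval i itself is counted on the right but not on the left. This strictness is
  -- what allows conflicts to be read off from ranks.
  rank-< : ∀ {t} i → 0ℚ ℚ.≤ t → t ℚ.< end (ℐ i) →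
      rank entries (encodeℚ t) < rank entries (encodeℚ (end (ℐ i)))
  rank-< {t} i 0≤t t<e = length-filter-strict (λ k → proj₁ (proj₂ k) ≤ᴱ encodeℚ t) (λ k → proj₁ (proj₂ k) ≤ᴱ encodeℚ (end (ℐ i)))
    (before-mono 0≤t (end≥0 i) (ℚ.<⇒≤ t<e)) (∈-tabulate⁺ i) (<⇒≰ᴱ (end≥0 i) 0≤t t<e) (≤⇒≤ᴱ (end≥0 i) (end≥0 i) ℚ.≤-refl)

  ≤⇒⊰ : ∀ {i j} → end (ℐ i) ℚ.≤ start (ℐ j) → itemOf i ⊰ itemOf j
  ≤⇒⊰ {i} {j} e≤s = length-filter-mono (λ k → proj₁ (proj₂ k) ≤ᴱ encodeℚ (end (ℐ i))) (λ k → proj₁ (proj₂ k) ≤ᴱ encodeℚ (start (ℐ j)))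
    (before-mono (end≥0 i) (start≥0 (ℐ j)) e≤s)

  ⊰⇒≤ : ∀ {i j} → itemOf i ⊰ itemOf j → end (ℐ i) ℚ.≤ start (ℐ j)
  ⊰⇒≤ {i} {j} i⊰j = ℚ.≮⇒≥ λ s<e → <⇒≱ (rank-< i (start≥0 (ℐ j)) s<e) i⊰j

  valid : ∀ j → Valid (itemOf j)
  valid j = rank-< j (start≥0 (ℐ j)) (start<end (ℐ j))

  ⊰⇒¬Overlap : ∀ {i j} → itemOf i ⊰ itemOf j → ¬ Overlap (ℐ i) (ℐ j)
  ⊰⇒¬Overlap i⊰j (t , (_ , t<e) , (s≤t , _)) = ℚ.<-irrefl refl (ℚ.<-≤-trans t<e (ℚ.≤-trans (⊰⇒≤ i⊰j) s≤t))

  -- If neither interval ends before the other starts, the later of the two starts lies in both.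
  ¬Overlap⇒⊰ : ∀ {i j} → ¬ Overlap (ℐ i) (ℐ j) → itemOf i ⊰ itemOf j ⊎ itemOf j ⊰ itemOf i
  ¬Overlap⇒⊰ {i} {j} apart with end (ℐ i) ℚ.≤? start (ℐ j) | end (ℐ j) ℚ.≤? start (ℐ i)
  ... | yes e≤s | _       = inj₁ (≤⇒⊰ e≤s)
  ... | no _    | yes e≤s = inj₂ (≤⇒⊰ e≤s)
  ... | no e≰s  | no e≰s′ = ⊥-elim (apart (meet (ℚ.≤-total (start (ℐ i)) (start (ℐ j)))))
    where
    meet : start (ℐ i) ℚ.≤ start (ℐ j) ⊎ start (ℐ j) ℚ.≤ start (ℐ i) → Overlap (ℐ i) (ℐ j)
    meet (inj₁ i≤j) = start (ℐ j) , (i≤j , ℚ.≰⇒> e≰s) , (ℚ.≤-refl , start<end (ℐ j))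
    meet (inj₂ j≤i) = start (ℐ i) , (ℚ.≤-refl , start<end (ℐ i)) , (j≤i , ℚ.≰⇒> e≰s′)

  tag-injective : ∀ {i j} → tag (itemOf i) ≡ tag (itemOf j) → i ≡ j
  tag-injective {i} {j} eq = Fin.toℕ-injective (suc-injective (∸-cancelˡ-≡ (Fin.toℕ<n i) (Fin.toℕ<n j) eq))

  sameWeight⇒≡ : ∀ {i j} → sameWeight (itemOf i) (itemOf j) ≡ true → weight (ℐ j) ≡ weight (ℐ i)
  sameWeight⇒≡ {i} {j} same = let (n≡ , d≡) = ∧-true same in encode-injective (weight≥0 j) (weight≥0 i)
    (sym (≡ᵇ′⇒≡ (num (itemOf i)) (num (itemOf j)) n≡)) (sym (≡ᵇ′⇒≡ (den (itemOf i)) (den (itemOf j)) d≡))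

  ≡⇒sameWeight : ∀ {i j} → weight (ℐ i) ≡ weight (ℐ j) → sameWeight (itemOf i) (itemOf j) ≡ true
  ≡⇒sameWeight {i} {j} eq = cong₂ _∧_
    (trans (cong (λ w′ → nn (weight (ℐ i)) ≡ᵇ′ nn w′) (sym eq)) (≡ᵇ′-refl (nn (weight (ℐ i)))))
    (trans (cong (λ w′ → (ℚ.↧ₙ (weight (ℐ i))) ≡ᵇ′ (ℚ.↧ₙ w′)) (sym eq)) (≡ᵇ′-refl (ℚ.↧ₙ (weight (ℐ i)))))

  tags-unique : ∀ i → ∑ (λ j → 𝟙 (tag (itemOf j) ≡ᵇ′ tag (itemOf i))) ≡ 1
  tags-unique i = ∑-unique (λ j → tag (itemOf j) ≡ᵇ′ tag (itemOf i)) i (≡ᵇ′-refl (tag (itemOf i)))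
    λ j eq → tag-injective (≡ᵇ′⇒≡ (tag (itemOf j)) (tag (itemOf i)) eq)

  tagCount-items : ∀ i → tagCount (tag (itemOf i)) allItems ≡ 1
  tagCount-items i = trans (total-tabulate (λ y → 𝟙 (tag (itemOf i) ≡ᵇ′ tag y)) itemOf)
    (∑-unique (λ j → tag (itemOf i) ≡ᵇ′ tag (itemOf j)) i (≡ᵇ′-refl (tag (itemOf i)))
      λ j eq → sym (tag-injective (≡ᵇ′⇒≡ (tag (itemOf i)) (tag (itemOf j)) eq)))

  class : Fin n → List Item
  class i = filterᵇ (sameWeight (itemOf i)) allItems

  class-valid : ∀ i → All Valid (class i)
  class-valid i = All-filter⁺ (sameWeight (itemOf i)) (All.tabulate⁺ valid)

  module _ {m : ℕ} (O : Schedule m ℐ) where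

    private
      -- `greedy-maximum` expects a schedule of items, so the index is recovered from the tag; an
      -- item with a foreign tag is rejected.
      τ : Item → Maybe (Fin m)
      τ x with Fin.any? (λ j → tag (itemOf j) ≟ tag x)
      ... | yes (j , _) = assign O j
      ... | no  _       = nothing

      τ-itemOf : ∀ j → τ (itemOf j) ≡ assign O j
      τ-itemOf j with Fin.any? (λ i → tag (itemOf i) ≟ tag (itemOf j))
      ... | yes (i , eq) = cong (assign O) (tag-injective eq)
      ... | no none      = ⊥-elim (none (j , refl))

      disjoint : ∀ {i j} → i ≢ j → Disjoint τ (itemOf i) (itemOf j)
      disjoint {i} {j} i≢j = valid i , valid j , λ x τi τj →
        ¬Overlap⇒⊰ (noOverlap O i≢j (trans (sym (τ-itemOf i)) τi) (trans (sym (τ-itemOf j)) τj))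

    class-accepted : ∀ i → ∑ (λ j → 𝟙 (sameWeight (itemOf i) (itemOf j) ∧ is-just (assign O j))) ≤ total length (greedy m (class i))
    class-accepted i = ≤-trans (≤-reflexive (sym (begin
      total accept (class i)                           ≡⟨ total-filter-𝟙 (sameWeight (itemOf i)) accept allItems ⟩
      total (λ x → if sameWeight (itemOf i) x then accept x else 0) allItems ≡⟨ total-tabulate (λ x → if sameWeight (itemOf i) x then accept x else 0) itemOf ⟩
      ∑ (λ j → if sameWeight (itemOf i) (itemOf j) then accept (itemOf j) else 0)
        ≡⟨ ∑-cong (λ j → trans (if-𝟙 (sameWeight (itemOf i) (itemOf j)) (is-just (τ (itemOf j))))
             (cong (λ r → 𝟙 (sameWeight (itemOf i) (itemOf j) ∧ is-just r)) (τ-itemOf j))) ⟩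
      ∑ (λ j → 𝟙 (sameWeight (itemOf i) (itemOf j) ∧ is-just (assign O j))) ∎)))
      (greedy-maximum τ (class i) (class-valid i) (AllPairs.filter⁺ (T? ∘ sameWeight (itemOf i)) (AllPairs.tabulate⁺ disjoint)))
      where
      open ≡-Reasoning
      accept = λ x → 𝟙 (is-just (τ x))
      if-𝟙 : ∀ b c → (if b then 𝟙 c else 0) ≡ 𝟙 (b ∧ c)
      if-𝟙 true  c = refl
      if-𝟙 false c = refl

  module FairSchedule (m : ℕ) (i : Fin n) (Ds : List Chain) (fair : Fair m (class i) Ds) where

    private
      module F = Fair fair
      ω = weight (ℐ i)

    Ds≤m : length Ds ≤ m
    Ds≤m = ≤-trans (≤-reflexive F.width) (m⊓n≤m m (length (class i)))

    part : ∀ {D} → (∀ f → total f D ≤ total (total f) Ds) → ∀ {y} → y ∈ D → ∃ λ j → y ≡ itemOf j × weight (ℐ j) ≡ ω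
    part {D} D≤ y∈ with ∈-filter⁻ (T? ∘ sameWeight (itemOf i)) {xs = allItems} (total-≤⇒∈ {D} (λ f → ≤-trans (D≤ f) (F.part f)) y∈)
    ... | y∈all , same with ∈-tabulate⁻ y∈all
    ...   | j , refl = j , refl , sameWeight⇒≡ {i} {j} (T⇒≡ same)
      where T⇒≡ : ∀ {b} → T b → b ≡ true
            T⇒≡ {true} _ = refl

    tags≤1 : ∀ j → total (tagCount (tag (itemOf j))) Ds ≤ 1
    tags≤1 j = ≤-trans (F.part (λ y → 𝟙 (tag (itemOf j) ≡ᵇ′ tag y)))
      (≤-trans (total-filter-≤ _ (sameWeight (itemOf i)) allItems) (≤-reflexive (tagCount-items j)))

    -- Double counting: every item of `D` carries the tag of exactly one interval.
    chain-size : ∀ {D} → (∀ f → total f D ≤ total (total f) Ds) → ∑ (λ j → tagCount (tag (itemOf j)) D) ≡ length D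
    chain-size {D} D≤ = trans (∑-total (λ j y → 𝟙 (tag (itemOf j) ≡ᵇ′ tag y)) D)
      (trans (total-cong {xs = D} (All.tabulate λ y∈ → one (part {D} D≤ y∈))) (total-one D))
      where
      one : ∀ {y} → (∃ λ j → y ≡ itemOf j × weight (ℐ j) ≡ ω) → ∑ (λ j → 𝟙 (tag (itemOf j) ≡ᵇ′ tag y)) ≡ 1
      one (j , refl , _) = tags-unique j

    machineAt : Fin n → Maybe (Fin m)
    machineAt j = findMachine m Ds Ds≤m (tag (itemOf j))

    chainOf≤ : ∀ (x : Fin m) f → total f (chainOf Ds x) ≤ total (total f) Ds
    chainOf≤ x f = total-chainOf (total f) Ds x refl

    isMachine-self : ∀ (x : Fin m) → isMachine (just x) x ≡ true
    isMachine-self x with x Fin.≟ x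
    ... | yes _ = refl
    ... | no ne = ⊥-elim (ne refl)

    on-machine : ∀ {j x} → isMachine (machineAt j) x ≡ true → itemOf j ∈ chainOf Ds x × weight (ℐ j) ≡ ω
    on-machine {j} {x} eq with total>0 (λ y → tag (itemOf j) ≡ᵇ′ tag y)
      (≤-reflexive (trans (sym (cong 𝟙 eq)) (findMachine-count m Ds Ds≤m (tag (itemOf j)) (tags≤1 j) x)))
    ... | y , y∈ , same with part {chainOf Ds x} (chainOf≤ x) y∈
    ...   | j′ , refl , w≡ with refl ← tag-injective {j} {j′} (≡ᵇ′⇒≡ (tag (itemOf j)) (tag (itemOf j′)) same) = y∈ , w≡

    schedule : Schedule m ℐ
    schedule = record { assign = machineAt ; noOverlap = disjoint }
      where
      ordered : ∀ {D} → AllPairs _⊰_ D → ∀ {y z} → y ∈ D → z ∈ D → y ≢ z → y ⊰ z ⊎ z ⊰ y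
      ordered (y⊰ ∷ _)  (here refl) (here refl) y≢z = ⊥-elim (y≢z refl)
      ordered (y⊰ ∷ _)  (here refl) (there z∈)  _   = inj₁ (All.lookup y⊰ z∈)
      ordered (z⊰ ∷ _)  (there y∈)  (here refl) _   = inj₂ (All.lookup z⊰ y∈)
      ordered (_ ∷ ⊰D)  (there y∈)  (there z∈)  y≢z = ordered ⊰D y∈ z∈ y≢z
      on : ∀ {j x} → machineAt j ≡ just x → itemOf j ∈ chainOf Ds x
      on {j} {x} eq = proj₁ (on-machine {j} {x} (trans (cong (λ r → isMachine r x) eq) (isMachine-self x)))
      chains-ordered : ∀ x → AllPairs _⊰_ (chainOf Ds x)
      chains-ordered x = proj₁ (chainOf-elim {P = IsChain} Ds x (λ _ → [] , []) F.chains)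
      disjoint : ∀ {j l x} → j ≢ l → machineAt j ≡ just x → machineAt l ≡ just x → ¬ Overlap (ℐ j) (ℐ l)
      disjoint {j} {l} {x} j≢l jx lx = [ ⊰⇒¬Overlap {j} {l} , (λ l⊰j (t , t∈j , t∈l) → ⊰⇒¬Overlap {l} {j} l⊰j (t , t∈l , t∈j)) ]
        (ordered (chains-ordered x) (on {j} jx) (on {l} lx) (λ eq → j≢l (tag-injective {j} {l} (cong tag eq))))

    weight-subset : ∀ (b : Fin n → Bool) x → (∀ j → b j ≡ true → weight (ℐ j) ≡ x) →
        w ℐ (Vec.tabulate b) ≡ ι (∑ (𝟙 ∘ b)) ℚ.* x
    weight-subset b x eq = trans (sumℚ-cong λ j → cong (λ c → if c then weight (ℐ j) else 0ℚ) (Vec.lookup∘tabulate b j))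
      (sum-indicator b (weight ∘ ℐ) x eq)

    weight-machine : ∀ x → w ℐ (machine schedule x) ≡ ι (length (chainOf Ds x)) ℚ.* ω
    weight-machine x = trans (weight-subset (λ j → isMachine (machineAt j) x) ω (λ j eq → proj₂ (on-machine {j} {x} eq)))
      (cong (λ k → ι k ℚ.* ω) (trans (∑-cong λ j → findMachine-count m Ds Ds≤m (tag (itemOf j)) (tags≤1 j) x) (chain-size {chainOf Ds x} (chainOf≤ x))))

    weight-schedule : scheduleWeight schedule ≡ ι (total length Ds) ℚ.* ω
    weight-schedule = trans (weight-subset (λ j → is-just (machineAt j)) ω accepted-ω)
      (cong (λ k → ι k ℚ.* ω) (trans (∑-cong λ j → findMachine-total m Ds Ds≤m (tag (itemOf j)) (tags≤1 j))
        (trans (∑-total (λ j → tagCount (tag (itemOf j))) Ds)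
          (total-cong {f = λ D → ∑ (λ j → tagCount (tag (itemOf j)) D)} {length} {Ds}
            (All.tabulate λ {D} D∈ → chain-size {D} λ f → ∈⇒≤total (total f) D∈)))))
      where
      accepted-ω : ∀ j → is-just (machineAt j) ≡ true → weight (ℐ j) ≡ ω
      accepted-ω j eq = by-machine (machineAt j) refl eq
        where
        by-machine : ∀ r → machineAt j ≡ r → is-just r ≡ true → weight (ℐ j) ≡ ω
        by-machine (just x) r≡ _ = proj₂ (on-machine {j} {x} (trans (cong (λ r → isMachine r x) r≡) (isMachine-self x)))

    -- All items weigh the same, so the one that witnesses nonemptiness can be removed: at most
    -- `F.q` items are left, and every machine has at least `F.q`.
    schedule-EF1 : EF1 schedule
    schedule-EF1 x y _ (j , j∈) = j , j∈ , subst₂ ℚ._≤_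
      (sym (cong₂ ℚ._-_ (weight-machine y) (proj₂ (on-machine {j} {y} on-y)))) (sym (weight-machine x))
      (ι*-pred (weight≥0 i) (≤-trans (proj₂ (sizes y)) (s≤s (proj₁ (sizes x)))))
      where
      sizes : ∀ x → F.q ≤ length (chainOf Ds x) × length (chainOf Ds x) ≤ suc F.q
      -- Machines without a chain exist only if `F.q` is 0, so the bounds hold for them too.
      sizes x = chainOf-elim {P = λ D → F.q ≤ length D × length D ≤ suc F.q} Ds x (λ short → ≤-reflexive (F.empties short) , z≤n) F.sizes
      on-y : isMachine (machineAt j) y ≡ true
      on-y = trans (sym (Vec.lookup∘tabulate (λ j → isMachine (machineAt j) y) j)) (Vec.[]=⇒lookup j∈)

-- Comparison with the optimum

private variable
  m n k : ℕ

does⇒≡ : ∀ (i l : Fin k) → does (i Fin.≟ l) ≡ true → i ≡ l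
does⇒≡ i l eq with i Fin.≟ l
... | yes i≡l = i≡l
does⇒≡ i l () | no _

sum-single : ∀ (i : Fin k) y → sumℚ (λ l → if does (i Fin.≟ l) then y else 0ℚ) ≡ y
sum-single i y = trans (sum-indicator (λ l → does (i Fin.≟ l)) (λ _ → y) y (λ _ _ → refl))
  (trans (cong (λ c → ι c ℚ.* y) (∑-unique (λ l → does (i Fin.≟ l)) i same λ l eq → sym (does⇒≡ i l eq))) (ℚ.*-identityˡ y))
  where
  same : does (i Fin.≟ i) ≡ true
  same with i Fin.≟ i
  ... | yes _ = refl
  ... | no ne = ⊥-elim (ne refl)

if-∧ : ∀ a b (y : ℚ) → (if a then (if b then y else 0ℚ) else 0ℚ) ≡ (if a ∧ b then y else 0ℚ)
if-∧ true  b y = refl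
if-∧ false b y = refl

𝟙-∧ : ∀ {a b} c → (a ≡ true → b ≡ true) → 𝟙 (a ∧ c) ≤ 𝟙 (b ∧ c)
𝟙-∧ {true}  c a⇒b rewrite a⇒b refl = ≤-refl
𝟙-∧ {false} c a⇒b = z≤n

does-≢ : ∀ (i l : Fin k) → i ≢ l → does (i Fin.≟ l) ≡ false
does-≢ i l i≢l with i Fin.≟ l
... | yes i≡l = ⊥-elim (i≢l i≡l)
... | no _    = refl

sum-classes : ∀ (κ : Fin n → Fin k) (f : Fin n → ℚ) →
              sumℚ f ≡ sumℚ (λ i → sumℚ (λ j → if does (κ j Fin.≟ i) then f j else 0ℚ))
sum-classes {k = k} κ f = trans (sumℚ-cong {x = f} {λ j → sumℚ {k} (λ i → if does (κ j Fin.≟ i) then f j else 0ℚ)} λ j → sym (sum-single (κ j) (f j))) (sumℚ-swap (λ j i → if does (κ j Fin.≟ i) then f j else 0ℚ))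

module _ (ℐ : Instance n) (positive : ∀ j → 0ℚ ℚ.< weight (ℐ j)) where

  open Encoded ℐ positive

  -- Restricted to one weight, `O` is a schedule of that class, so it accepts at most the greedy
  -- number of items and earns at most β there; the k weights together give k β.
  opt-≤ : ∀ {k m} (W : Fin k → ℚ) (κ : Fin n → Fin k) → (∀ j → weight (ℐ j) ≡ W (κ j)) → ∀ {β} → 0ℚ ℚ.≤ β →
          (∀ j → ι (total length (greedy m (class j))) ℚ.* weight (ℐ j) ℚ.≤ β) →
          ∀ (O : Schedule m ℐ) → scheduleWeight O ℚ.≤ ι k ℚ.* β
  opt-≤ {k} {m} W κ wκ {β} 0≤β class≤β O = ℚ.≤-trans (ℚ.≤-reflexive by-class) (sum-≤ bound)
    where
    acc : Fin n → Bool
    acc j = is-just (assign O j)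
    inside : Fin k → Fin n → Bool
    inside i j = does (κ j Fin.≟ i)
    count : Fin k → ℕ
    count i = ∑ (λ j → 𝟙 (inside i j ∧ acc j))
    v : Fin n → ℚ
    v j = if acc j then weight (ℐ j) else 0ℚ
    class-sum : ∀ i → sumℚ (λ j → if inside i j then v j else 0ℚ) ≡ ι (count i) ℚ.* W i
    class-sum i = trans
      (sumℚ-cong {x = λ j → if inside i j then v j else 0ℚ} {λ j → if inside i j ∧ acc j then weight (ℐ j) else 0ℚ}
        λ j → if-∧ (inside i j) (acc j) (weight (ℐ j)))
      (sum-indicator (λ j → inside i j ∧ acc j) (λ j → weight (ℐ j)) (W i) λ j eq → trans (wκ j) (cong W (does⇒≡ (κ j) i (proj₁ (∧-true {inside i j} {acc j} eq)))))
    by-class : scheduleWeight O ≡ sumℚ (λ i → ι (count i) ℚ.* W i)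
    by-class = trans
      (sumℚ-cong {x = λ j → if Vec.lookup (Vec.tabulate acc) j then weight (ℐ j) else 0ℚ} {v}
        λ j → cong (λ b → if b then weight (ℐ j) else 0ℚ) (Vec.lookup∘tabulate acc j))
      (trans (sum-classes κ v) (sumℚ-cong {x = λ i → sumℚ (λ j → if inside i j then v j else 0ℚ)} {λ i → ι (count i) ℚ.* W i} class-sum))
    count≤greedy : ∀ j₀ → count (κ j₀) ≤ total length (greedy m (class j₀))
    count≤greedy j₀ = ≤-trans
      (∑-mono {f = λ j → 𝟙 (inside (κ j₀) j ∧ acc j)} {λ j → 𝟙 (sameWeight (itemOf j₀) (itemOf j) ∧ acc j)}
        λ j → 𝟙-∧ {inside (κ j₀) j} {sameWeight (itemOf j₀) (itemOf j)} (acc j)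
        λ eq → ≡⇒sameWeight {j₀} {j} (trans (wκ j₀) (trans (cong W (sym (does⇒≡ (κ j) (κ j₀) eq))) (sym (wκ j)))))
      (class-accepted O j₀)
    nobody : ∀ {i} → (∀ j → κ j ≢ i) → count i ≡ 0
    nobody {i} none = trans (∑-cong {x = λ j → 𝟙 (inside i j ∧ acc j)} {const 0} nobody′) (∑-zero n)
      where
      nobody′ : ∀ j → 𝟙 (inside i j ∧ acc j) ≡ 0
      nobody′ j = cong (λ b → 𝟙 (b ∧ acc j)) (does-≢ (κ j) i (none j))
    bound : ∀ i → ι (count i) ℚ.* W i ℚ.≤ β
    bound i = by-dec (Fin.any? (λ j → κ j Fin.≟ i))
      where
      by-dec : Dec (∃ λ j → κ j ≡ i) → ι (count i) ℚ.* W i ℚ.≤ β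
      by-dec (yes (j₀ , refl)) = ℚ.≤-trans (ℚ.≤-reflexive (cong (ι (count (κ j₀)) ℚ.*_) (sym (wκ j₀))))
        (ℚ.≤-trans (ι*-mono {count (κ j₀)} {total length (greedy m (class j₀))} {weight (ℐ j₀)} (weight≥0 j₀) (count≤greedy j₀)) (class≤β j₀))
      -- A weight that no interval has contributes 0, which is at most β because β is nonnegative.
      by-dec (no none) = ℚ.≤-trans (ℚ.≤-reflexive (trans (cong (λ c → ι c ℚ.* W i) (nobody λ j eq → none (j , eq))) (ℚ.*-zeroˡ (W i)))) 0≤β

  record BestClass (m : ℕ) : Set where
    field
      index  : Fin n
      Ds     : List Chain
      best≡  : proj₁ (best m (items entries)) ≡ Ds
      fair   : Fair m (class index) Ds
      bound  : ∀ j → ι (total length (greedy m (class j))) ℚ.* weight (ℐ j) ℚ.≤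
               (pos 3 ℚ./ 2) ℚ.* (ι (total length Ds) ℚ.* weight (ℐ index))

  bestClass : ∀ m → BestOf (candidate m allItems) allItems (best m allItems) → BestClass m
  bestClass m b = from-index (∈-tabulate⁻ (BestOf.arg∈ b)) (BestOf.is b) (BestOf.maximal b)
    where
    fairOf : ∀ j → Fair m (class j) (classSchedule m (class j))
    fairOf j = classSchedule-fair m (class j) (class-valid j)
    value-bound : ∀ i j →
        proj₁ (proj₂ (candidate m allItems (itemOf j))) * den (itemOf i) ≤ proj₁ (proj₂ (candidate m allItems (itemOf i))) * den (itemOf j) →
                  ι (total length (greedy m (class j))) ℚ.* weight (ℐ j) ℚ.≤ (pos 3 ℚ./ 2) ℚ.* (ι (total length (classSchedule m (class i))) ℚ.* weight (ℐ i))
    value-bound i j le = ℚ.≤-trans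
      (three-halves {total length (greedy m (class j))} {total length (classSchedule m (class j))} (weight≥0 j) (Fair.large (fairOf j)))
      (ℚ.*-monoˡ-≤-nonNeg (pos 3 ℚ./ 2) (value-≤ {total length (classSchedule m (class j))} {total length (classSchedule m (class i))} (weight≥0 j) (weight≥0 i)
        (subst₂ (λ a b → a * nn (weight (ℐ j)) * ℚ.↧ₙ (weight (ℐ i)) ≤ b * nn (weight (ℐ i)) * ℚ.↧ₙ (weight (ℐ j)))
          (length-concat (classSchedule m (class j))) (length-concat (classSchedule m (class i))) le)))
    from-index : ∀ {c} → (∃ λ i → c ≡ itemOf i) → best m allItems ≡ candidate m allItems c →
                 All (λ c′ → proj₁ (proj₂ (candidate m allItems c′)) * den c ≤ proj₁ (proj₂ (candidate m allItems c)) * den c′) allItems → BestClass m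
    from-index (i , refl) is maximal = record
      { index = i
      ; Ds    = classSchedule m (class i)
      ; best≡ = trans (cong (λ L → proj₁ (best m L)) items≡) (cong proj₁ is)
      ; fair  = fairOf i
      ; bound = λ j → value-bound i j (All.lookup maximal (∈-tabulate⁺ j)) }

  module _ (b : BestClass m) where

    open BestClass b
    open FairSchedule m index Ds fair

    run-schedule : algorithm (encodeInstance m ℐ) ≡ encodeSchedule schedule
    run-schedule = trans (enumerate-tabulate (λ i _ → machineOf (proj₁ (best m (items entries))) i) entryOf)
      (tabulate-cong λ j → trans (cong (λ Ds → machineOf Ds (tag (itemOf j))) best≡) (sym (encode-findMachine m Ds Ds≤m (tag (itemOf j)))))

    schedule-≥ : ∀ (W : Fin k → ℚ) (κ : Fin n → Fin k) → (∀ j → weight (ℐ j) ≡ W (κ j)) →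
                 ∀ (O : Schedule m ℐ) → scheduleWeight O ℚ.≤ (pos 3 ℚ./ 2) ℚ.* (pos k ℚ./ 1) ℚ.* scheduleWeight schedule
    schedule-≥ {k} W κ wκ O = ℚ.≤-trans (opt-≤ W κ wκ 0≤β bound O) (ℚ.≤-reflexive (begin
      ι k ℚ.* (three/2 ℚ.* v)    ≡⟨ ℚ.*-assoc (ι k) three/2 v ⟨
      ι k ℚ.* three/2 ℚ.* v      ≡⟨ cong₂ ℚ._*_ (ℚ.*-comm (ι k) three/2) (sym weight-schedule) ⟩
      three/2 ℚ.* ι k ℚ.* scheduleWeight schedule ∎))
      where
      open ≡-Reasoning
      three/2 = pos 3 ℚ./ 2
      v = ι (total length Ds) ℚ.* weight (ℐ index)
      0≤v : 0ℚ ℚ.≤ v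
      0≤v = subst (ℚ._≤ v) (ℚ.*-zeroˡ (weight (ℐ index))) (ι*-mono {0} {total length Ds} (weight≥0 index) z≤n)
      0≤β : 0ℚ ℚ.≤ three/2 ℚ.* v
      0≤β = subst (ℚ._≤ three/2 ℚ.* v) (ℚ.*-zeroʳ three/2) (ℚ.*-monoˡ-≤-nonNeg three/2 0≤v)

corollary1 : ∃ λ (ALG : Prog instanceTy scheduleTy) →
    PolynomialTime ALG ×
    (∀ (m n k : ℕ) .{{_ : NonZero m}} (W : Vector ℚ k) (ℐ : Instance n) →
    Injective _≡_ _≡_ W →
    (∀ i → 0ℚ ℚ.< W i) →
    (∀ j → ∃ λ i → weight (ℐ j) ≡ W i) →
    ∃ λ (S : Schedule m ℐ) →
    run ALG (encodeInstance m ℐ) ≡ encodeSchedule S ×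
    EF1 S ×
    (∀ (OPT : Schedule m ℐ) → Optimal OPT →
    scheduleWeight OPT ℚ.≤ (pos 3 ℚ./ 2) ℚ.* (pos k ℚ./ 1) ℚ.* scheduleWeight S))
corollary1 = Poly.prog algorithmP , polynomialTime algorithmP , correct
  where
  correct : ∀ (m n k : ℕ) .{{_ : NonZero m}} (W : Vector ℚ k) (ℐ : Instance n) →
    Injective _≡_ _≡_ W → (∀ i → 0ℚ ℚ.< W i) → (∀ j → ∃ λ i → weight (ℐ j) ≡ W i) →
    ∃ λ (S : Schedule m ℐ) →
    run (Poly.prog algorithmP) (encodeInstance m ℐ) ≡ encodeSchedule S ×
    EF1 S ×
    (∀ (OPT : Schedule m ℐ) → Optimal OPT →
    scheduleWeight OPT ℚ.≤ (pos 3 ℚ./ 2) ℚ.* (pos k ℚ./ 1) ℚ.* scheduleWeight S)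
  -- Without intervals `best` has no candidate to choose from, so the empty schedule is given
  -- directly.
  correct m zero k W ℐ _ _ _ = empty , Poly.run≡ algorithmP (encodeInstance m ℐ) , (λ { _ _ _ (() , _) }) ,
    λ _ _ → ℚ.≤-reflexive (sym (ℚ.*-zeroʳ ((pos 3 ℚ./ 2) ℚ.* (pos k ℚ./ 1))))
    where
    empty : Schedule m ℐ
    empty = record { assign = λ () ; noOverlap = λ { {()} } }
  correct m (suc n) k W ℐ _ W>0 classes = FairSchedule.schedule m index Ds fair ,
    trans (Poly.run≡ algorithmP (encodeInstance m ℐ)) (run-schedule ℐ positive b) ,
    FairSchedule.schedule-EF1 m index Ds fair ,
    λ O _ → schedule-≥ ℐ positive b W (proj₁ ∘ classes) (proj₂ ∘ classes) O
    where
    positive : ∀ j → 0ℚ ℚ.< weight (ℐ j)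
    positive j = subst (0ℚ ℚ.<_) (sym (proj₂ (classes j))) (W>0 (proj₁ (classes j)))
    open Encoded ℐ positive
    b : BestClass ℐ positive m
    b = bestClass ℐ positive m (best-of (candidate m allItems) (itemOf zero) (List.tabulate (itemOf ∘ suc)) (All.tabulate⁺ {f = itemOf} λ _ → s≤s z≤n))
    open BestClass b
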